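{- Let $\Gamma$ be a nontrivial finite group and let $n \ge 3$ be an integer. Let $\mathcal{M}_{n,\Gamma}$ be the class of lifts $M$ of the cycle matroid $M(K_n^{\Gamma})$ such that a cycle of $K_n^{\Gamma}$ is a circuit of $M$ if and only if it is balanced. Then $\mathcal{M}_{n,\Gamma}$ contains a non-elementary lift (i.e. a lift whose rank exceeds that of $M(K_n^\Gamma)$ by at least $2$) in precisely the following cases: (1) $n = 3$ and $\Gamma$ has a nontrivial partition; or (2) $n \ge 4$ and $\Gamma \cong \mathbb{Z}_p^j$ for some prime $p$ and integer $j \ge 2$.
   Context: For a finite group $\Gamma$ with identity $\epsilon$ and integer $n$, $K_n^{\Gamma}$ is the graph with vertex set $[n]=\{1,\dots,n\}$ and edge set $\binom{[n]}{2}\times\Gamma$; the edge $(\{i,j\},\alpha)$ with $i<j$ is oriented from $i$ to $j$ and labeled $\alpha$. A cycle (including a $2$-edge cycle formed by two parallel edges) is balanced if, traversing it in a cyclic order and multiplying the labels, using $\alpha$ for an edge traversed along its orientation and $\alpha^{ -1}$ for an edge traversed against it, the product is $\epsilon$ (this does not depend on the starting point or direction). $M(K_n^\Gamma)$ is the cycle (graphic) matroid of $K_n^\Gamma$. Given matroids $M, L$ on a common ground set $E$, $L$ is a lift of $M$ if there is a matroid $K$ on $E\cup F$ with $M = K/F$ and $L = K\setminus F$. A nontrivial partition of $\Gamma$ is a partition of $\Gamma\setminus\{\epsilon\}$ into at least two sets $A_1,\dots,A_k$ such that each $A_i\cup\{\epsilon\}$ is a subgroup of $\Gamma$. $\mathbb{Z}_p^j$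 is the direct sum of $j$ copies of the cyclic group of order $p$. -}

module Defs where

open import Level using (0ℓ)
open import Data.Bool using (Bool; true; false; if_then_else_)
open import Data.Nat using (ℕ; zero; suc; _+_; _≤_; _<_)
open import Data.Nat.DivMod using (_mod_)
open import Data.Nat.Primality using (Prime)
open import Data.Fin using (Fin; toℕ) renaming (zero to fzero; suc to fsuc; _<_ to _<ᶠ_)
open import Data.Fin.Properties using () renaming (_≟_ to _≟ᶠ_)
open import Data.Vec using (Vec; zipWith)
open import Data.Sum using (_⊎_; [_,_])
open import Data.Product using (Σ; ∃; ∃-syntax; _×_; _,_)
open import Relation.Nullary using (¬_; does)
open import Relation.Binary.PropositionalEquality using (_≡_; _≢_)
open import Function using (_∘_; const)
open import Function.Bundles using (_↔_; _⇔_; Inverse)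
open import Function.Definitions using (Injective)
open import Algebra.Structures using (IsGroup)

record FiniteGroup : Set₁ where
  infixl 7 _∙_
  field
    Carrier : Set
    _∙_     : Carrier → Carrier → Carrier
    ε       : Carrier
    _⁻¹     : Carrier → Carrier
    isGroup : IsGroup _≡_ _∙_ ε _⁻¹
    finite  : Σ ℕ λ m → Carrier ↔ Fin m

Elt : FiniteGroup → Set
Elt = FiniteGroup.Carrier

Nontrivial : FiniteGroup → Set
Nontrivial Γ = ∃[ g ] g ≢ FiniteGroup.ε Γ

module _ (Γ : FiniteGroup) where
  open FiniteGroup Γ

  IsSubgroup : (Carrier → Set) → Set
  IsSubgroup P = P ε × (∀ x y → P x → P y → P (x ∙ y)) × (∀ x → P x → P (x ⁻¹))

  -- A nontrivial partition: Γ∖{ε} is partitioned into k ≥ 2 nonempty blocks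
  -- A_i = {g ≠ ε | c g ≡ i}, and each A_i ∪ {ε} is a subgroup.
  HasNontrivialPartition : Set
  HasNontrivialPartition =
    Σ ℕ λ k → 2 ≤ k × Σ (Carrier → Fin k) λ c →
      (∀ i → ∃[ g ] (g ≢ ε × c g ≡ i)) ×
      (∀ i → IsSubgroup (λ g → g ≡ ε ⊎ (g ≢ ε × c g ≡ i)))

addMod : ∀ {p} → Fin p → Fin p → Fin p
addMod {suc p} a b = (toℕ a + toℕ b) mod suc p

_+ᵥ_ : ∀ {p j} → Vec (Fin p) j → Vec (Fin p) j → Vec (Fin p) j
_+ᵥ_ = zipWith addMod

IsoToZpj : FiniteGroup → ℕ → ℕ → Set
IsoToZpj Γ p j = Σ (Elt Γ ↔ Vec (Fin p) j) λ f →
  ∀ x y → Inverse.to f (FiniteGroup._∙_ Γ x y) ≡ Inverse.to f x +ᵥ Inverse.to f y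

Subset : Set → Set
Subset E = E → Bool

_⊆_ : ∀ {E} → Subset E → Subset E → Set
X ⊆ Y = ∀ x → X x ≡ true → Y x ≡ true

HasSize : ∀ {E} → Subset E → ℕ → Set
HasSize {E} X k = Σ (Fin k → E) λ f →
  Injective _≡_ _≡_ f × (∀ i → X (f i) ≡ true) × (∀ e → X e ≡ true → ∃[ i ] f i ≡ e)

IsInsert : ∀ {E} → Subset E → E → Subset E → Set
IsInsert X e Z = ∀ x → (Z x ≡ true → X x ≡ true ⊎ x ≡ e) × (X x ≡ true ⊎ x ≡ e → Z x ≡ true)

IndepPred : Set → Set₁
IndepPred E = Subset E → Set

record Matroid (E : Set) : Set₁ where
  field
    Indep    : IndepPred E
    indep-∅  : Indep (const false)
    indep-⊆  : ∀ X Y → Y ⊆ X → Indep X → Indep Y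
    augment  : ∀ X Y a b → Indep X → Indep Y → HasSize X a → HasSize Y b → a < b →
               ∃[ e ] (Y e ≡ true × X e ≡ false × ∃[ Z ] (IsInsert X e Z × Indep Z))

open Matroid public

IsRank : ∀ {E} → IndepPred E → ℕ → Set
IsRank I r = (∃[ X ] (I X × HasSize X r)) × (∀ X s → I X → HasSize X s → s ≤ r)

IsCircuit : ∀ {E} → IndepPred E → Subset E → Set
IsCircuit I X = ¬ I X × (∀ Y → Y ⊆ X → (∃[ e ] (X e ≡ true × Y e ≡ false)) → I Y)

-- Contraction K/F and deletion K\F, for K on E ⊎ Fin k (F = Fin k).
IsBasisOfF : ∀ {E k} → Matroid (E ⊎ Fin k) → Subset (Fin k) → Set
IsBasisOfF K B = Indep K [ const false , B ] ×
  (∀ Z → B ⊆ Z → Indep K [ const false , Z ] → Z ⊆ B)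

ContractIndep : ∀ {E k} → Matroid (E ⊎ Fin k) → IndepPred E
ContractIndep K X = ∃[ B ] (IsBasisOfF K B × Indep K [ X , B ])

DeleteIndep : ∀ {E k} → Matroid (E ⊎ Fin k) → IndepPred E
DeleteIndep K X = Indep K [ X , const false ]

IsLift : ∀ {E} → Matroid E → IndepPred E → Set₁
IsLift {E} L M = Σ ℕ λ k → Σ (Matroid (E ⊎ Fin k)) λ K →
  (∀ X → ContractIndep K X ⇔ M X) × (∀ X → DeleteIndep K X ⇔ Indep L X)

record Edge (n : ℕ) (Γ : FiniteGroup) : Set where
  constructor edge
  field
    src   : Fin n
    tgt   : Fin n
    .lt   : src <ᶠ tgt
    label : Elt Γ

open Edge public

next : ∀ {l} → Fin (suc l) → Fin (suc l)
next {l} k = suc (toℕ k) mod suc l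

Joins : ∀ {n Γ} → Edge n Γ → Fin n → Fin n → Set
Joins e u w = (src e ≡ u × tgt e ≡ w) ⊎ (src e ≡ w × tgt e ≡ u)

-- A cycle of length m+2 (m+2 ≥ 2, so 2-edge cycles of parallel edges included):
-- distinct vertices v₀,…,v_{m+1} and distinct edges e_k joining v_k and v_{k+1 mod (m+2)}.
record Cycle (n : ℕ) (Γ : FiniteGroup) : Set where
  field
    len   : ℕ
    vert  : Fin (suc (suc len)) → Fin n
    edg   : Fin (suc (suc len)) → Edge n Γ
    vinj  : Injective _≡_ _≡_ vert
    einj  : Injective _≡_ _≡_ edg
    joins : ∀ k → Joins (edg k) (vert k) (vert (next k))

EdgeSetOf : ∀ {n Γ} → Cycle n Γ → Subset (Edge n Γ) → Set
EdgeSetOf C X = ∀ f → X f ≡ true ⇔ (∃[ k ] Cycle.edg C k ≡ f)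

prod : (Γ : FiniteGroup) (l : ℕ) → (Fin l → Elt Γ) → Elt Γ
prod Γ zero    g = FiniteGroup.ε Γ
prod Γ (suc l) g = FiniteGroup._∙_ Γ (g fzero) (prod Γ l (g ∘ fsuc))

travLabel : ∀ {n Γ} → Edge n Γ → Fin n → Elt Γ
travLabel {Γ = Γ} e u =
  if does (src e ≟ᶠ u) then label e else FiniteGroup._⁻¹ Γ (label e)

Balanced : ∀ {n Γ} → Cycle n Γ → Set
Balanced {n} {Γ} C =
  prod Γ _ (λ k → travLabel (Cycle.edg C k) (Cycle.vert C k)) ≡ FiniteGroup.ε Γ

GraphicIndep : (n : ℕ) (Γ : FiniteGroup) → IndepPred (Edge n Γ)
GraphicIndep n Γ X = ∀ (C : Cycle n Γ) Y → EdgeSetOf C Y → ¬ (Y ⊆ X)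

InClass : (n : ℕ) (Γ : FiniteGroup) → Matroid (Edge n Γ) → Set₁
InClass n Γ L = IsLift L (GraphicIndep n Γ) ×
  (∀ (C : Cycle n Γ) X → EdgeSetOf C X → (IsCircuit (Indep L) X ⇔ Balanced C))

NonElementary : (n : ℕ) (Γ : FiniteGroup) → Matroid (Edge n Γ) → Set
NonElementary n Γ L = ∃[ rM ] ∃[ rL ]
  (IsRank (GraphicIndep n Γ) rM × IsRank (Indep L) rL × rM + 2 ≤ rL)

{-# OPTIONS --safe #-}

-- Necessity.  Flats of the cycle matroid are flats of every lift L, and balanced triangles are lines of L.  For the edges
-- C h = (1,3,h) this forces the sets H_g = {h | C h ∈ cl(C ε, C g)} to be subgroups: carry the line to the edges (2,3) and
-- back by projection from edges (1,2).  They partition Γ∖{ε}, nontrivially, because a single line would make the rank of L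
-- exceed that of the cycle matroid by at most 1.  A fourth vertex makes every H_g normal; then elements of different H_g
-- commute and have the same order, so Γ is elementary abelian.  Independence in L need not be decidable, but there are
-- finitely many edge sets and the conclusions are decidable, so it may be assumed to be.
--
-- Sufficiency.  If Γ = ℤ_p^j, represent the edge (i,j,g) by (g, eᵢ - eⱼ) over F_p and let F span the first factor.  If n = 3,
-- replace the partition by the common refinement of its conjugates.  The lift is the rank-4 matroid whose lines with three
-- points are the balanced triangles and the cosets of blocks H inside a parallel class, and whose planes are the parallel
-- classes and the sets {(i,j,g) | pᵢ g pⱼ⁻¹ ∈ H} for p ∈ Γ³; the contracted set F consists of two points in general position.

module Submission where

open import Defs
open import Data.Bool using (Bool; true; false; if_then_else_; _∨_)
import Data.Bool.Properties as Bool
open import Data.Nat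
  using (ℕ; zero; suc; _+_; _*_; _∸_; _≤_; _<_; z≤n; s≤s; z<s; s<s; NonZero; >-nonZero; >-nonZero⁻¹; nonTrivial⇒n>1)
import Data.Nat.Properties as ℕ
open import Data.Nat.DivMod
  using (_%_; _/_; m≡m%n+[m/n]*n; m%n<n; m<n⇒m%n≡m; n%n≡0; %-distribˡ-+; m%n%n≡m%n; [m+n]%n≡m%n; m*n%n≡0)
open import Data.Nat.Divisibility using (divides)
open import Data.Nat.Primality using (Prime; prime; prime⇒nonZero; prime⇒nonTrivial; composite)
open import Data.Nat.Coprimality using (prime⇒coprime; coprime-Bézout)
open import Data.Nat.GCD using (module Bézout)
open import Data.Fin
  using (Fin; toℕ; fromℕ; fromℕ<; inject₁; inject≤; punchIn; punchOut; combine; remQuot; splitAt; _↑ˡ_;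
    _↑ʳ_) renaming (zero to fzero; suc to fsuc; _<_ to _<ᶠ_)
import Data.Fin.Properties as Fin
open import Data.Fin.Induction using (<-weakInduction; >-weakInduction)
open import Data.Fin.Relation.Unary.Top using (view; ‵fromℕ; ‵inject₁)
open import Data.Vec using (Vec; []; _∷_; lookup; tabulate; replicate)
import Data.Vec.Properties as Vec
open import Data.List using (List; []; _∷_; _++_; length; map; filter; cartesianProduct)
import Data.List as List
import Data.List.Properties as List
open import Data.List.Relation.Unary.Any using (Any; here; there; index; any?)
import Data.List.Relation.Unary.Any as Any
import Data.List.Relation.Unary.Any.Properties as Any
import Data.List.Relation.Unary.All as All
open import Data.List.Membership.Propositional using (_∈_; _∉_; find; lose)
open import Data.List.Membership.Propositional.Properties
  using (∈-++⁺ˡ; ∈-++⁺ʳ; ∈-++⁻; ∈-map⁺; ∈-map⁻; ∈-allFin; ∈-cartesianProduct⁺; ∈-filter⁺; ∈-filter⁻; ∈-lookup; ∈-tabulate⁺;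
    ∈-tabulate⁻)
open import Data.Sum using (_⊎_; inj₁; inj₂; [_,_]; [_,_]′)
import Data.Sum.Properties as Sum
open import Data.Product using (Σ; ∃; ∃-syntax; _×_; _,_; proj₁; proj₂)
open import Data.Empty using (⊥; ⊥-elim)
open import Data.Unit using (⊤; tt)
open import Relation.Nullary using (recompute; ¬_; Dec; yes; no; does; contradiction; ¬?; _×-dec_; _⊎-dec_; _→-dec_)
open import Relation.Nullary.Decidable using (map′; decidable-stable; dec-true; dec-false)
open import Relation.Binary.Definitions using (DecidableEquality)
open import Relation.Binary.PropositionalEquality
  using (_≡_; _≢_; refl; sym; trans; cong; cong₂; subst; subst₂; module ≡-Reasoning)
open import Function using (_∘_; const; id; case_of_)
open import Function.Bundles using (_⇔_; Inverse; Equivalence; mk⇔; mk↔ₛ′)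
open import Function.Definitions using (Injective)
open import Algebra.Bundles using (Group)
open import Algebra.Structures using (IsGroup)
import Algebra.Properties.Group as GroupProperties

-- Enumerations of finite types

-- Why flats survive: with M = K/F, and L obtained from K by deleting F, the closure of a set X in L
-- is contained in its closure in M. Hence if p lies off a flat S of M and X is a subset of S, then
-- exchange shows that X ∪ p has no closure points in S beyond the closure of X. This is the
-- projection on which necessity rests: an auxiliary edge is added to a configuration, used to build
-- balanced triangles, and dropped once the conclusion lies back in S. All flats used are
-- complements of vertex cuts.
--
-- Why the partition is refined for n = 3: a potential p describing a plane can be multiplied on the
-- left by a constant c, and this conjugates all the values pᵢ g pⱼ⁻¹ by c. Three noncollinear
-- points therefore determine a plane only if conjugation permutes the blocks, which holds for the
-- common refinement of the conjugates but not for an arbitrary partition. A fourth vertex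
-- strengthens this to normality of every single block. The set F has two points because the lift
-- has rank 4 while the cycle matroid of a triangle has rank 2.

Enum : Set → Set
Enum A = Σ (List A) λ xs → ∀ a → a ∈ xs

enum-Fin : ∀ n → Enum (Fin n)
enum-Fin n = List.allFin n , ∈-allFin

enum-⊎ : ∀ {A B} → Enum A → Enum B → Enum (A ⊎ B)
enum-⊎ (xs , p) (ys , q) = map inj₁ xs ++ map inj₂ ys , λ where
  (inj₁ a) → ∈-++⁺ˡ (∈-map⁺ inj₁ (p a))
  (inj₂ b) → ∈-++⁺ʳ (map inj₁ xs) (∈-map⁺ inj₂ (q b))

enum-× : ∀ {A B} → Enum A → Enum B → Enum (A × B)
enum-× (xs , p) (ys , q) = cartesianProduct xs ys , λ (a , b) → ∈-cartesianProduct⁺ (p a) (q b)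

enum-image : ∀ {A B} (f : A → B) → (∀ b → ∃[ a ] f a ≡ b) → Enum A → Enum B
enum-image f surj (xs , p) = map f xs , λ b → subst (_∈ map f xs) (proj₂ (surj b)) (∈-map⁺ f (p (proj₁ (surj b))))

enum-filter : ∀ {A} {Q : A → Set} → (∀ a → Dec (Q a)) → (∀ {a} (q q′ : Q a) → q ≡ q′) → Enum A → Enum (Σ A Q)
enum-filter {A} {Q} Q? irr (xs , p) = go xs , λ (a , q) → mem a q (p a)
  where
  go : List A → List (Σ A Q)
  go [] = []
  go (x ∷ xs) with Q? x
  ... | yes q = (x , q) ∷ go xs
  ... | no _ = go xs
  mem : ∀ a q {xs} → a ∈ xs → (a , q) ∈ go xs
  mem a q {x ∷ xs} (here refl) with Q? x
  ... | yes q′ = here (cong (a ,_) (irr q q′))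
  ... | no ¬q = contradiction q ¬q
  mem a q {x ∷ xs} (there m) with Q? x
  ... | yes _ = there (mem a q m)
  ... | no _ = mem a q m

∃-dec : ∀ {ℓ A} {Q : A → Set ℓ} → Enum A → (∀ a → Dec (Q a)) → Dec (∃ Q)
∃-dec (xs , p) Q? = map′ (λ m → let (a , _ , q) = find m in a , q) (λ (a , q) → lose (p a) q) (any? Q? xs)

∀-dec : ∀ {ℓ A} {Q : A → Set ℓ} → Enum A → (∀ a → Dec (Q a)) → Dec (∀ a → Q a)
∀-dec (xs , p) Q? = map′ (λ al a → All.lookup al (p a)) (λ f → All.tabulate (λ {a} _ → f a)) (All.all? Q? xs)

∃-dec-Vec : ∀ {n} {Q : Vec Bool n → Set} → (∀ v → Dec (Q v)) → Dec (∃ Q)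
∃-dec-Vec {zero} Q? = map′ (λ q → [] , q) (λ { ([] , q) → q }) (Q? [])
∃-dec-Vec {suc n} {Q} Q? = map′
  (λ { (inj₁ (v , q)) → true ∷ v , q ; (inj₂ (v , q)) → false ∷ v , q })
  (λ { (true ∷ v , q) → inj₁ (v , q) ; (false ∷ v , q) → inj₂ (v , q) })
  (∃-dec-Vec (λ v → Q? (true ∷ v)) ⊎-dec ∃-dec-Vec (λ v → Q? (false ∷ v)))

-- Double negation commutes with a universal quantifier over a finite type. This is what allows
-- decidability of independence to be assumed while proving a stable goal.
¬¬-∀-Vec : ∀ {n} {Q : Vec Bool n → Set} → (∀ v → ¬ ¬ Q v) → ¬ ¬ (∀ v → Q v)
¬¬-∀-Vec {zero} f k = f [] (λ q → k λ { [] → q })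
¬¬-∀-Vec {suc n} f k =
  ¬¬-∀-Vec (λ v → f (true ∷ v)) λ p → ¬¬-∀-Vec (λ v → f (false ∷ v)) λ q →
  k λ { (true ∷ v) → p v ; (false ∷ v) → q v }

¬¬-dec : ∀ {A : Set} → ¬ ¬ Dec A
¬¬-dec k = k (no (λ a → k (yes a)))

-- Subsets are coded by bit vectors along the enumeration. Decoding returns a subset only up to
-- pointwise equality, hence the hypothesis that `Q` respects it.
¬¬-dec-subsets : ∀ {A} → Enum A → (Q : (A → Bool) → Set) →
  (∀ {X Y} → (∀ a → X a ≡ Y a) → Q X → Q Y) → ¬ ¬ (∀ X → Dec (Q X))
¬¬-dec-subsets {A} (xs , p) Q ext k = ¬¬-∀-Vec {Q = λ v → Dec (Q (decode v))} (λ _ → ¬¬-dec) λ dec →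
  k λ X → map′ (ext (decode-code X)) (ext (λ a → sym (decode-code X a))) (dec (code X))
  where
  decode : Vec Bool (length xs) → A → Bool
  decode v a = lookup v (index (p a))
  code : (A → Bool) → Vec Bool (length xs)
  code X = tabulate (X ∘ List.lookup xs)
  decode-code : ∀ X a → decode (code X) a ≡ X a
  decode-code X a = trans (Vec.lookup∘tabulate (X ∘ List.lookup xs) (index (p a))) (cong X (sym (Any.lookup-index (p a))))

injective⇒surjective : ∀ {n} {f : Fin n → Fin n} → Injective _≡_ _≡_ f → ∀ j → ∃[ i ] f i ≡ j
injective⇒surjective {suc n} {f} inj j with Fin.any? (λ i → f i Fin.≟ j)
... | yes r = r
... | no ¬r = contradiction
  (λ {a} {b} eq → inj (Fin.punchOut-injective (λ e → ¬r (a , sym e)) (λ e → ¬r (b , sym e)) eq))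
  (Fin.<⇒notInjective {f = λ i → punchOut {i = j} {j = f i} (λ e → ¬r (i , sym e))} ℕ.≤-refl)

-- Pigeonhole: if every `g j` were a value of `f`, choosing preimages would embed `Fin b` into
-- `Fin a`.
escape : ∀ {A : Set} → DecidableEquality A → ∀ {a b} (f : Fin a → A) (g : Fin b → A) →
  Injective _≡_ _≡_ g → a < b → ∃[ j ] (∀ i → f i ≢ g j)
escape _≟_ {a} {b} f g g-inj a<b with Fin.any? (λ j → Fin.all? (λ i → ¬? (f i ≟ g j)))
... | yes r = r
... | no ¬r = contradiction (λ {x} {y} → h-inj {x} {y}) (Fin.<⇒notInjective {f = proj₁ ∘ hit} a<b)
  where
  hit : ∀ j → ∃[ i ] f i ≡ g j
  hit j with Fin.any? (λ i → f i ≟ g j)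
  ... | yes r = r
  ... | no n = contradiction (j , λ i e → n (i , e)) ¬r
  h-inj : Injective _≡_ _≡_ (proj₁ ∘ hit)
  h-inj {x} {y} e = g-inj (trans (sym (proj₂ (hit x))) (trans (cong f e) (proj₂ (hit y))))

-- Cyclic sequences

module _ {l : ℕ} where
  next-inject₁ : (i : Fin l) → next (inject₁ i) ≡ fsuc i
  next-inject₁ i = Fin.toℕ-injective (trans (Fin.toℕ-fromℕ< _)
    (trans (m<n⇒m%n≡m (s<s (subst (_< l) (sym (Fin.toℕ-inject₁ i)) (Fin.toℕ<n i)))) (cong suc (Fin.toℕ-inject₁ i))))

  next-fromℕ : next (fromℕ l) ≡ fzero
  next-fromℕ = Fin.toℕ-injective (trans (Fin.toℕ-fromℕ< _)
    (trans (cong (λ m → suc m % suc l) (Fin.toℕ-fromℕ l)) (n%n≡0 (suc l))))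

  module Around (R : Fin (suc l) → Fin (suc l) → Set)
    (R-refl : ∀ {i} → R i i) (R-sym : ∀ {i j} → R i j → R j i) (R-trans : ∀ {i j k} → R i j → R j k → R i k)
    where

    private
      prefix : ∀ j → (∀ i → toℕ i < toℕ j → R i (next i)) → R fzero j
      prefix = <-weakInduction _ (λ _ → R-refl) λ i ih st →
        R-trans (ih (λ i′ lt → st i′ (ℕ.m<n⇒m<1+n (subst (toℕ i′ <_) (Fin.toℕ-inject₁ i) lt))))
                (subst (R (inject₁ i)) (next-inject₁ i) (st (inject₁ i) (ℕ.≤-reflexive (cong suc (Fin.toℕ-inject₁ i)))))

      suffix : ∀ j → (∀ i → toℕ j ≤ toℕ i → i ≢ fromℕ l → R i (next i)) → R j (fromℕ l)
      suffix = >-weakInduction _ (λ _ → R-refl) λ i ih st →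
        R-trans (subst (R (inject₁ i)) (next-inject₁ i) (st (inject₁ i) ℕ.≤-refl (λ e → Fin.fromℕ≢inject₁ (sym e))))
                (ih (λ i′ le → st i′ (ℕ.≤-trans (ℕ.≤-reflexive (Fin.toℕ-inject₁ i)) (ℕ.≤-trans (ℕ.n≤1+n _) le))))

    -- Step `k` is replaced by the way round the other side: back to 0, across the closing step, and
    -- down from the end. `R` is equality of colours across a cut in one use and membership of a
    -- difference vector in a subspace in another.
    around : ∀ k → (∀ i → i ≢ k → R i (next i)) → R k (next k)
    around k st with view k
    ... | ‵fromℕ = subst (R (fromℕ l)) (sym next-fromℕ)
          (R-sym (prefix (fromℕ l) (λ i lt → st i (λ e → ℕ.<-irrefl (cong toℕ e) lt))))
    ... | ‵inject₁ i = subst (R (inject₁ i)) (sym (next-inject₁ i))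
          (R-trans (R-sym (prefix (inject₁ i) (λ j lt → st j (λ e → ℕ.<-irrefl (cong toℕ e) lt))))
            (R-trans (R-sym (subst (R (fromℕ l)) next-fromℕ (st (fromℕ l) Fin.fromℕ≢inject₁)))
              (R-sym (suffix (fsuc i) (λ j le _ → st j (λ e →
                ℕ.<-irrefl refl (ℕ.≤-trans le (ℕ.≤-reflexive (trans (cong toℕ e) (Fin.toℕ-inject₁ i))))))))))

-- Finite groups

module GroupFacts (Γ : FiniteGroup) where
  open FiniteGroup Γ public
  open IsGroup isGroup public using (assoc; identityˡ; identityʳ; inverseˡ; inverseʳ)

  group : Group _ _
  group = record { isGroup = isGroup }

  open GroupProperties group public using (⁻¹-involutive; ⁻¹-anti-homo-∙; ∙-cancelˡ; ∙-cancelʳ; ε⁻¹≈ε; inverseˡ-unique;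
    inverseʳ-unique)

  infixl 7 _//_
  _//_ : Carrier → Carrier → Carrier
  x // y = x ∙ y ⁻¹

  cancelᵐ : ∀ x y z → (x ∙ y) ∙ (y ⁻¹ ∙ z) ≡ x ∙ z
  cancelᵐ x y z = trans (assoc x y _) (cong (x ∙_)
    (trans (sym (assoc y (y ⁻¹) z)) (trans (cong (_∙ z) (inverseʳ y)) (identityˡ z))))

  cancelᵐ′ : ∀ x y z → (x ∙ y ⁻¹) ∙ (y ∙ z) ≡ x ∙ z
  cancelᵐ′ x y z = trans (assoc x _ _) (cong (x ∙_)
    (trans (sym (assoc (y ⁻¹) y z)) (trans (cong (_∙ z) (inverseˡ y)) (identityˡ z))))

  x⁻¹∙xy : ∀ x y → x ⁻¹ ∙ (x ∙ y) ≡ y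
  x⁻¹∙xy x y = trans (sym (assoc _ x y)) (trans (cong (_∙ y) (inverseˡ x)) (identityˡ y))

  x∙x⁻¹y : ∀ x y → x ∙ (x ⁻¹ ∙ y) ≡ y
  x∙x⁻¹y x y = trans (sym (assoc x _ y)) (trans (cong (_∙ y) (inverseʳ x)) (identityˡ y))

  xy∙y⁻¹ : ∀ x y → (x ∙ y) ∙ y ⁻¹ ≡ x
  xy∙y⁻¹ x y = trans (assoc x y _) (trans (cong (x ∙_) (inverseʳ y)) (identityʳ x))

  xy⁻¹∙y : ∀ x y → (x ∙ y ⁻¹) ∙ y ≡ x
  xy⁻¹∙y x y = trans (assoc x _ y) (trans (cong (x ∙_) (inverseˡ y)) (identityʳ x))

  xy⁻¹≡ε⇒x≡y : ∀ {x y} → x ∙ y ⁻¹ ≡ ε → x ≡ y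
  xy⁻¹≡ε⇒x≡y {x} {y} e = trans (sym (xy⁻¹∙y x y)) (trans (cong (_∙ y) e) (identityˡ y))

  order : ℕ
  order = proj₁ finite

  code : Carrier → Fin order
  code = Inverse.to (proj₂ finite)

  uncode : Fin order → Carrier
  uncode = Inverse.from (proj₂ finite)

  uncode-code : ∀ x → uncode (code x) ≡ x
  uncode-code = Inverse.strictlyInverseʳ (proj₂ finite)

  code-injective : ∀ {x y} → code x ≡ code y → x ≡ y
  code-injective {x} {y} e = trans (sym (uncode-code x)) (trans (cong uncode e) (uncode-code y))

  enum : Enum Carrier
  enum = enum-image uncode (λ x → code x , uncode-code x) (enum-Fin order)

  infix 4 _≟_
  _≟_ : DecidableEquality Carrier
  x ≟ y = map′ code-injective (cong code) (code x Fin.≟ code y)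

  prefixProd : ∀ {l} → (Fin (suc l) → Carrier) → Fin (suc l) → Carrier
  prefixProd t fzero = ε
  prefixProd {suc l} t (fsuc i) = t fzero ∙ prefixProd (t ∘ fsuc) i

  prefixProd-suc : ∀ {l} (t : Fin (suc l) → Carrier) (i : Fin l) →
    prefixProd t (inject₁ i) ∙ t (inject₁ i) ≡ prefixProd t (fsuc i)
  prefixProd-suc t fzero = trans (identityˡ _) (sym (identityʳ _))
  prefixProd-suc {suc l} t (fsuc i) = trans (assoc _ _ _) (cong (t fzero ∙_) (prefixProd-suc (t ∘ fsuc) i))

  prefixProd-last : ∀ {l} (t : Fin (suc l) → Carrier) → prefixProd t (fromℕ l) ∙ t (fromℕ l) ≡ prod Γ (suc l) t
  prefixProd-last {zero} t = trans (identityˡ _) (sym (identityʳ _))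
  prefixProd-last {suc l} t = trans (assoc _ _ _) (cong (t fzero ∙_) (prefixProd-last (t ∘ fsuc)))

  -- The labels round the cycle are successive differences of `h`. This turns balance, an ordered
  -- product, into a condition on each edge separately.
  Potential : ∀ {l} → (Fin (suc l) → Carrier) → (Fin (suc l) → Carrier) → Set
  Potential t h = ∀ i → t i ≡ h i ⁻¹ ∙ h (next i)

  prod≡ε⇒potential : ∀ {l} (t : Fin (suc l) → Carrier) → prod Γ (suc l) t ≡ ε → Potential t (prefixProd t)
  prod≡ε⇒potential {l} t e i with view i
  ... | ‵fromℕ = begin
      t (fromℕ l)                                                ≡⟨ x⁻¹∙xy _ _ ⟨
      p (fromℕ l) ⁻¹ ∙ (p (fromℕ l) ∙ t (fromℕ l))               ≡⟨ cong (p (fromℕ l) ⁻¹ ∙_) (trans (prefixProd-last t) e) ⟩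
      p (fromℕ l) ⁻¹ ∙ ε                                         ≡⟨ cong (λ j → p (fromℕ l) ⁻¹ ∙ p j) next-fromℕ ⟨
      p (fromℕ l) ⁻¹ ∙ p (next (fromℕ l))                        ∎
    where
    open ≡-Reasoning
    p = prefixProd t
  ... | ‵inject₁ j = trans (sym (x⁻¹∙xy (p (inject₁ j)) _))
      (cong (p (inject₁ j) ⁻¹ ∙_) (trans (prefixProd-suc t j) (cong p (sym (next-inject₁ j)))))
    where p = prefixProd t

  potential⇒prod≡ε : ∀ {l} (t h : Fin (suc l) → Carrier) → Potential t h → prod Γ (suc l) t ≡ ε
  potential⇒prod≡ε {l} t h pot = begin
    prod Γ (suc l) t                                               ≡⟨ prefixProd-last t ⟨
    prefixProd t (fromℕ l) ∙ t (fromℕ l)                           ≡⟨ cong₂ _∙_ (pre (fromℕ l)) (pot (fromℕ l)) ⟩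
    (h fzero ⁻¹ ∙ h (fromℕ l)) ∙ (h (fromℕ l) ⁻¹ ∙ h (next (fromℕ l))) ≡⟨ cancelᵐ _ _ _ ⟩
    h fzero ⁻¹ ∙ h (next (fromℕ l))                                ≡⟨ cong (λ j → h fzero ⁻¹ ∙ h j) next-fromℕ ⟩
    h fzero ⁻¹ ∙ h fzero                                           ≡⟨ inverseˡ _ ⟩
    ε                                                              ∎
    where
    open ≡-Reasoning
    pre : ∀ i → prefixProd t i ≡ h fzero ⁻¹ ∙ h i
    pre = <-weakInduction _ (sym (inverseˡ _)) λ i ih → trans (sym (prefixProd-suc t i))
      (trans (cong₂ _∙_ ih (trans (pot (inject₁ i)) (cong (λ j → h (inject₁ i) ⁻¹ ∙ h j) (next-inject₁ i)))) (cancelᵐ _ _ _))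

-- Lists and subsets

does⁻ : ∀ {A : Set} (d : Dec A) → does d ≡ true → A
does⁻ (yes a) _ = a

∨⁻ : ∀ b {c} → b ∨ c ≡ true → b ≡ true ⊎ c ≡ true
∨⁻ true _ = inj₁ refl
∨⁻ false e = inj₂ e

module _ {A : Set} where
  infix 4 _⊑_
  _⊑_ : List A → List A → Set
  xs ⊑ ys = ∀ {x} → x ∈ xs → x ∈ ys

  ∷-⊑ : ∀ {x xs ys} → x ∈ ys → xs ⊑ ys → (x ∷ xs) ⊑ ys
  ∷-⊑ m _ (here refl) = m
  ∷-⊑ _ s (there m) = s m

  ++-⊑ : ∀ xs {ys zs} → xs ⊑ zs → ys ⊑ zs → (xs ++ ys) ⊑ zs
  ++-⊑ xs s t m = [ s , t ] (∈-++⁻ xs m)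

  ++-mono-⊑ : ∀ xs {ys xs′ ys′} → xs ⊑ xs′ → ys ⊑ ys′ → (xs ++ ys) ⊑ (xs′ ++ ys′)
  ++-mono-⊑ xs {xs′ = xs′} s t = ++-⊑ xs (λ m → ∈-++⁺ˡ (s m)) (λ m → ∈-++⁺ʳ xs′ (t m))

  split-∈ : ∀ {x : A} {xs} → x ∈ xs → ∃[ as ] ∃[ bs ] xs ≡ as ++ x ∷ bs
  split-∈ (here refl) = [] , _ , refl
  split-∈ {xs = y ∷ _} (there m) with split-∈ m
  ... | as , bs , refl = y ∷ as , bs , refl

  ∈-delete : ∀ as {bs} {w x : A} → x ∈ as ++ w ∷ bs → x ≢ w → x ∈ as ++ bs
  ∈-delete as m x≢w with ∈-++⁻ as m
  ... | inj₁ p = ∈-++⁺ˡ p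
  ... | inj₂ (here e) = contradiction e x≢w
  ... | inj₂ (there p) = ∈-++⁺ʳ as p

  length-delete : ∀ as {bs} {w : A} → length (as ++ w ∷ bs) ≡ suc (length (as ++ bs))
  length-delete [] = refl
  length-delete (_ ∷ as) = cong suc (length-delete as)

  Distinct : List A → Set
  Distinct [] = ⊤
  Distinct (x ∷ xs) = x ∉ xs × Distinct xs

  lookup-injective : ∀ {xs : List A} → Distinct xs → Injective _≡_ _≡_ (List.lookup xs)
  lookup-injective {x ∷ xs} _ {fzero} {fzero} _ = refl
  lookup-injective {x ∷ xs} (n , _) {fzero} {fsuc j} e = contradiction (subst (_∈ xs) (sym e) (∈-lookup j)) n
  lookup-injective {x ∷ xs} (n , _) {fsuc i} {fzero} e = contradiction (subst (_∈ xs) e (∈-lookup i)) n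
  lookup-injective {x ∷ xs} (_ , d) {fsuc i} {fsuc j} e = cong fsuc (lookup-injective d e)

  tabulate-distinct : ∀ {k} {f : Fin k → A} → Injective _≡_ _≡_ f → Distinct (List.tabulate f)
  tabulate-distinct {zero} _ = tt
  tabulate-distinct {suc k} {f} inj =
    (λ m → case ∈-tabulate⁻ m of λ { (i , e) → case inj e of λ () }) ,
    tabulate-distinct (λ e → Fin.suc-injective (inj e))

module Subsets {A : Set} (_≟_ : DecidableEquality A) where
  infix 4 _∈?_
  _∈?_ : ∀ x xs → Dec (x ∈ xs)
  x ∈? xs = any? (x ≟_) xs

  abstract
    toSubset : List A → Subset A
    toSubset xs x = does (x ∈? xs)

    toSubset⁺ : ∀ {x xs} → x ∈ xs → toSubset xs x ≡ true
    toSubset⁺ {x} {xs} = dec-true (x ∈? xs)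

    toSubset⁻ : ∀ {x} xs → toSubset xs x ≡ true → x ∈ xs
    toSubset⁻ {x} xs = does⁻ (x ∈? xs)

    ∉⇒toSubset-false : ∀ {x} xs → x ∉ xs → toSubset xs x ≡ false
    ∉⇒toSubset-false {x} xs = dec-false (x ∈? xs)

  toSubset-∉ : ∀ {x} xs → toSubset xs x ≡ false → x ∉ xs
  toSubset-∉ xs e m = contradiction (trans (sym e) (toSubset⁺ m)) λ ()

  toSubset-mono : ∀ xs {ys} → xs ⊑ ys → toSubset xs ⊆ toSubset ys
  toSubset-mono xs s x e = toSubset⁺ (s (toSubset⁻ xs e))

  toSubset-size : ∀ {xs} → Distinct xs → HasSize (toSubset xs) (length xs)
  toSubset-size {xs} d = List.lookup xs , lookup-injective d , (λ i → toSubset⁺ {xs = xs} (∈-lookup i)) ,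
    λ x e → index (toSubset⁻ xs e) , sym (Any.lookup-index (toSubset⁻ xs e))

-- Pregeometries and matroids

-- A matroid presented by its closure operator, on finite lists whose order and repetitions are
-- irrelevant by `cl-mono`. Decidability of `Cl` makes bases computable.
record Pregeometry (P : Set) : Set₁ where
  field
    Cl : List P → P → Set
    cl? : ∀ xs y → Dec (Cl xs y)
    cl-∈ : ∀ {xs x} → x ∈ xs → Cl xs x
    cl-trans : ∀ {xs ys z} → (∀ {y} → y ∈ ys → Cl xs y) → Cl ys z → Cl xs z
    cl-exchange : ∀ {xs x y} → Cl (x ∷ xs) y → ¬ Cl xs y → Cl (y ∷ xs) x

  cl-mono : ∀ {xs ys z} → xs ⊑ ys → Cl xs z → Cl ys z
  cl-mono s = cl-trans (λ m → cl-∈ (s m))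

  Ind : List P → Set
  Ind [] = ⊤
  Ind (x ∷ xs) = ¬ Cl xs x × Ind xs

  -- With the list built up from the right, `x` is the element whose arrival first brings `y` into
  -- the closure.
  exchange-++ : ∀ xs {zs y} → Cl (xs ++ zs) y → ¬ Cl zs y →
    ∃[ as ] ∃[ x ] ∃[ bs ] (xs ≡ as ++ x ∷ bs × Cl (y ∷ bs ++ zs) x × ¬ Cl (bs ++ zs) x)
  exchange-++ [] c n = contradiction c n
  exchange-++ (x ∷ xs) {zs} {y} c n with cl? (xs ++ zs) y
  ... | no n′ = [] , x , xs , refl , cl-exchange c n′ ,
        λ cx → n′ (cl-trans (λ { (here refl) → cx ; (there m) → cl-∈ m }) c)
  ... | yes c′ with exchange-++ xs c′ n
  ...   | as , x′ , bs , refl , c″ , n″ = x ∷ as , x′ , bs , refl , c″ , n″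

  -- Each further `y` takes the place of one element of the current complement `zs`, found by
  -- `exchange-++`, so the total length stays that of `xs`.
  steinitz-complete : ∀ ys {xs} → Ind ys → (∀ {y} → y ∈ ys → Cl xs y) →
    ∃[ zs ] (length ys + length zs ≡ length xs × (∀ {x} → x ∈ xs → Cl (zs ++ ys) x))
  steinitz-complete [] {xs} _ _ = xs , refl , λ m → cl-∈ (∈-++⁺ˡ m)
  steinitz-complete (y ∷ ys) (ny , ind) sp with steinitz-complete ys ind (λ m → sp (there m))
  ... | zs , len , sp′ with exchange-++ zs (cl-trans sp′ (sp (here refl))) ny
  ...   | as , z , bs , refl , cz , _ = as ++ bs ,
    trans (sym (ℕ.+-suc (length ys) _)) (trans (cong (length ys +_) (sym (length-delete as))) len) ,
    λ m → cl-trans step (sp′ m)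
    where
    step : ∀ {v} → v ∈ (as ++ z ∷ bs) ++ ys → Cl ((as ++ bs) ++ y ∷ ys) v
    step m with ∈-++⁻ (as ++ z ∷ bs) m
    ... | inj₂ p = cl-∈ (∈-++⁺ʳ (as ++ bs) (there p))
    ... | inj₁ p with ∈-++⁻ as p
    ...   | inj₁ q = cl-∈ (∈-++⁺ˡ (∈-++⁺ˡ q))
    ...   | inj₂ (here refl) = cl-mono (∷-⊑ (∈-++⁺ʳ (as ++ bs) (here refl))
            (++-mono-⊑ bs (∈-++⁺ʳ as) there)) cz
    ...   | inj₂ (there q) = cl-∈ (∈-++⁺ˡ (∈-++⁺ʳ as q))

  steinitz : ∀ ys {xs} → Ind ys → (∀ {y} → y ∈ ys → Cl xs y) → length ys ≤ length xs
  steinitz ys ind sp with steinitz-complete ys ind sp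
  ... | zs , len , _ = subst (length ys ≤_) len (ℕ.m≤m+n _ _)

  -- `Ind` is defined along the order of a list; this frees it from that order. If `w` were in the
  -- closure of `ws`, then `ys` with `w` removed would still span `ys`, against `steinitz`.
  ind-separated : ∀ {ys ws w} → Ind ys → w ∈ ys → ws ⊑ ys → w ∉ ws → ¬ Cl ws w
  ind-separated {ws = ws} {w} ind m s n c with split-∈ m
  ... | as , bs , refl = ℕ.<-irrefl refl
    (ℕ.≤-trans (ℕ.≤-reflexive (sym (length-delete as))) (steinitz (as ++ w ∷ bs) ind spans))
    where
    ws⊑ : ws ⊑ as ++ bs
    ws⊑ {x} m = ∈-delete as (s m) λ { refl → n m }
    spans : ∀ {y} → y ∈ as ++ w ∷ bs → Cl (as ++ bs) y
    spans m with ∈-++⁻ as m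
    ... | inj₁ p = cl-∈ (∈-++⁺ˡ p)
    ... | inj₂ (here refl) = cl-mono ws⊑ c
    ... | inj₂ (there p) = cl-∈ (∈-++⁺ʳ as p)

  ind⇒distinct : ∀ {ys} → Ind ys → Distinct ys
  ind⇒distinct {[]} _ = tt
  ind⇒distinct {y ∷ ys} (n , i) = (λ m → n (cl-∈ m)) , ind⇒distinct i

  basis : ∀ xs → ∃[ ys ] (ys ⊑ xs × Ind ys × (∀ {x} → x ∈ xs → Cl ys x))
  basis [] = [] , id , tt , λ ()
  basis (x ∷ xs) with basis xs
  ... | ys , s , i , sp with cl? ys x
  ...   | yes c = ys , (λ m → there (s m)) , i , λ { (here refl) → c ; (there m) → sp m }
  ...   | no n = x ∷ ys , ∷-⊑ (here refl) (λ m → there (s m)) , (n , i) ,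
    λ { (here refl) → cl-∈ (here refl) ; (there m) → cl-mono there (sp m) }

  -- Independence tested on finite lists drawn from `X`, so that `X` itself never has to be
  -- enumerated.
  IndSet : Subset P → Set
  IndSet X = ∀ ws w → (∀ {x} → x ∈ ws → X x ≡ true) → X w ≡ true → w ∉ ws → ¬ Cl ws w

  ind⇒indSet : ∀ {ys X} → Ind ys → (∀ x → X x ≡ true → x ∈ ys) → IndSet X
  ind⇒indSet ind s ws w wsX wX n = ind-separated ind (s w wX) (λ m → s _ (wsX m)) n

  indSet-distinct⇒ind : ∀ {X} → IndSet X → ∀ {ys} → Distinct ys → (∀ {y} → y ∈ ys → X y ≡ true) → Ind ys
  indSet-distinct⇒ind ind {[]} _ _ = tt
  indSet-distinct⇒ind ind {y ∷ ys} (n , d) s = ind ys y (s ∘ there) (s (here refl)) n , indSet-distinct⇒ind ind d (s ∘ there)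

  indSet⇒ind : ∀ {X} → IndSet X → ∀ {k} (f : Fin k → P) → Injective _≡_ _≡_ f → (∀ i → X (f i) ≡ true) →
    Ind (List.tabulate f)
  indSet⇒ind ind f inj fX = indSet-distinct⇒ind ind (tabulate-distinct inj) λ m →
    case ∈-tabulate⁻ m of λ { (i , refl) → fX i }

module _ {P : Set} (G : Pregeometry P) where
  open Pregeometry G

  -- Contraction of `fs`, whose elements stay in the ground set as loops; a `pullback` along an
  -- inclusion then removes them.
  localize : List P → Pregeometry P
  localize fs = record
    { Cl = λ xs → Cl (xs ++ fs)
    ; cl? = λ xs → cl? (xs ++ fs)
    ; cl-∈ = λ m → cl-∈ (∈-++⁺ˡ m)
    ; cl-trans = λ {xs} {ys} sp → cl-trans λ m → [ sp , (λ p → cl-∈ (∈-++⁺ʳ xs p)) ] (∈-++⁻ ys m)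
    ; cl-exchange = cl-exchange }

  pullback : ∀ {Q} → (Q → P) → Pregeometry Q
  pullback g = record
    { Cl = λ xs y → Cl (map g xs) (g y)
    ; cl? = λ xs y → cl? (map g xs) (g y)
    ; cl-∈ = λ m → cl-∈ (∈-map⁺ g m)
    ; cl-trans = λ sp → cl-trans λ m → case ∈-map⁻ g m of λ { (_ , p , refl) → sp p }
    ; cl-exchange = cl-exchange }

  module _ (_≟_ : DecidableEquality P) where
    open Subsets _≟_

    pregeometryMatroid : Matroid P
    pregeometryMatroid = record
      { Indep = IndSet
      ; indep-∅ = λ _ _ _ e → contradiction e λ ()
      ; indep-⊆ = λ X Y s ind ws w wsY wY → ind ws w (λ m → s _ (wsY m)) (s w wY)
      ; augment = aug }
      where
      aug : ∀ X Y a b → IndSet X → IndSet Y → HasSize X a → HasSize Y b → a < b →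
        ∃[ e ] (Y e ≡ true × X e ≡ false × ∃[ Z ] (IsInsert X e Z × IndSet Z))
      aug X Y a b indX indY (f , f-inj , fX , f-sur) (g , g-inj , gY , _) a<b
        with Fin.any? (λ j → ¬? (cl? (List.tabulate f) (g j)))
      ... | no none = contradiction (ℕ.<-≤-trans a<b
              (subst₂ _≤_ (List.length-tabulate g) (List.length-tabulate f)
                (steinitz (List.tabulate g) (indSet⇒ind indY g g-inj gY)
                  (λ m → case ∈-tabulate⁻ m of λ { (j , refl) →
                    decidable-stable (cl? _ _) (λ n → none (j , n)) }))))
            (ℕ.<-irrefl refl)
      ... | yes (j , n) = y , gY j , yX , Z , (λ x → Z⁻ x , Z⁺ x) , indZ
        where
        y = g j
        xs = List.tabulate f
        X⊑ : ∀ {x} → X x ≡ true → x ∈ xs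
        X⊑ {x} e = case f-sur x e of λ { (i , refl) → ∈-tabulate⁺ i }
        yX : X y ≡ false
        yX with X y in e
        ... | false = refl
        ... | true = contradiction (cl-∈ (X⊑ e)) n
        Z : Subset P
        Z x = X x ∨ does (x ≟ y)
        Z⁻ : ∀ x → Z x ≡ true → X x ≡ true ⊎ x ≡ y
        Z⁻ x e with X x | x ≟ y
        ... | true | _ = inj₁ refl
        ... | false | yes p = inj₂ p
        ... | false | no _ = contradiction e λ ()
        Z⁺ : ∀ x → X x ≡ true ⊎ x ≡ y → Z x ≡ true
        Z⁺ x (inj₁ e) rewrite e = refl
        Z⁺ x (inj₂ e) rewrite dec-true (x ≟ y) e = Bool.∨-zeroʳ (X x)
        indZ : IndSet Z
        indZ = ind⇒indSet {ys = y ∷ xs} (n , indSet⇒ind indX f f-inj fX)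
          λ x e → [ (λ p → there (X⊑ p)) , here ]′ (Z⁻ x e)

module FromMatroid {P : Set} (K : Matroid P) (_≟_ : DecidableEquality P) (indep? : ∀ X → Dec (Indep K X)) where
  open Subsets _≟_

  indep-⊑ : ∀ xs {ys} → xs ⊑ ys → Indep K (toSubset ys) → Indep K (toSubset xs)
  indep-⊑ xs s = indep-⊆ K _ _ (toSubset-mono xs s)

  Basis : List P → List P → Set
  Basis bs xs = bs ⊑ xs × Distinct bs × Indep K (toSubset bs) ×
    (∀ {x} → x ∈ xs → x ∈ bs ⊎ ¬ Indep K (toSubset (x ∷ bs)))

  length≤basis : ∀ {zs bs xs} → Distinct zs → Indep K (toSubset zs) → zs ⊑ xs → Basis bs xs → length zs ≤ length bs
  length≤basis {zs} {bs} dz iz sz (_ , db , ib , mx) = ℕ.≮⇒≥ λ lt →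
    let (e , ez , eb , Z , ins , iZ) = augment K _ _ _ _ ib iz (toSubset-size db) (toSubset-size dz) lt
    in [ toSubset-∉ bs eb , (λ n → n (indep-⊆ K _ _
          (λ x m → proj₂ (ins x) (case toSubset⁻ (e ∷ bs) m of λ { (here p) → inj₂ p ; (there p) → inj₁ (toSubset⁺ p) }))
            iZ)) ]
       (mx (sz (toSubset⁻ zs ez)))

  extend : ∀ ys zs → Distinct ys → Indep K (toSubset ys) → ∃[ bs ] (ys ⊑ bs × Basis bs (zs ++ ys))
  extend ys [] d i = ys , id , id , d , i , inj₁
  extend ys (z ∷ zs) d i with extend ys zs d i
  ... | bs , s , sb , db , ib , mx with z ∈? bs | indep? (toSubset (z ∷ bs))
  ...   | yes m | _ = bs , s , (λ p → there (sb p)) , db , ib , λ { (here refl) → inj₁ m ; (there p) → mx p }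
  ...   | no _ | no n = bs , s , (λ p → there (sb p)) , db , ib , λ { (here refl) → inj₂ n ; (there p) → mx p }
  ...   | no n | yes i′ = z ∷ bs , (λ p → there (s p)) , ∷-⊑ (here refl) (λ p → there (sb p)) , (n , db) , i′ ,
    λ { (here refl) → inj₁ (here refl)
      ; (there p) → [ (λ q → inj₁ (there q)) , (λ q → inj₂ λ r → q
        (indep-⊑ (_ ∷ bs) (∷-⊑ (here refl) (λ o → there (there o))) r)) ] (mx p) }

  basisOf : ∀ xs → ∃[ bs ] Basis bs xs
  basisOf xs with extend [] xs tt (indep-⊆ K _ _ (λ x e → contradiction (toSubset⁻ [] e) λ ()) (indep-∅ K))
  ... | bs , _ , s , r = bs , (λ m → [ id , (λ ()) ] (∈-++⁻ xs (s m))) , proj₁ r , proj₁ (proj₂ r) ,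
        λ m → proj₂ (proj₂ r) (∈-++⁺ˡ m)

  -- Adding `y` does not raise the rank: a list inside `xs` is already maximal independent in
  -- `y ∷ xs`.
  Cl : List P → P → Set
  Cl xs y = ∃[ bs ] (bs ⊑ xs × Basis bs (y ∷ xs))

  -- By `length≤basis` all bases have the same length, so the basis witnessing `Cl` can be exchanged
  -- for any given one.
  cl-basis : ∀ {xs y bs} → Cl xs y → Basis bs xs → Basis bs (y ∷ xs)
  cl-basis {xs} {y} {bs} (cs , sc , bc) B@(sb , db , ib , mx) = (λ m → there (sb m)) , db , ib ,
    λ { (here refl) → last ; (there m) → mx m }
    where
    last : y ∈ bs ⊎ ¬ Indep K (toSubset (y ∷ bs))
    last with y ∈? bs
    ... | yes m = inj₁ m
    ... | no n = inj₂ λ i → ℕ.<-irrefl refl (ℕ.≤-trans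
            (length≤basis {zs = y ∷ bs} (n , db) i (∷-⊑ (here refl) (λ m → there (sb m))) bc)
            (length≤basis (proj₁ (proj₂ bc)) (proj₁ (proj₂ (proj₂ bc))) sc B))

  basis-cl : ∀ {xs y bs} → Basis bs xs → Basis bs (y ∷ xs) → Cl xs y
  basis-cl {bs = bs} B B′ = bs , proj₁ B , B′

  dependent⇒cl : ∀ {ys y} → Indep K (toSubset ys) → ¬ Indep K (toSubset (y ∷ ys)) → Cl ys y
  dependent⇒cl {ys} {y} i n with basisOf ys
  ... | bs , B@(sb , db , ib , mx) = basis-cl B ((λ m → there (sb m)) , db , ib ,
    λ { (here refl) → inj₂ (λ i′ → n (indep-⊑ _ (∷-⊑ (here refl) (λ m → there (full m))) i′)) ; (there m) → mx m })
    where
    full : ys ⊑ bs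
    full m = [ id , (λ nn → contradiction (indep-⊑ _ (∷-⊑ m sb) i) nn) ] (mx m)

  independent⇒¬cl : ∀ {ys y} → y ∉ ys → Indep K (toSubset (y ∷ ys)) → ¬ Cl ys y
  independent⇒¬cl n i (bs , s , _ , _ , _ , mx) =
    [ (λ m → n (s m)) , (λ nn → nn (indep-⊑ _ (∷-⊑ (here refl) (λ m → there (s m))) i)) ] (mx (here refl))

  matroidPregeometry : Pregeometry P
  matroidPregeometry = record { Cl = Cl ; cl? = cl? ; cl-∈ = cl-∈ ; cl-trans = cl-trans ; cl-exchange = cl-exchange }
    where
    cl? : ∀ xs y → Dec (Cl xs y)
    cl? xs y with basisOf xs
    ... | bs , B@(sb , db , ib , mx) with y ∈? bs | indep? (toSubset (y ∷ bs))
    ...   | yes m | _ = yes (basis-cl B ((λ p → there (sb p)) , db , ib , λ { (here refl) → inj₁ m ; (there p) → mx p }))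
    ...   | no _ | no n = yes (basis-cl B ((λ p → there (sb p)) , db , ib , λ { (here refl) → inj₂ n ; (there p) → mx p }))
    ...   | no n | yes i = no λ c → [ n , (λ nn → nn i) ] (proj₂ (proj₂ (proj₂ (cl-basis c B))) (here refl))

    cl-∈ : ∀ {xs x} → x ∈ xs → Cl xs x
    cl-∈ {xs} m with basisOf xs
    ... | bs , B@(sb , db , ib , mx) = basis-cl B ((λ p → there (sb p)) , db , ib ,
      λ { (here refl) → mx m ; (there p) → mx p })

    cl-trans : ∀ {xs ys z} → (∀ {y} → y ∈ ys → Cl xs y) → Cl ys z → Cl xs z
    cl-trans {xs} {ys} {z} sp c with basisOf xs | basisOf ys
    -- `bs` remains a basis of `xs ++ ys`, because every element of `ys` depends on it. `ds`
    -- contains `cs`, on which `z` depends, so it remains a basis after `z` is added. If `z ∷ bs`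
    -- were independent it would be at most as long as `ds`, which is at most as long as `bs`.
    ... | bs , B@(sb , db , ib , mx) | cs , C@(sc , dc , ic , mc) with extend cs (xs ++ ys) dc ic
    ...   | ds , cd , D@(sd , dd , id′ , md) = basis-cl B ((λ p → there (sb p)) , db , ib ,
            λ { (here refl) → last ; (there p) → mx p })
      where
      B′ : Basis bs (z ∷ (xs ++ ys) ++ cs) → z ∈ bs ⊎ ¬ Indep K (toSubset (z ∷ bs))
      B′ b = proj₂ (proj₂ (proj₂ b)) (here refl)
      B⁺ : Basis bs ((xs ++ ys) ++ cs)
      B⁺ = (λ m → ∈-++⁺ˡ (∈-++⁺ˡ (sb m))) , db , ib , λ m → [ (λ p → [ mx , inY ] (∈-++⁻ xs p)) , (λ p → inY (sc p)) ]
        (∈-++⁻ (xs ++ ys) m)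
        where
        inY : ∀ {x} → x ∈ ys → x ∈ bs ⊎ ¬ Indep K (toSubset (x ∷ bs))
        inY m = proj₂ (proj₂ (proj₂ (cl-basis (sp m) B))) (here refl)
      D⁺ : Basis ds (z ∷ (xs ++ ys) ++ cs)
      D⁺ = (λ m → there (sd m)) , dd , id′ , λ
        { (here refl) → [ (λ p → inj₁ (cd p)) , (λ nn → inj₂ (λ i → nn (indep-⊑ _ (∷-⊑ (here refl) (λ m → there (cd m))) i)))
          ]
                          (proj₂ (proj₂ (proj₂ (cl-basis c C))) (here refl))
        ; (there m) → md m }
      last : z ∈ bs ⊎ ¬ Indep K (toSubset (z ∷ bs))
      last with z ∈? bs
      ... | yes m = inj₁ m
      ... | no n = inj₂ λ i → ℕ.<-irrefl refl (ℕ.≤-trans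
              (length≤basis {zs = z ∷ bs} (n , db) i (∷-⊑ (here refl) (λ m → there (proj₁ B⁺ m))) D⁺)
              (length≤basis dd id′ sd B⁺))

    cl-exchange : ∀ {xs x y} → Cl (x ∷ xs) y → ¬ Cl xs y → Cl (y ∷ xs) x
    cl-exchange {xs} {x} {y} c n with basisOf xs
    ... | bs , B@(sb , db , ib , mx) with x ∈? bs | indep? (toSubset (x ∷ bs))
    ...   | yes m | _ = contradiction (cl-trans (λ { (here refl) → cl-∈ (sb m) ; (there p) → cl-∈ p }) c) n
    ...   | no _ | no nx = contradiction (cl-trans (λ { (here refl) →
              basis-cl B ((λ p → there (sb p)) , db , ib , λ { (here refl) → inj₂ nx ; (there p) → mx p }) ; (there p) →
                cl-∈ p }) c) n
    ...   | no x∉ | yes ix with y ∈? bs | indep? (toSubset (y ∷ bs))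
    ...     | yes m | _ = contradiction (cl-∈ (sb m)) n
    ...     | no _ | no ny = contradiction
                (basis-cl B ((λ p → there (sb p)) , db , ib , λ { (here refl) → inj₂ ny ; (there p) → mx p })) n
    ...     | no y∉ | yes iy with x ∈? (y ∷ bs)
    ...       | yes (there m) = contradiction m x∉
    ...       | yes (here refl) = cl-∈ (here refl)
    -- Since `y` depends on `x ∷ xs`, the list `x ∷ bs` is a basis of `y ∷ x ∷ xs`. The list
    -- `y ∷ bs` is independent and equally long, so `x` cannot enlarge it.
    ...       | no x∉′ = basis-cl Y Y′
      where
      X : Basis (x ∷ bs) (y ∷ x ∷ xs)
      X = cl-basis c (∷-⊑ (here refl) (λ p → there (sb p)) , (x∉ , db) , ix ,
        λ { (here refl) → inj₁ (here refl)
          ; (there p) → [ (λ q → inj₁ (there q)) , (λ q → inj₂ λ r → q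
            (indep-⊑ (_ ∷ bs) (∷-⊑ (here refl) (λ o → there (there o))) r)) ] (mx p) })
      maximal : ∀ {v} → v ∈ xs → v ∈ (y ∷ bs) ⊎ ¬ Indep K (toSubset (v ∷ y ∷ bs))
      maximal p = [ (λ q → inj₁ (there q)) , (λ q → inj₂ λ r → q
        (indep-⊑ (_ ∷ bs) (∷-⊑ (here refl) (λ o → there (there o))) r)) ] (mx p)
      Y : Basis (y ∷ bs) (y ∷ xs)
      Y = ∷-⊑ (here refl) (λ p → there (sb p)) , (y∉ , db) , iy ,
        λ { (here refl) → inj₁ (here refl) ; (there p) → maximal p }
      Y′ : Basis (y ∷ bs) (x ∷ y ∷ xs)
      Y′ = ∷-⊑ (there (here refl)) (λ p → there (there (sb p))) , (y∉ , db) , iy , λ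
        { (here refl) → inj₂ λ i → ℕ.<-irrefl refl
            (length≤basis {zs = x ∷ y ∷ bs} (x∉′ , y∉ , db) i
              (∷-⊑ (there (here refl)) (∷-⊑ (here refl) (λ p → there (there (sb p))))) X)
        ; (there (here refl)) → inj₁ (here refl)
        ; (there (there p)) → maximal p }

-- Cycles of K_n^Γ

module Graph (n : ℕ) (Γ : FiniteGroup) where
  open GroupFacts Γ

  E : Set
  E = Edge n Γ

  -- The order proof stored in an edge is irrelevant; decidability of the order recovers one that
  -- can be used.
  src<tgt : (e : E) → src e <ᶠ tgt e
  src<tgt (edge s t s<t _) = recompute (s Fin.<? t) s<t

  src≢tgt : (e : E) → src e ≢ tgt e
  src≢tgt e p = Fin.<-irrefl p (src<tgt e)

  edge-ext : ∀ {x y : E} → src x ≡ src y → tgt x ≡ tgt y → label x ≡ label y → x ≡ y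
  edge-ext refl refl refl = refl

  infix 4 _≟ᴱ_
  _≟ᴱ_ : DecidableEquality E
  x ≟ᴱ y = map′ (λ (p , q , r) → edge-ext p q r) (λ { refl → refl , refl , refl })
    (src x Fin.≟ src y ×-dec tgt x Fin.≟ tgt y ×-dec label x ≟ label y)

  enumᴱ : Enum E
  enumᴱ = enum-image (λ (((s , t) , g) , p) → edge s t p g)
    (λ e → (((src e , tgt e) , label e) , src<tgt e) , refl)
    (enum-filter (λ ((s , t) , _) → s Fin.<? t) (ℕ.<-irrelevant)
      (enum-× (enum-× (enum-Fin n) (enum-Fin n)) enum))

  open Subsets _≟ᴱ_ public

  module _ (C : Cycle n Γ) where
    open Cycle C

    edges : List E
    edges = List.tabulate edg

    cycleSet : Subset E
    cycleSet = toSubset edges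

    edg∈edges : ∀ k → edg k ∈ edges
    edg∈edges k = ∈-tabulate⁺ {f = edg} k

    cycleSet-isEdgeSet : EdgeSetOf C cycleSet
    cycleSet-isEdgeSet f = mk⇔ (λ e → let (k , p) = ∈-tabulate⁻ {f = edg} (toSubset⁻ edges e) in k , sym p)
      (λ { (k , refl) → toSubset⁺ (edg∈edges k) })

  -- `s` is read as a vertex cut. The edges that do not cross it form a flat of the cycle matroid.
  Mono : (Fin n → Bool) → E → Set
  Mono s e = s (src e) ≡ s (tgt e)

  joins-mono : ∀ {s : Fin n → Bool} {e u w} → Joins e u w → Mono s e → s u ≡ s w
  joins-mono (inj₁ (refl , refl)) p = p
  joins-mono (inj₂ (refl , refl)) p = sym p

  mono-joins : ∀ {s : Fin n → Bool} {e u w} → Joins e u w → s u ≡ s w → Mono s e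
  mono-joins (inj₁ (refl , refl)) p = p
  mono-joins (inj₂ (refl , refl)) p = sym p

  -- A closed walk crosses a cut an even number of times; only the exclusion of exactly one crossing
  -- is used, and it follows by comparing colours along the rest of the cycle.
  no-single-crossing : (C : Cycle n Γ) (s : Fin n → Bool) (k : Fin _) →
    (∀ i → i ≢ k → Mono s (Cycle.edg C i)) → Mono s (Cycle.edg C k)
  no-single-crossing C s k st = mono-joins {s = s} {e = edg k} (joins k)
    (Around.around (λ i j → s (vert i) ≡ s (vert j)) refl sym trans k
      (λ i i≢k → joins-mono {s = s} {e = edg i} (joins i) (st i i≢k)))
    where open Cycle C

  graphic-insert : ∀ {X Z} (s : Fin n → Bool) {e} → GraphicIndep n Γ X → (∀ x → X x ≡ true → Mono s x) → ¬ Mono s e →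
    (∀ x → Z x ≡ true → X x ≡ true ⊎ x ≡ e) → GraphicIndep n Γ Z
  graphic-insert {X} {Z} s {e} gX mono cross ins C Y eq Y⊆Z with Fin.any? (λ k → Cycle.edg C k ≟ᴱ e)
  ... | yes (k , refl) = cross (no-single-crossing C s k λ i i≢k →
          [ mono (Cycle.edg C i) , (λ p → contradiction (Cycle.einj C p) i≢k) ]′
            (ins _ (Y⊆Z _ (Equivalence.from (eq _) (i , refl)))))
  ... | no none = gX C Y eq λ x m → case Equivalence.to (eq x) m of λ { (k , refl) →
          [ id , (λ p → contradiction (k , p) none) ]′ (ins _ (Y⊆Z _ m)) }

  graphic-∅ : GraphicIndep n Γ (const false)
  graphic-∅ C Y eq s = contradiction (s _ (Equivalence.from (eq _) (fzero , refl))) λ ()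

  graphic-single : ∀ e → GraphicIndep n Γ (toSubset (e ∷ []))
  graphic-single e C Y eq s = case Cycle.einj C {fzero} {fsuc fzero} (trans (at fzero) (sym (at (fsuc fzero)))) of λ ()
    where
    at : ∀ k → Cycle.edg C k ≡ e
    at k = case toSubset⁻ (e ∷ []) (s _ (Equivalence.from (eq _) (k , refl))) of λ { (here p) → p }

  twoCycle : (x y : E) → x ≢ y → src x ≡ src y → tgt x ≡ tgt y → Cycle n Γ
  twoCycle x y x≢y p q = record
    { len = 0
    ; vert = λ { fzero → src x ; (fsuc fzero) → tgt x }
    ; edg = λ { fzero → x ; (fsuc fzero) → y }
    ; vinj = λ { {fzero} {fzero} _ → refl ; {fzero} {fsuc fzero} e → contradiction e (src≢tgt x)
               ; {fsuc fzero} {fzero} e → contradiction (sym e) (src≢tgt x) ; {fsuc fzero} {fsuc fzero} _ → refl }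
    ; einj = λ { {fzero} {fzero} _ → refl ; {fzero} {fsuc fzero} e → contradiction e x≢y
               ; {fsuc fzero} {fzero} e → contradiction (sym e) x≢y ; {fsuc fzero} {fsuc fzero} _ → refl }
    ; joins = λ { fzero → inj₁ (refl , refl) ; (fsuc fzero) → inj₂ (sym p , sym q) } }

  triangle : (x y z : E) → tgt x ≡ src y → src z ≡ src x → tgt z ≡ tgt y → Cycle n Γ
  triangle x y z p q r = record
    { len = 1
    ; vert = λ { fzero → src x ; (fsuc fzero) → src y ; (fsuc (fsuc fzero)) → tgt y }
    ; edg = λ { fzero → x ; (fsuc fzero) → y ; (fsuc (fsuc fzero)) → z }
    ; vinj = λ { {fzero} {fzero} _ → refl ; {fsuc fzero} {fsuc fzero} _ → refl ; {fsuc (fsuc fzero)} {fsuc (fsuc fzero)} _ →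
      refl
               ; {fzero} {fsuc fzero} e → contradiction e sx≢sy ; {fsuc fzero} {fzero} e → contradiction (sym e) sx≢sy
               ; {fzero} {fsuc (fsuc fzero)} e → contradiction e sx≢ty ; {fsuc (fsuc fzero)} {fzero} e → contradiction
                 (sym e) sx≢ty
               ; {fsuc fzero} {fsuc (fsuc fzero)} e → contradiction e (src≢tgt y)
               ; {fsuc (fsuc fzero)} {fsuc fzero} e → contradiction (sym e) (src≢tgt y) }
    ; einj = λ { {fzero} {fzero} _ → refl ; {fsuc fzero} {fsuc fzero} _ → refl ; {fsuc (fsuc fzero)} {fsuc (fsuc fzero)} _ →
      refl
               ; {fzero} {fsuc fzero} e → contradiction e x≢y ; {fsuc fzero} {fzero} e → contradiction (sym e) x≢y
               ; {fzero} {fsuc (fsuc fzero)} e → contradiction e x≢z ; {fsuc (fsuc fzero)} {fzero} e → contradiction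
                 (sym e) x≢z
               ; {fsuc fzero} {fsuc (fsuc fzero)} e → contradiction e y≢z
               ; {fsuc (fsuc fzero)} {fsuc fzero} e → contradiction (sym e) y≢z }
    ; joins = λ { fzero → inj₁ (refl , p) ; (fsuc fzero) → inj₁ (refl , refl) ; (fsuc (fsuc fzero)) → inj₂ (q , r) } }
    where
    sx≢sy : src x ≢ src y
    sx≢sy e = src≢tgt x (trans e (sym p))
    sx≢ty : src x ≢ tgt y
    sx≢ty e = src≢tgt z (trans q (trans e (sym r)))
    x≢y : x ≢ y
    x≢y e = sx≢sy (cong src e)
    x≢z : x ≢ z
    x≢z e = src≢tgt y (trans (sym p) (trans (cong tgt e) r))
    y≢z : y ≢ z
    y≢z e = sx≢sy (sym (trans (cong src e) q))

  -- Switching by `p` turns the label of such an edge into the identity. A cycle is balanced exactly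
  -- when all its edges fit one potential, which removes starting points and orientations from the
  -- later arguments.
  Fits : (Fin n → Carrier) → E → Set
  Fits p e = label e ≡ p (src e) ⁻¹ ∙ p (tgt e)

  travLabel-src : ∀ (e : E) {u} → src e ≡ u → travLabel e u ≡ label e
  travLabel-src e {u} q rewrite dec-true (src e Fin.≟ u) q = refl

  travLabel-tgt : ∀ (e : E) {u} → tgt e ≡ u → travLabel e u ≡ label e ⁻¹
  travLabel-tgt e {u} q rewrite dec-false (src e Fin.≟ u) (λ r → src≢tgt e (trans r (sym q))) = refl

  inverse-step : ∀ x y → (x ⁻¹ ∙ y) ⁻¹ ≡ y ⁻¹ ∙ x
  inverse-step x y = trans (⁻¹-anti-homo-∙ _ _) (cong (y ⁻¹ ∙_) (⁻¹-involutive x))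

  fits⇒travLabel : ∀ p (e : E) {u w} → Joins e u w → Fits p e → travLabel e u ≡ p u ⁻¹ ∙ p w
  fits⇒travLabel p e (inj₁ (refl , refl)) f = trans (travLabel-src e refl) f
  fits⇒travLabel p e (inj₂ (refl , refl)) f = trans (travLabel-tgt e refl) (trans (cong _⁻¹ f) (inverse-step _ _))

  travLabel⇒fits : ∀ p (e : E) {u w} → Joins e u w → travLabel e u ≡ p u ⁻¹ ∙ p w → Fits p e
  travLabel⇒fits p e (inj₁ (refl , refl)) f = trans (sym (travLabel-src e refl)) f
  travLabel⇒fits p e (inj₂ (refl , refl)) f =
    trans (sym (⁻¹-involutive _)) (trans (cong _⁻¹ (trans (sym (travLabel-tgt e refl)) f)) (inverse-step _ _))

  fits⇒balanced : (C : Cycle n Γ) (p : Fin n → Carrier) → (∀ k → Fits p (Cycle.edg C k)) → Balanced C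
  fits⇒balanced C p f = potential⇒prod≡ε _ (p ∘ vert) (λ k → fits⇒travLabel p (edg k) (joins k) (f k))
    where open Cycle C

  module _ (C : Cycle n Γ) where
    open Cycle C

    private
      gains : Fin (suc (suc len)) → Carrier
      gains k = travLabel (edg k) (vert k)

    -- The product of the labels met on the way along the cycle from its first vertex.
    pathPotential : Fin n → Carrier
    pathPotential v with Fin.any? (λ k → vert k Fin.≟ v)
    ... | yes (k , _) = prefixProd gains k
    -- An arbitrary default: no edge of the cycle meets such a vertex.
    ... | no _ = ε

    pathPotential-vert : ∀ k → pathPotential (vert k) ≡ prefixProd gains k
    pathPotential-vert k with Fin.any? (λ i → vert i Fin.≟ vert k)
    ... | yes (i , p) = cong (prefixProd gains) (vinj p)
    ... | no none = contradiction (k , refl) none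

    private
      lift : ∀ k → gains k ≡ prefixProd gains k ⁻¹ ∙ prefixProd gains (next k) → Fits pathPotential (edg k)
      lift k e = travLabel⇒fits pathPotential (edg k) (joins k)
        (trans e (sym (cong₂ (λ x y → x ⁻¹ ∙ y) (pathPotential-vert k) (pathPotential-vert (next k)))))

    -- All edges but the closing one fit by construction, balanced or not, so balance is decided by
    -- the closing edge alone.
    pathPotential-fits : ∀ i → Fits pathPotential (edg (inject₁ i))
    pathPotential-fits i = lift (inject₁ i) (trans (sym (x⁻¹∙xy (prefixProd gains (inject₁ i)) _))
      (cong (prefixProd gains (inject₁ i) ⁻¹ ∙_) (trans (prefixProd-suc gains i)
        (cong (prefixProd gains) (sym (next-inject₁ i))))))

    balanced⇒fits : Balanced C → ∀ k → Fits pathPotential (edg k)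
    balanced⇒fits b k = lift k (prod≡ε⇒potential gains b k)

    fits-last⇒balanced : Fits pathPotential (edg (fromℕ (suc len))) → Balanced C
    fits-last⇒balanced f = fits⇒balanced C pathPotential all
      where
      all : ∀ k → Fits pathPotential (edg k)
      all k with view k
      ... | ‵fromℕ = f
      ... | ‵inject₁ i = pathPotential-fits i

  triangle-balanced : ∀ x y z p q r → label x ∙ label y ≡ label z → Balanced (triangle x y z p q r)
  triangle-balanced x y z p q r e =
    trans (cong₂ _∙_ (travLabel-src x refl) (cong₂ _∙_ (travLabel-src y refl) (cong (_∙ ε) (travLabel-tgt z r))))
      (trans (cong (λ w → label x ∙ (label y ∙ w)) (identityʳ _))
        (trans (sym (assoc _ _ _)) (trans (cong (_∙ label z ⁻¹) e) (inverseʳ _))))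

  twoCycle-unbalanced : ∀ x y ne p q → ¬ Balanced (twoCycle x y ne p q)
  twoCycle-unbalanced x y ne p q b = ne (edge-ext p q (xy⁻¹≡ε⇒x≡y
    (trans (sym (trans (cong₂ _∙_ (travLabel-src x refl) (trans (cong (_∙ ε) (travLabel-tgt y (sym q))) (identityʳ _)))
      refl)) b)))

module Star (m : ℕ) (Γ : FiniteGroup) where
  open GroupFacts Γ
  open Graph (suc m) Γ

  spoke : Fin m → E
  spoke j = edge fzero (fsuc j) z<s ε

  star : List E
  star = List.tabulate spoke

  spoke-injective : Injective _≡_ _≡_ spoke
  spoke-injective refl = refl

  star-size : HasSize (toSubset star) m
  star-size = subst (HasSize _) (List.length-tabulate spoke) (toSubset-size (tabulate-distinct spoke-injective))

  star-graphic : GraphicIndep (suc m) Γ (toSubset star)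
  star-graphic C Y eq s = crossing (no-single-crossing C cut fzero others)
    where
    at : ∀ k → ∃[ j ] Cycle.edg C k ≡ spoke j
    at k = ∈-tabulate⁻ (toSubset⁻ star (s _ (Equivalence.from (eq _) (k , refl))))
    j₀ = proj₁ (at fzero)
    -- Isolating the outer end of one spoke gives a cut that this spoke alone crosses.
    cut : Fin (suc m) → Bool
    cut v = does (v Fin.≟ fsuc j₀)
    others : ∀ i → i ≢ fzero → Mono cut (Cycle.edg C i)
    others i i≢0 with at i
    ... | j , e rewrite e = sym (dec-false (fsuc j Fin.≟ fsuc j₀)
          λ { refl → i≢0 (Cycle.einj C (trans e (sym (proj₂ (at fzero))))) })
    crossing : ¬ Mono cut (Cycle.edg C fzero)
    crossing mono = contradiction (trans (subst (Mono cut) (proj₂ (at fzero)) mono) (dec-true (fsuc j₀ Fin.≟ fsuc j₀) refl))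
      λ ()

-- Closure in a lift of the cycle matroid

module LiftGeometry {m : ℕ} {Γ : FiniteGroup} (L : Matroid (Edge (suc m) Γ)) {k : ℕ} (K : Matroid (Edge (suc m) Γ ⊎ Fin k))
  (contraction : ∀ X → ContractIndep K X ⇔ GraphicIndep (suc m) Γ X)
  (deletion : ∀ X → DeleteIndep K X ⇔ Indep L X)
  (circuits : ∀ (C : Cycle (suc m) Γ) X → EdgeSetOf C X → (IsCircuit (Indep L) X ⇔ Balanced C))
  (indep? : ∀ X → Dec (Indep K X))
  where
  open GroupFacts Γ
  open Graph (suc m) Γ
  open Star m Γ

  infix 4 _≟ᴾ_
  _≟ᴾ_ : DecidableEquality (E ⊎ Fin k)
  _≟ᴾ_ = Sum.≡-dec _≟ᴱ_ Fin._≟_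

  module S = Subsets _≟ᴾ_
  module FM = FromMatroid K _≟ᴾ_ indep?
  module G = Pregeometry FM.matroidPregeometry
  module GE = Pregeometry (pullback FM.matroidPregeometry inj₁)
  open GE using (Cl; cl?; cl-∈; cl-trans; cl-mono; cl-exchange) public

  toSubset-inj₁ : ∀ xs → S.toSubset (map inj₁ xs) ⊆ [ toSubset xs , const false ]
  toSubset-inj₁ xs p e with ∈-map⁻ inj₁ (S.toSubset⁻ (map inj₁ xs) e)
  ... | x , q , refl = toSubset⁺ q

  inj₁-toSubset : ∀ xs → [ toSubset xs , const false ] ⊆ S.toSubset (map inj₁ xs)
  inj₁-toSubset xs (inj₁ x) e = S.toSubset⁺ (∈-map⁺ inj₁ (toSubset⁻ xs e))

  indepL⇒indepK : ∀ xs → Indep L (toSubset xs) → Indep K (S.toSubset (map inj₁ xs))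
  indepL⇒indepK xs i = indep-⊆ K _ _ (toSubset-inj₁ xs) (Equivalence.from (deletion _) i)

  indepK⇒indepL : ∀ xs → Indep K (S.toSubset (map inj₁ xs)) → Indep L (toSubset xs)
  indepK⇒indepL xs i = Equivalence.to (deletion _) (indep-⊆ K _ _ (inj₁-toSubset xs) i)

  graphic⇒indepL : ∀ {X} → GraphicIndep (suc m) Γ X → Indep L X
  graphic⇒indepL {X} g with Equivalence.from (contraction X) g
  ... | B , _ , i = Equivalence.to (deletion X) (indep-⊆ K _ _ (λ { (inj₁ x) e → e ; (inj₂ _) () }) i)

  module BasisOfF {B} (isBasis : IsBasisOfF K B) where
    fs : List (E ⊎ Fin k)
    fs = map inj₂ (filter (λ i → B i Bool.≟ true) (List.allFin k))

    ∈-fs : ∀ {i} → B i ≡ true → inj₂ i ∈ fs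
    ∈-fs {i} e = ∈-map⁺ inj₂ (∈-filter⁺ (λ i → B i Bool.≟ true) (∈-allFin i) e)

    fs-∈ : ∀ {p} → p ∈ fs → ∃[ i ] (p ≡ inj₂ i × B i ≡ true)
    fs-∈ m with ∈-map⁻ inj₂ m
    ... | i , q , refl = i , refl , proj₂ (∈-filter⁻ (λ i → B i Bool.≟ true) {xs = List.allFin k} q)

    inj₁∉fs : ∀ {e} → inj₁ e ∉ fs
    inj₁∉fs m = case proj₁ (proj₂ (fs-∈ m)) of λ ()

    fs-indep : Indep K (S.toSubset fs)
    fs-indep = indep-⊆ K _ _ (λ p e → case fs-∈ (S.toSubset⁻ fs e) of λ { (i , refl , b) → b }) (proj₁ isBasis)

    fs-spans : ∀ i → G.Cl fs (inj₂ i)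
    fs-spans i with B i Bool.≟ true
    ... | yes b = G.cl-∈ (∈-fs b)
    ... | no n = FM.dependent⇒cl fs-indep λ ind → n (proj₂ isBasis (λ j → S.toSubset (inj₂ i ∷ fs) (inj₂ j))
          (λ j b → S.toSubset⁺ {inj₂ j} {inj₂ i ∷ fs} (there (∈-fs b)))
          (indep-⊆ K _ _ (λ { (inj₁ _) () ; (inj₂ _) e → e }) ind) i (S.toSubset⁺ {xs = inj₂ i ∷ fs} (here refl)))

  -- Closure in the lift is contained in closure in K/F. Suppose `e` crossed the cut. A basis `bs`
  -- of F together with `xs` has a graphic set `Y` of edges, and `Y` with `e` is graphic by
  -- `graphic-insert`. It is therefore independent together with some basis of F, although `e`
  -- depends on the edges of `bs` modulo F.
  cl-mono-edges : ∀ (s : Fin (suc m) → Bool) {xs e} → (∀ {x} → x ∈ xs → Mono s x) → Cl xs e → Mono s e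
  cl-mono-edges s {xs} {e} mono c = decidable-stable (_ Bool.≟ _) λ cross → absurd cross
    where
    absurd : ¬ ¬ Mono s e
    absurd cross with Equivalence.from (contraction (const false)) graphic-∅
    ... | B , isB , _ = go
      where
      open BasisOfF isB
      ext = FM.extend fs (map inj₁ xs) (fs-distinct) fs-indep
        where
        fs-distinct : Distinct fs
        fs-distinct = map-distinct (filter-distinct (List.allFin k) (tabulate-distinct id))
          where
          map-distinct : ∀ {is : List (Fin k)} → Distinct is → Distinct (map inj₂ is)
          map-distinct {[]} _ = tt
          map-distinct {i ∷ is} (n , d) = (λ q → case ∈-map⁻ inj₂ q of λ { (_ , r , refl) → n r }) , map-distinct d
          filter-distinct : ∀ is → Distinct is → Distinct (filter (λ i → B i Bool.≟ true) is)
          filter-distinct [] _ = tt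
          filter-distinct (i ∷ is) (n , d) with does (B i Bool.≟ true)
          ... | true = (λ q → n (proj₁ (∈-filter⁻ (λ i → B i Bool.≟ true) {xs = is} q))) , filter-distinct is d
          ... | false = filter-distinct is d
      bs = proj₁ ext
      fs⊑bs = proj₁ (proj₂ ext)
      basis = proj₂ (proj₂ ext)
      Y : Subset E
      Y x = S.toSubset bs (inj₁ x)
      Y⇒xs : ∀ {x} → inj₁ x ∈ bs → x ∈ xs
      Y⇒xs q with ∈-++⁻ (map inj₁ xs) (proj₁ basis q)
      ... | inj₁ r = case ∈-map⁻ inj₁ r of λ { (_ , r′ , refl) → r′ }
      ... | inj₂ r = contradiction r inj₁∉fs
      Z : Subset E
      Z x = Y x ∨ does (x ≟ᴱ e)
      Z-ins : ∀ x → Z x ≡ true → Y x ≡ true ⊎ x ≡ e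
      Z-ins x q = [ inj₁ , (λ r → inj₂ (does⁻ (x ≟ᴱ e) r)) ]′ (∨⁻ (Y x) q)
      Z-e : ∀ {x} → x ≡ e → Z x ≡ true
      Z-e {x} r rewrite dec-true (x ≟ᴱ e) r = Bool.∨-zeroʳ (Y x)
      Z-Y : ∀ {x} → Y x ≡ true → Z x ≡ true
      Z-Y q rewrite q = refl
      gY : GraphicIndep (suc m) Γ Y
      gY = Equivalence.to (contraction Y) (B , isB ,
        indep-⊆ K _ _ (λ { (inj₁ x) q → q ; (inj₂ i) q → S.toSubset⁺ (fs⊑bs (∈-fs q)) }) (proj₁ (proj₂ (proj₂ basis))))
      gZ : GraphicIndep (suc m) Γ Z
      gZ = graphic-insert s gY (λ x q → mono (Y⇒xs (S.toSubset⁻ bs q))) cross Z-ins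
      go : ⊥
      go with Equivalence.from (contraction Z) gZ
      -- The basis `B′` of F supplied here may differ from `B`. It also spans F, so `vs`, made of
      -- `B′` and the edges of `bs`, spans `bs`, hence `xs`, hence `e`.
      ... | B′ , isB′ , indZ = FM.independent⇒¬cl e∉ (indep-⊆ K _ _ sub indZ) c′
        where
        module F′ = BasisOfF isB′
        ys = filter (λ x → inj₁ x S.∈? bs) xs
        vs = map inj₁ ys ++ F′.fs
        ys-bs : ∀ {x} → x ∈ ys → inj₁ x ∈ bs
        ys-bs q = proj₂ (∈-filter⁻ (λ x → inj₁ x S.∈? bs) {xs = xs} q)
        e∉ : inj₁ e ∉ vs
        e∉ q with ∈-++⁻ (map inj₁ ys) q
        ... | inj₂ r = F′.inj₁∉fs r
        ... | inj₁ r = case ∈-map⁻ inj₁ r of λ { (_ , r′ , refl) → cross (mono (Y⇒xs (ys-bs r′))) }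
        sub : S.toSubset (inj₁ e ∷ vs) ⊆ [ Z , B′ ]
        sub p q with S.toSubset⁻ (inj₁ e ∷ vs) q
        ... | here refl = Z-e refl
        ... | there r with ∈-++⁻ (map inj₁ ys) r
        ...   | inj₁ r′ = case ∈-map⁻ inj₁ r′ of λ { (_ , r″ , refl) → Z-Y (S.toSubset⁺ (ys-bs r″)) }
        ...   | inj₂ r′ = case F′.fs-∈ r′ of λ { (_ , refl , b) → b }
        spans-bs : ∀ {p} → p ∈ bs → G.Cl vs p
        spans-bs {inj₁ x} q = G.cl-∈ (∈-++⁺ˡ (∈-map⁺ inj₁ (∈-filter⁺ (λ x → inj₁ x S.∈? bs) (Y⇒xs q) q)))
        spans-bs {inj₂ i} q = G.cl-mono (∈-++⁺ʳ (map inj₁ ys)) (F′.fs-spans i)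
        bs-spans : ∀ {x} → x ∈ xs → G.Cl bs (inj₁ x)
        bs-spans q with proj₂ (proj₂ (proj₂ basis)) (∈-++⁺ˡ (∈-map⁺ inj₁ q))
        ... | inj₁ r = G.cl-∈ r
        ... | inj₂ nn = FM.dependent⇒cl (proj₁ (proj₂ (proj₂ basis))) nn
        c′ : G.Cl vs (inj₁ e)
        c′ = G.cl-trans spans-bs (G.cl-trans (λ q → case ∈-map⁻ inj₁ q of λ { (_ , r , refl) → bs-spans r }) c)

  -- The complement of a cut is a flat of the cycle matroid, hence also of its lift.
  drop : ∀ (s : Fin (suc m) → Bool) {p xs z} → ¬ Mono s p → (∀ {x} → x ∈ xs → Mono s x) → Mono s z →
    Cl (p ∷ xs) z → Cl xs z
  drop s {p} {xs} {z} cross mono mz c = decidable-stable (cl? xs z) λ n →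
    cross (cl-mono-edges s (λ { (here refl) → mz ; (there q) → mono q }) (cl-exchange c n))

  circuit⇒cl : ∀ {X x ys} → IsCircuit (Indep L) X → X ⊆ toSubset (x ∷ ys) → X x ≡ true → (∀ {y} → y ∈ ys → X y ≡ true) →
    x ∉ ys →
    Cl ys x
  circuit⇒cl {X} {x} {ys} (dep , proper) X⊆ Xx Xys x∉ = FM.dependent⇒cl
    (indepL⇒indepK ys (proper _ (λ y q → Xys (toSubset⁻ ys q)) (x , Xx , ∉⇒toSubset-false ys x∉)))
    (λ i → dep (indep-⊆ L _ _ X⊆ (indepK⇒indepL (x ∷ ys) i)))

  module _ {x y z : E} (p : tgt x ≡ src y) (q : src z ≡ src x) (r : tgt z ≡ tgt y)
    (balanced : label x ∙ label y ≡ label z) where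
    private
      C = triangle x y z p q r
      circuit : IsCircuit (Indep L) (cycleSet C)
      circuit = Equivalence.from (circuits C _ (cycleSet-isEdgeSet C)) (triangle-balanced x y z p q r balanced)
      x≢y : x ≢ y
      x≢y e = src≢tgt x (trans (cong src e) (sym p))
      x≢z : x ≢ z
      x≢z e = src≢tgt y (trans (sym p) (trans (cong tgt e) r))
      y≢z : y ≢ z
      y≢z e = src≢tgt x (trans (sym q) (trans (sym (cong src e)) (sym p)))
      inC : ∀ {w} → w ∈ x ∷ y ∷ z ∷ [] → cycleSet C w ≡ true
      inC = toSubset⁺ {xs = edges C}
      pair : ∀ {a b c} → a ∷ b ∷ c ∷ [] ⊑ x ∷ y ∷ z ∷ [] → x ∷ y ∷ z ∷ [] ⊑ c ∷ a ∷ b ∷ [] →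
        c ≢ a → c ≢ b → Cl (a ∷ b ∷ []) c
      pair s t c≢a c≢b = circuit⇒cl circuit (toSubset-mono (edges C) t) (inC (s (there (there (here refl)))))
        (λ { (here refl) → inC (s (here refl)) ; (there (here refl)) → inC (s (there (here refl))) })
        λ { (here e) → c≢a e ; (there (here e)) → c≢b e }

      close : ∀ {xs a b c} → Cl (a ∷ b ∷ []) c → Cl xs a → Cl xs b → Cl xs c
      close c ca cb = cl-trans (λ { (here refl) → ca ; (there (here refl)) → cb }) c

    cl-third : ∀ {xs} → Cl xs x → Cl xs y → Cl xs z
    cl-third = close (pair id (∷-⊑ (there (here refl)) (∷-⊑ (there (there (here refl))) (∷-⊑ (here refl) λ ())))
      (x≢z ∘ sym) (y≢z ∘ sym))

    cl-second : ∀ {xs} → Cl xs x → Cl xs z → Cl xs y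
    cl-second = close (pair (∷-⊑ (here refl) (∷-⊑ (there (there (here refl))) (∷-⊑ (there (here refl)) λ ())))
      (∷-⊑ (there (here refl)) (∷-⊑ (here refl) (∷-⊑ (there (there (here refl))) λ ()))) (x≢y ∘ sym) y≢z)

    cl-first : ∀ {xs} → Cl xs y → Cl xs z → Cl xs x
    cl-first = close (pair (∷-⊑ (there (here refl)) (∷-⊑ (there (there (here refl))) (∷-⊑ (here refl) λ ())))
      (∷-⊑ (here refl) (∷-⊑ (there (here refl)) (∷-⊑ (there (there (here refl))) λ ()))) x≢y x≢z)

  -- Single edges are independent in `L`, so two dependent parallel edges would form a circuit; but
  -- a 2-edge cycle with different labels is unbalanced.
  parallel-¬cl : ∀ {x y} → x ≢ y → src x ≡ src y → tgt x ≡ tgt y → ¬ Cl (x ∷ []) y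
  parallel-¬cl {x} {y} x≢y p q = FM.independent⇒¬cl (λ { (here refl) → x≢y refl })
    (decidable-stable (indep? _) λ dep → twoCycle-unbalanced x y x≢y p q
      (Equivalence.to (circuits C _ (cycleSet-isEdgeSet C)) ((λ i → dep (indepL⇒indepK (y ∷ x ∷ [])
        (indep-⊆ L _ _ (toSubset-mono (y ∷ x ∷ []) {edges C} (∷-⊑ (there (here refl)) (∷-⊑ (here refl) λ ()))) i))) ,
          proper)))
    where
    C = twoCycle x y x≢y p q
    two : ∀ {e} → e ∈ edges C → e ≡ x ⊎ e ≡ y
    two (here r) = inj₁ r
    two (there (here r)) = inj₂ r
    proper : ∀ Y → Y ⊆ cycleSet C → ∃[ e ] (cycleSet C e ≡ true × Y e ≡ false) → Indep L Y
    proper Y s (e , Ce , Ye) with two (toSubset⁻ (edges C) Ce)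
    ... | inj₁ e≡x = indep-⊆ L (toSubset (y ∷ [])) Y (λ w Yw → rest w Yw (two (toSubset⁻ (edges C) (s w Yw))))
      (graphic⇒indepL (graphic-single y))
      where
      rest : ∀ w → Y w ≡ true → w ≡ x ⊎ w ≡ y → toSubset (y ∷ []) w ≡ true
      rest w Yw (inj₁ w≡x) = contradiction (trans (sym Ye) (subst (λ v → Y v ≡ true) (trans w≡x (sym e≡x)) Yw)) λ ()
      rest w Yw (inj₂ w≡y) = toSubset⁺ {xs = y ∷ []} (here w≡y)
    ... | inj₂ e≡y = indep-⊆ L (toSubset (x ∷ [])) Y (λ w Yw → rest w Yw (two (toSubset⁻ (edges C) (s w Yw))))
      (graphic⇒indepL (graphic-single x))
      where
      rest : ∀ w → Y w ≡ true → w ≡ x ⊎ w ≡ y → toSubset (x ∷ []) w ≡ true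
      rest w Yw (inj₂ w≡y) = contradiction (trans (sym Ye) (subst (λ v → Y v ≡ true) (trans w≡y (sym e≡y)) Yw)) λ ()
      rest w Yw (inj₁ w≡x) = toSubset⁺ {xs = x ∷ []} (here w≡x)

  distinct-indep⇒ind : ∀ {ys} → Distinct ys → Indep K (S.toSubset ys) → G.Ind ys
  distinct-indep⇒ind {[]} _ _ = tt
  distinct-indep⇒ind {y ∷ ys} (n , d) i = FM.independent⇒¬cl n i , distinct-indep⇒ind d (FM.indep-⊑ ys there i)

  -- The star shows that the cycle matroid has rank at least `m`, so the lift has rank at least
  -- `m + 2`, one more than `S` can span.
  nonElementary⇒no-small-span : NonElementary (suc m) Γ L → ∀ S → length S ≤ suc m → ¬ (∀ e → Cl S e)
  nonElementary⇒no-small-span (rM , rL , (_ , maxM) , ((X , indX , f , f-inj , fX , _) , _) , le) S lenS spans =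
    ℕ.<-irrefl refl (ℕ.≤-trans rank≥ (subst₂ _≤_ (List.length-tabulate g) (List.length-map inj₁ S) rank≤))
    where
    g : Fin rL → E ⊎ Fin k
    g = inj₁ ∘ f
    ind : G.Ind (List.tabulate g)
    ind = distinct-indep⇒ind (tabulate-distinct (f-inj ∘ Sum.inj₁-injective))
      (indep-⊆ K _ _ (λ p q → case ∈-tabulate⁻ {f = g} (S.toSubset⁻ (List.tabulate g) q) of λ { (i , refl) → fX i })
        (Equivalence.from (deletion X) indX))
      where module S′ = S
    rank≤ : length (List.tabulate g) ≤ length (map inj₁ S)
    rank≤ = G.steinitz (List.tabulate g) ind λ q → case ∈-tabulate⁻ {f = g} q of λ { (i , refl) → spans (f i) }
    rank≥ : suc (length S) ≤ rL
    rank≥ = ℕ.≤-trans (s≤s lenS) (ℕ.≤-trans (ℕ.≤-reflexive (ℕ.+-comm 2 m))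
      (ℕ.≤-trans (ℕ.+-monoˡ-≤ 2 (maxM _ m star-graphic star-size)) le))

-- A partition into subgroups as a relation: `H g h` says that `h` is ε or in the block of `g`. As ε
-- lies in every `H g`, symmetry is demanded only for `h ≢ ε`. `proper` rules out a single block.
record IsSpread (Γ : FiniteGroup) (H : Elt Γ → Elt Γ → Set) : Set where
  open FiniteGroup Γ
  field
    ∋ε : ∀ g → H g ε
    ∋self : ∀ g → H g g
    ∋quotient : ∀ g a b → H g a → H g b → H g (a ⁻¹ ∙ b)
    symmetric : ∀ g h → H g h → h ≢ ε → H h g
    transitive : ∀ g h k → H g h → H h k → H g k
    proper : ∀ g → g ≢ ε → ∃[ k ] ¬ H g k

-- The partition into subgroups obtained from three vertices

module ThreeVertices {m : ℕ} {Γ : FiniteGroup} (L : Matroid (Edge (3 + m) Γ)) {k : ℕ} (K : Matroid (Edge (3 + m) Γ ⊎ Fin k))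
  (contraction : ∀ X → ContractIndep K X ⇔ GraphicIndep (3 + m) Γ X)
  (deletion : ∀ X → DeleteIndep K X ⇔ Indep L X)
  (circuits : ∀ (C : Cycle (3 + m) Γ) X → EdgeSetOf C X → (IsCircuit (Indep L) X ⇔ Balanced C))
  (indep? : ∀ X → Dec (Indep K X))
  where
  open GroupFacts Γ
  open Graph (3 + m) Γ
  open Star (2 + m) Γ
  open LiftGeometry L K contraction deletion circuits indep? public

  v₀ v₁ v₂ : Fin (3 + m)
  v₀ = fzero
  v₁ = fsuc fzero
  v₂ = fsuc (fsuc fzero)

  A B C : Carrier → E
  A = edge v₀ v₁ z<s
  B = edge v₁ v₂ (s<s z<s)
  C = edge v₀ v₂ z<s

  only : Fin (3 + m) → Fin (3 + m) → Bool
  only i v = does (v Fin.≟ i)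

  ABC : ∀ {xs a b c} → a ∙ b ≡ c → Cl xs (A a) → Cl xs (B b) → Cl xs (C c)
  ABC {a = a} {b} {c} e = cl-third {A a} {B b} {C c} refl refl refl e

  BCA : ∀ {xs a b c} → a ∙ b ≡ c → Cl xs (B b) → Cl xs (C c) → Cl xs (A a)
  BCA {a = a} {b} {c} e = cl-first {A a} {B b} {C c} refl refl refl e

  ACB : ∀ {xs a b c} → a ∙ b ≡ c → Cl xs (A a) → Cl xs (C c) → Cl xs (B b)
  ACB {a = a} {b} {c} e = cl-second {A a} {B b} {C c} refl refl refl e

  H : Carrier → Carrier → Set
  H g h = Cl (C ε ∷ C g ∷ []) (C h)

  H? : ∀ g h → Dec (H g h)
  H? g h = cl? _ _

  all₂ : ∀ {Q : E → Set} {x y} → Q x → Q y → ∀ {z} → z ∈ x ∷ y ∷ [] → Q z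
  all₂ p q (here refl) = p
  all₂ p q (there (here refl)) = q

  first : ∀ {x xs} → Cl (x ∷ xs) x
  first = cl-∈ (here refl)

  second : ∀ {x y xs} → Cl (x ∷ y ∷ xs) y
  second = cl-∈ (there (here refl))

  third : ∀ {x y z xs} → Cl (x ∷ y ∷ z ∷ xs) z
  third = cl-∈ (there (there (here refl)))

  -- Projection from `A ε`: the triangles on `A ε`, `B x`, `C x` are balanced, and `A ε` crosses the
  -- cut around `v₀` while the `B` edges do not.
  C⇒B : ∀ {x y z} → Cl (C x ∷ C y ∷ []) (C z) → Cl (B x ∷ B y ∷ []) (B z)
  C⇒B c = drop (only v₀) {A ε} (λ ()) (all₂ {λ e → Mono (only v₀) e} refl refl) refl
    (ACB (identityˡ _) first (cl-trans (all₂ {Cl _} (ABC (identityˡ _) first second) (ABC (identityˡ _) first third)) c))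

  -- Adding `B ε` to the line of `C ε` and `C g` brings in `A ε`, then `B g`, then the whole
  -- corresponding line of `B` edges, and also `A (g ⁻¹)` from `B g` and `C ε`. The triangle on
  -- `A (g ⁻¹)` and `B h` yields the required `C` edge, and `B ε` is dropped by the cut around `v₁`.
  H-quotient-self : ∀ g h → H g h → H g (g ⁻¹ ∙ h)
  H-quotient-self g h c = drop (only v₁) {B ε} (λ ()) (all₂ {λ e → Mono (only v₁) e} refl refl) refl
    (ABC refl (BCA (inverseˡ g) Bg second) (cl-trans (all₂ {Cl _} first Bg) (C⇒B c)))
    where
    Bg : Cl (B ε ∷ C ε ∷ C g ∷ []) (B g)
    Bg = ACB (identityˡ g) (BCA (identityˡ ε) first second) third

  H-symmetric : ∀ g h → H g h → h ≢ ε → H h g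
  H-symmetric g h c h≢ε = cl-mono (∷-⊑ (there (here refl)) (∷-⊑ (here refl) λ ()))
    (cl-exchange (cl-mono (∷-⊑ (there (here refl)) (∷-⊑ (here refl) λ ())) c)
      (parallel-¬cl (λ e → h≢ε (sym (cong label e))) refl refl))

  H-transitive : ∀ g h k → H g h → H h k → H g k
  H-transitive g h k c d = cl-trans (all₂ {Cl _} first c) d

  H-quotient : ∀ g a b → H g a → H g b → H g (a ⁻¹ ∙ b)
  H-quotient g a b ga gb with a ≟ ε
  ... | yes refl = subst (H g) (sym (trans (cong (_∙ b) ε⁻¹≈ε) (identityˡ b))) gb
  -- For `a ≢ ε` the block of `g` is also the block of `a`, so the previous lemma applies with `a`
  -- as base.
  ... | no a≢ε = H-transitive g a _ ga (H-quotient-self a b (H-transitive a g b (H-symmetric g a ga a≢ε) gb))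

  -- One edge besides the spanning star then generates all `C` edges, from these all edges at `v₀`,
  -- and every other edge closes a balanced triangle with two edges at `v₀`.
  line-spans : ∀ g → (∀ h → H g h) → ∀ e → Cl (C g ∷ star) e
  line-spans g all e = spans e
    where
    S = C g ∷ star
    inStar : ∀ j → Cl S (spoke j)
    inStar j = cl-∈ (there (∈-tabulate⁺ {f = spoke} j))
    allC : ∀ h → Cl S (C h)
    allC h = cl-trans (all₂ {Cl _} (inStar (fsuc fzero)) first) (all h)
    allB : ∀ h → Cl S (B h)
    allB h = ACB (identityˡ h) (inStar fzero) (allC h)
    allStar : ∀ j h → Cl S (edge fzero (fsuc j) z<s h)
    allStar fzero h = BCA (identityʳ h) (allB ε) (allC h)
    allStar (fsuc fzero) h = allC h
    allStar (fsuc (fsuc j)) h = cl-third {C h} {edge v₂ (fsuc (fsuc (fsuc j))) (s<s (s<s z<s)) ε} refl refl refl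
      (identityʳ h) (allC h)
      (cl-second {C ε} {z = spoke (fsuc (fsuc j))} refl refl refl (identityˡ ε) (allC ε) (inStar (fsuc (fsuc j))))
    spans : ∀ e → Cl S e
    spans (edge fzero fzero () _)
    spans (edge fzero (fsuc t) _ h) = allStar t h
    spans (edge (fsuc s) fzero () _)
    spans (edge (fsuc s) (fsuc t) s<t h) = cl-second {edge fzero (fsuc s) z<s ε} {edge (fsuc s) (fsuc t) s<t h}
      {edge fzero (fsuc t) z<s h}
      refl refl refl (identityˡ h) (allStar s ε) (allStar t h)

  H-proper : NonElementary (3 + m) Γ L → ∀ g → g ≢ ε → ∃[ h ] ¬ H g h
  H-proper ne g g≢ε with ∃-dec enum (λ h → ¬? (H? g h))
  ... | yes r = r
  ... | no none = contradiction (line-spans g (λ h → decidable-stable (H? g h) (λ n → none (h , n))))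
    (nonElementary⇒no-small-span ne _ (ℕ.≤-reflexive (cong suc (List.length-tabulate spoke))))

  H-isSpread : NonElementary (3 + m) Γ L → IsSpread Γ H
  H-isSpread ne = record
    { ∋ε = λ g → first ; ∋self = λ g → second ; ∋quotient = H-quotient
    ; symmetric = H-symmetric ; transitive = H-transitive ; proper = H-proper ne }

-- Normality of the blocks from a fourth vertex

module FourVertices {m : ℕ} {Γ : FiniteGroup} (L : Matroid (Edge (4 + m) Γ)) {k : ℕ} (K : Matroid (Edge (4 + m) Γ ⊎ Fin k))
  (contraction : ∀ X → ContractIndep K X ⇔ GraphicIndep (4 + m) Γ X)
  (deletion : ∀ X → DeleteIndep K X ⇔ Indep L X)
  (circuits : ∀ (C : Cycle (4 + m) Γ) X → EdgeSetOf C X → (IsCircuit (Indep L) X ⇔ Balanced C))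
  (indep? : ∀ X → Dec (Indep K X))
  where
  open GroupFacts Γ
  open Graph (4 + m) Γ
  open ThreeVertices L K contraction deletion circuits indep? public

  v₃ : Fin (4 + m)
  v₃ = fsuc (fsuc (fsuc fzero))

  D I G′ : Carrier → E
  D = edge v₁ v₃ (s<s z<s)
  I = edge v₂ v₃ (s<s (s<s z<s))
  G′ = edge v₀ v₃ z<s

  BDI : ∀ {xs b i d} → b ∙ i ≡ d → Cl xs (B b) → Cl xs (D d) → Cl xs (I i)
  BDI {b = b} {i} {d} e = cl-second {B b} {I i} {D d} refl refl refl e

  BID : ∀ {xs b i d} → b ∙ i ≡ d → Cl xs (B b) → Cl xs (I i) → Cl xs (D d)
  BID {b = b} {i} {d} e = cl-third {B b} {I i} {D d} refl refl refl e

  IGC : ∀ {xs c i g} → c ∙ i ≡ g → Cl xs (I i) → Cl xs (G′ g) → Cl xs (C c)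
  IGC {c = c} {i} {g} e = cl-first {C c} {I i} {G′ g} refl refl refl e

  ADG : ∀ {xs a d g} → a ∙ d ≡ g → Cl xs (A a) → Cl xs (D d) → Cl xs (G′ g)
  ADG {a = a} {d} {g} e = cl-third {A a} {D d} {G′ g} refl refl refl e

  all₃ : ∀ {Q : E → Set} {x y w} → Q x → Q y → Q w → ∀ {z} → z ∈ x ∷ y ∷ w ∷ [] → Q z
  all₃ p q r (here refl) = p
  all₃ p q r (there m) = all₂ q r m

  cut₁₃ : Fin (4 + m) → Bool
  cut₁₃ v = does (v Fin.≟ v₁) ∨ does (v Fin.≟ v₃)

  -- The lines C⟨ε,g⟩ and D⟨ε,x⁻¹gx⟩ are coplanar: both are images of one line under projection from A x.
  C-D-coplanar : ∀ x g → Cl (C ε ∷ C g ∷ D ε ∷ []) (D (x ⁻¹ ∙ g ∙ x))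
  C-D-coplanar x g = drop cut₁₃ {A x} (λ ()) (all₃ {λ e → Mono cut₁₃ e} refl refl refl) refl
    (BID refl (ACB (x∙x⁻¹y x g) first third)
      (BDI (inverseˡ x) (ACB (inverseʳ x) first second) fourth))
    where
    fourth : ∀ {x y z w xs} → Cl (x ∷ y ∷ z ∷ w ∷ xs) w
    fourth = cl-∈ (there (there (there (here refl))))

  -- The way back from `D` to `C`. From `A a` and the given edges one reaches `B (a ⁻¹)`, then
  -- `I a`, and also `G′ (a ∙ g)`; the last two close a balanced triangle with the conjugate.
  D-C-coplanar : ∀ a g → Cl (D ε ∷ D g ∷ C ε ∷ []) (C (a ∙ g ∙ a ⁻¹))
  D-C-coplanar a g = drop cut₁₃ {A a} (λ ()) (all₃ {λ e → Mono cut₁₃ e} refl refl refl) refl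
    (IGC (xy⁻¹∙y (a ∙ g) a)
      (BDI (inverseˡ a) (ACB (inverseʳ a) first fourth) second) (ADG refl first third))
    where
    fourth : ∀ {x y z w xs} → Cl (x ∷ y ∷ z ∷ w ∷ xs) w
    fourth = cl-∈ (there (there (there (here refl))))

  -- Go from `C` to `D` with trivial conjugation and return with conjugation by `a`. The only
  -- auxiliary edge, `D ε`, crosses the cut around `v₁` and is dropped.
  H-normal : ∀ g a → H g (a ∙ g ∙ a ⁻¹)
  H-normal g a = drop (only v₁) {D ε} (λ ()) (all₂ {λ e → Mono (only v₁) e} refl refl) refl
    (cl-trans (all₃ {Cl _} first Dg second) (D-C-coplanar a g))
    where
    Dg : Cl (D ε ∷ C ε ∷ C g ∷ []) (D g)
    Dg = cl-trans (all₃ {Cl _} second third first)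
      (subst (λ h → Cl (C ε ∷ C g ∷ D ε ∷ []) (D h))
        (trans (identityʳ _) (trans (cong (_∙ g) ε⁻¹≈ε) (identityˡ g))) (C-D-coplanar ε g))

-- Elementary abelian groups

module Powers (Γ : FiniteGroup) where
  open GroupFacts Γ

  infixr 8 _^_
  _^_ : Carrier → ℕ → Carrier
  x ^ zero = ε
  x ^ suc n = x ∙ x ^ n

  ^-+ : ∀ x m n → x ^ (m + n) ≡ x ^ m ∙ x ^ n
  ^-+ x zero n = sym (identityˡ _)
  ^-+ x (suc m) n = trans (cong (x ∙_) (^-+ x m n)) (sym (assoc _ _ _))

  ^-* : ∀ x m n → x ^ (m * n) ≡ (x ^ n) ^ m
  ^-* x zero n = refl
  ^-* x (suc m) n = trans (^-+ x n (m * n)) (cong (x ^ n ∙_) (^-* x m n))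

  ε^ : ∀ n → ε ^ n ≡ ε
  ε^ zero = refl
  ε^ (suc n) = trans (identityˡ _) (ε^ n)

  ^-1 : ∀ x → x ^ 1 ≡ x
  ^-1 = identityʳ

  module _ (p : ℕ) .⦃ _ : NonZero p ⦄ {x : Carrier} (x^p : x ^ p ≡ ε) where
    ^-multiple : ∀ k → x ^ (k * p) ≡ ε
    ^-multiple k = trans (^-* x k p) (trans (cong (_^ k) x^p) (ε^ k))

    ^-% : ∀ n → x ^ (n % p) ≡ x ^ n
    ^-% n = sym (begin
      x ^ n                               ≡⟨ cong (x ^_) (m≡m%n+[m/n]*n n p) ⟩
      x ^ (n % p + n / p * p)             ≡⟨ ^-+ x (n % p) _ ⟩
      x ^ (n % p) ∙ x ^ (n / p * p)       ≡⟨ cong (x ^ (n % p) ∙_) (^-multiple (n / p)) ⟩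
      x ^ (n % p) ∙ ε                     ≡⟨ identityʳ _ ⟩
      x ^ (n % p)                         ∎)
      where open ≡-Reasoning

  ^-addMod : ∀ {p x} → x ^ p ≡ ε → ∀ (a b : Fin p) → x ^ toℕ (addMod a b) ≡ x ^ toℕ a ∙ x ^ toℕ b
  ^-addMod {suc p} {x} x^p a b = trans (cong (x ^_) (Fin.toℕ-fromℕ< (m%n<n (toℕ a + toℕ b) (suc p))))
    (trans (^-% (suc p) x^p (toℕ a + toℕ b)) (^-+ x (toℕ a) (toℕ b)))

enum-Vec : ∀ {A} → Enum A → ∀ n → Enum (Vec A n)
enum-Vec en zero = [] ∷ [] , λ { [] → here refl }
enum-Vec en (suc n) = enum-image (λ (x , xs) → x ∷ xs) (λ { (x ∷ xs) → (x , xs) , refl }) (enum-× en (enum-Vec en n))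

record Elementary (Γ : FiniteGroup) (p : ℕ) : Set where
  open FiniteGroup Γ
  field
    isPrime : Prime p
    commutative : ∀ x y → x ∙ y ≡ y ∙ x
    exponent : ∀ x → Powers._^_ Γ x p ≡ ε

module ElementaryFacts {Γ : FiniteGroup} {p : ℕ} (el : Elementary Γ p) where
  open GroupFacts Γ
  open Powers Γ public
  open Elementary el public

  instance
    p-nonZero : NonZero p
    p-nonZero = prime⇒nonZero isPrime

  interchange : ∀ a b c d → (a ∙ b) ∙ (c ∙ d) ≡ (a ∙ c) ∙ (b ∙ d)
  interchange a b c d = begin
    (a ∙ b) ∙ (c ∙ d)   ≡⟨ assoc a b _ ⟩
    a ∙ (b ∙ (c ∙ d))   ≡⟨ cong (a ∙_) (assoc b c d) ⟨
    a ∙ ((b ∙ c) ∙ d)   ≡⟨ cong (λ z → a ∙ (z ∙ d)) (commutative b c) ⟩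
    a ∙ ((c ∙ b) ∙ d)   ≡⟨ cong (a ∙_) (assoc c b d) ⟩
    a ∙ (c ∙ (b ∙ d))   ≡⟨ assoc a c _ ⟨
    (a ∙ c) ∙ (b ∙ d)   ∎
    where open ≡-Reasoning

  ^-∙ : ∀ x y n → (x ∙ y) ^ n ≡ x ^ n ∙ y ^ n
  ^-∙ x y zero = sym (identityˡ _)
  ^-∙ x y (suc n) = trans (cong (x ∙ y ∙_) (^-∙ x y n)) (interchange x y _ _)

  ⁻¹-∙ : ∀ x y → (x ∙ y) ⁻¹ ≡ x ⁻¹ ∙ y ⁻¹
  ⁻¹-∙ x y = trans (⁻¹-anti-homo-∙ x y) (commutative _ _)

  1≤p : 1 ≤ p
  1≤p = >-nonZero⁻¹ p

  ^-pred : ∀ x → x ^ (p ∸ 1) ≡ x ⁻¹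
  ^-pred x = inverseʳ-unique x _ (trans (cong (x ^_) (ℕ.m+[n∸m]≡n 1≤p)) (exponent x))

  module Vectors (N : ℕ) where
    -- The space Γ^N over F_p in multiplicative notation: `_∙̇_` is addition and a residue acts as
    -- an exponent.
    W : Set
    W = Fin N → Carrier

    infix 4 _≐_
    _≐_ : W → W → Set
    w ≐ w′ = ∀ i → w i ≡ w′ i

    infixl 7 _∙̇_
    _∙̇_ : W → W → W
    (w ∙̇ w′) i = w i ∙ w′ i

    -- Closure under scalars and inverses follows from closure under products, an inverse being the
    -- power with exponent `p ∸ 1`.
    record Subspace (Q : W → Set) : Set where
      field
        resp : ∀ {w w′} → w ≐ w′ → Q w → Q w′
        has-ε : Q (λ _ → ε)
        has-∙ : ∀ {w w′} → Q w → Q w′ → Q (w ∙̇ w′)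

      has-^ : ∀ {w} → Q w → ∀ n → Q (λ i → w i ^ n)
      has-^ q zero = has-ε
      has-^ q (suc n) = has-∙ q (has-^ q n)

      has-⁻¹ : ∀ {w} → Q w → Q (λ i → w i ⁻¹)
      has-⁻¹ q = resp (λ i → ^-pred _) (has-^ q (p ∸ 1))

      -- Multiplication by a nonzero residue is invertible mod p, by Bézout.
      has-root : ∀ {w} d → .⦃ NonZero d ⦄ → d < p → Q (λ i → w i ^ d) → Q w
      has-root {w} d d<p q with coprime-Bézout (prime⇒coprime isPrime d<p)
      ... | Bézout.+- x y e = resp {w = λ i → (w i ^ (y * d)) ⁻¹}
        (λ i → sym (inverseˡ-unique (w i) _ (trans (cong (w i ^_) e) (^-multiple p (exponent (w i)) x))))
            (has-⁻¹ (resp (λ i → sym (^-* (w i) y d)) (has-^ q y)))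
      ... | Bézout.-+ x y e = resp {w = λ i → w i ^ (y * d)} (λ i → trans (cong (w i ^_) (sym e))
              (trans (cong (w i ∙_) (^-multiple p (exponent (w i)) x)) (identityʳ (w i))))
            (resp (λ i → sym (^-* (w i) y d)) (has-^ q y))

    module Span {P : Set} (vec : P → W) where
      comb : (xs : List P) → Vec (Fin p) (length xs) → W
      comb [] [] _ = ε
      comb (x ∷ xs) (c ∷ cs) i = vec x i ^ toℕ c ∙ comb xs cs i

      Spans : List P → W → Set
      Spans xs w = ∃[ cs ] comb xs cs ≐ w

      comb-∙ : ∀ xs cs ds → comb xs (cs +ᵥ ds) ≐ comb xs cs ∙̇ comb xs ds
      comb-∙ [] [] [] i = sym (identityˡ ε)
      comb-∙ (x ∷ xs) (c ∷ cs) (d ∷ ds) i =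
        trans (cong₂ _∙_ (^-addMod (exponent (vec x i)) c d) (comb-∙ xs cs ds i)) (interchange _ _ _ _)

      spans-[] : ∀ {w} → Spans [] w → w ≐ (λ _ → ε)
      spans-[] ([] , q) i = sym (q i)

      zeroᶠ : Fin p
      zeroᶠ = fromℕ< 1≤p

      comb-zero : ∀ xs → Spans xs (λ _ → ε)
      comb-zero [] = [] , λ _ → refl
      comb-zero (x ∷ xs) with comb-zero xs
      ... | cs , e = zeroᶠ ∷ cs , λ i → trans (cong₂ _∙_ (cong (vec x i ^_) (Fin.toℕ-fromℕ< 1≤p)) (e i)) (identityˡ ε)

      spans-subspace : ∀ xs → Subspace (Spans xs)
      spans-subspace xs = record
        { resp = λ e (cs , f) → cs , λ i → trans (f i) (e i)
        ; has-ε = comb-zero xs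
        ; has-∙ = λ (cs , e) (ds , f) → cs +ᵥ ds , λ i → trans (comb-∙ xs cs ds i) (cong₂ _∙_ (e i) (f i)) }

      spans-∈ : ∀ {xs x} → x ∈ xs → Spans xs (vec x)
      spans-∈ {y ∷ xs} (here refl) with comb-zero xs
      ... | cs , e = oneᶠ ∷ cs , λ i → trans (cong₂ _∙_ (cong (vec y i ^_) (Fin.toℕ-fromℕ< 1<p)) (e i))
        (trans (identityʳ _) (^-1 _))
        where
        1<p : 1 < p
        1<p = nonTrivial⇒n>1 p ⦃ prime⇒nonTrivial isPrime ⦄
        oneᶠ : Fin p
        oneᶠ = fromℕ< 1<p
      spans-∈ {y ∷ xs} (there m) with spans-∈ m
      ... | cs , e = zeroᶠ ∷ cs , λ i → trans (cong₂ _∙_ (cong (vec y i ^_) (Fin.toℕ-fromℕ< 1≤p)) (e i)) (identityˡ _)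

      spans-least : ∀ {Q xs w} → Subspace Q → (∀ {x} → x ∈ xs → Q (vec x)) → Spans xs w → Q w
      spans-least {Q} S q (cs , e) = Subspace.resp S e (go _ cs q)
        where
        go : ∀ xs cs → (∀ {x} → x ∈ xs → Q (vec x)) → Q (comb xs cs)
        go [] [] _ = Subspace.has-ε S
        go (x ∷ xs) (c ∷ cs) q = Subspace.has-∙ S (Subspace.has-^ S (q (here refl)) (toℕ c)) (go xs cs (q ∘ there))

      spans-coefficient : ∀ {Q x xs c cs w} → Subspace Q → comb (x ∷ xs) (c ∷ cs) ≐ w → Q w → (∀ {y} → y ∈ xs → Q (vec y)) →
        Q (λ i → vec x i ^ toℕ c)
      spans-coefficient {Q} {x} {xs} {c} {cs} {w} S e qw q = Subspace.resp S
        (λ i → trans (cong (_∙ comb xs cs i ⁻¹) (sym (e i))) (xy∙y⁻¹ _ _))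
        (Subspace.has-∙ S qw (Subspace.has-⁻¹ S (spans-least S q (cs , λ _ → refl))))

      spans-drop-zero : ∀ {x xs c cs w} → toℕ c ≡ 0 → comb (x ∷ xs) (c ∷ cs) ≐ w → Spans xs w
      spans-drop-zero {x} {xs} {c} {cs} c≡0 e = cs , λ i → trans (trans (sym (identityˡ _))
        (cong (_∙ comb xs cs i) (sym (cong (vec x i ^_) c≡0)))) (e i)

      spanGeometry : Pregeometry P
      spanGeometry = record
        { Cl = λ xs y → Spans xs (vec y)
        ; cl? = λ xs y → ∃-dec (enum-Vec (enum-Fin p) _) (λ cs → Fin.all? (λ i → comb xs cs i ≟ vec y i))
        ; cl-∈ = spans-∈
        ; cl-trans = λ {xs} sp → spans-least (spans-subspace xs) sp
        ; cl-exchange = exch }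
        where
        exch : ∀ {xs x y} → Spans (x ∷ xs) (vec y) → ¬ Spans xs (vec y) → Spans (y ∷ xs) (vec x)
        exch {xs} {x} {y} (c ∷ cs , e) n = go (toℕ c) refl
          where
          S = spans-subspace (y ∷ xs)
          -- `k` is the coefficient of `x`. If it is 0, then `xs` already spans `vec y`; otherwise
          -- `has-root` divides by it.
          go : ∀ k → toℕ c ≡ k → Spans (y ∷ xs) (vec x)
          go zero eq = contradiction (spans-drop-zero {x} {xs} {c} {cs} eq e) n
          go (suc d) eq = Subspace.has-root S (suc d) (subst (_< p) eq (Fin.toℕ<n c))
            (subst (λ k → Spans (y ∷ xs) (λ i → vec x i ^ k)) eq
              (spans-coefficient {c = c} {cs} S e (spans-∈ (here refl)) (λ m → spans-∈ (there m))))

module Coordinates {Γ : FiniteGroup} {p : ℕ} (el : Elementary Γ p) where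
  open GroupFacts Γ
  open ElementaryFacts el
  open Vectors 1
  open Span {Carrier} (λ x _ → x)
  open Pregeometry spanGeometry

  -- Two different leading coefficients would put a nontrivial power of `g` into the span of `gs`,
  -- and `has-root` would put `g` itself there.
  comb-injective : ∀ gs → Ind gs → ∀ cs ds → comb gs cs ≐ comb gs ds → cs ≡ ds
  comb-injective [] _ [] [] _ = refl
  comb-injective (g ∷ gs) (n , ind) (c ∷ cs) (d ∷ ds) e = cong₂ _∷_ c≡d (comb-injective gs ind cs ds tail≐)
    where
    absurd : ∀ (c d : Fin p) cs ds → comb (g ∷ gs) (c ∷ cs) ≐ comb (g ∷ gs) (d ∷ ds) → ¬ (toℕ c < toℕ d)
    absurd c d cs ds e c<d = n (Subspace.has-root S (toℕ d ∸ toℕ c) ⦃ >-nonZero (ℕ.m<n⇒0<n∸m c<d) ⦄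
      (ℕ.≤-<-trans (ℕ.m∸n≤m _ (toℕ c)) (Fin.toℕ<n d))
      (Subspace.resp S (λ i → step i) (Subspace.has-∙ S (cs , λ _ → refl) (Subspace.has-⁻¹ S (ds , λ _ → refl)))))
      where
      S = spans-subspace gs
      step : ∀ i → comb gs cs i ∙ comb gs ds i ⁻¹ ≡ g ^ (toℕ d ∸ toℕ c)
      step i = trans (cong (_∙ comb gs ds i ⁻¹) (∙-cancelˡ (g ^ toℕ c) _ _ (begin
        g ^ toℕ c ∙ comb gs cs i                              ≡⟨ e i ⟩
        g ^ toℕ d ∙ comb gs ds i                              ≡⟨ cong (λ k → g ^ k ∙ comb gs ds i)
          (ℕ.m+[n∸m]≡n (ℕ.<⇒≤ c<d)) ⟨
        g ^ (toℕ c + (toℕ d ∸ toℕ c)) ∙ comb gs ds i          ≡⟨ cong (_∙ comb gs ds i) (^-+ g (toℕ c) _) ⟩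
        g ^ toℕ c ∙ g ^ (toℕ d ∸ toℕ c) ∙ comb gs ds i        ≡⟨ assoc _ _ _ ⟩
        g ^ toℕ c ∙ (g ^ (toℕ d ∸ toℕ c) ∙ comb gs ds i)      ∎))) (xy∙y⁻¹ _ _)
        where open ≡-Reasoning
    c≡d : c ≡ d
    c≡d = Fin.toℕ-injective (ℕ.≤-antisym (ℕ.≮⇒≥ (absurd d c ds cs (λ i → sym (e i)))) (ℕ.≮⇒≥ (absurd c d cs ds e)))
    tail≐ : comb gs cs ≐ comb gs ds
    tail≐ i = ∙-cancelˡ (g ^ toℕ c) _ _ (trans (e i) (cong (λ z → g ^ toℕ z ∙ comb gs ds i) (sym c≡d)))

  elementary⇒iso : Nontrivial Γ → (∀ g → ¬ (∀ x → ∃[ i ] x ≡ g ^ i)) → ∃[ j ] (2 ≤ j × IsoToZpj Γ p j)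
  elementary⇒iso (x₀ , x₀≢ε) noncyclic with basis (proj₁ enum)
  ... | gs , _ , ind , sp = length gs , big gs coords , mk↔ₛ′ coord (λ cs → comb gs cs fzero) left right , hom
    where
    coords : ∀ x → Spans gs (λ _ → x)
    coords x = sp (proj₂ enum x)
    coord : Carrier → Vec (Fin p) (length gs)
    coord x = proj₁ (coords x)
    right : ∀ x → comb gs (coord x) fzero ≡ x
    right x = proj₂ (coords x) fzero
    left : ∀ cs → coord (comb gs cs fzero) ≡ cs
    left cs = comb-injective gs ind _ _ λ { fzero → right _ }
    hom : ∀ x y → coord (x ∙ y) ≡ coord x +ᵥ coord y
    hom x y = comb-injective gs ind _ _ λ { fzero → trans (right (x ∙ y))
      (sym (trans (comb-∙ gs (coord x) (coord y) fzero) (cong₂ _∙_ (right x) (right y)))) }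
    -- An empty basis contradicts nontriviality, and a basis of one element would make the group
    -- cyclic.
    big : ∀ gs → (∀ x → Spans gs (λ _ → x)) → 2 ≤ length gs
    big [] s = case s x₀ of λ { ([] , e) → contradiction (sym (e fzero)) x₀≢ε }
    big (g ∷ []) s = contradiction (λ x → case s x of λ { (c ∷ [] , e) → toℕ c , trans (sym (e fzero)) (identityʳ _) })
      (noncyclic g)
    big (_ ∷ _ ∷ _) _ = s≤s (s≤s z≤n)

-- Partitions of a group into subgroups

module SpreadFacts {Γ : FiniteGroup} {H : Elt Γ → Elt Γ → Set} (S : IsSpread Γ H) where
  open GroupFacts Γ
  open Powers Γ
  open IsSpread S public

  ∋⁻¹ : ∀ {g a} → H g a → H g (a ⁻¹)
  ∋⁻¹ {g} {a} ha = subst (H g) (identityʳ _) (∋quotient g a ε ha (∋ε g))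

  ∋∙ : ∀ {g a b} → H g a → H g b → H g (a ∙ b)
  ∋∙ {g} {a} {b} ha hb = subst (λ z → H g (z ∙ b)) (⁻¹-involutive a) (∋quotient g (a ⁻¹) b (∋⁻¹ ha) hb)

  ∋^ : ∀ {g} n → H g (g ^ n)
  ∋^ zero = ∋ε _
  ∋^ (suc n) = ∋∙ (∋self _) (∋^ n)

  meet : ∀ {g k x} → H g x → H k x → x ≢ ε → H g k
  meet hg hk x≢ε = transitive _ _ _ hg (symmetric _ _ hk x≢ε)

module NormalSpread {Γ : FiniteGroup} {H : Elt Γ → Elt Γ → Set} (S : IsSpread Γ H) (H? : ∀ g h → Dec (H g h))
  (normal : ∀ g a → H g (FiniteGroup._∙_ Γ (FiniteGroup._∙_ Γ a g) (FiniteGroup._⁻¹ Γ a))) where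
  open GroupFacts Γ
  open Powers Γ
  open SpreadFacts S

  -- The commutator of g and k lies in both blocks.
  commute-apart : ∀ g k → ¬ H g k → g ∙ k ≡ k ∙ g
  commute-apart g k n with g ∙ k ∙ g ⁻¹ ∙ k ⁻¹ ≟ ε
  ... | yes e = sym (trans (cong (_∙ g) (sym (xy⁻¹≡ε⇒x≡y e))) (xy⁻¹∙y (g ∙ k) g))
  ... | no c≢ε = contradiction (meet inG inK c≢ε) n
    where
    inK : H k (g ∙ k ∙ g ⁻¹ ∙ k ⁻¹)
    inK = ∋∙ (normal k g) (∋⁻¹ (∋self k))
    inG : H g (g ∙ k ∙ g ⁻¹ ∙ k ⁻¹)
    inG = subst (H g) (begin
      g ∙ (k ∙ g ∙ k ⁻¹) ⁻¹          ≡⟨ cong (g ∙_) (⁻¹-anti-homo-∙ _ _) ⟩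
      g ∙ ((k ⁻¹) ⁻¹ ∙ (k ∙ g) ⁻¹)   ≡⟨ cong₂ (λ y z → g ∙ (y ∙ z)) (⁻¹-involutive k) (⁻¹-anti-homo-∙ k g) ⟩
      g ∙ (k ∙ (g ⁻¹ ∙ k ⁻¹))        ≡⟨ assoc g k _ ⟨
      g ∙ k ∙ (g ⁻¹ ∙ k ⁻¹)          ≡⟨ assoc (g ∙ k) _ _ ⟨
      g ∙ k ∙ g ⁻¹ ∙ k ⁻¹            ∎) (∋∙ (∋self g) (∋⁻¹ (normal g k)))
      where open ≡-Reasoning

  H-product-apart : ∀ g k → ¬ H g k → ¬ H g (g ∙ k)
  H-product-apart g k n c = n (subst (H g) (x⁻¹∙xy g k) (∋quotient g g (g ∙ k) (∋self g) c))

  commutative : ∀ g h → g ∙ h ≡ h ∙ g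
  commutative g h with g ≟ ε | h ≟ ε | H? g h
  ... | yes refl | _ | _ = trans (identityˡ h) (sym (identityʳ h))
  ... | no _ | yes refl | _ = trans (identityʳ g) (sym (identityˡ g))
  ... | no _ | no _ | no n = commute-apart g h n
  -- With `k` outside the common block, `h` commutes with both `k` and `g ∙ k`, which lie outside
  -- its block, and hence with `g`.
  ... | no g≢ε | no h≢ε | yes gh with proper g g≢ε
  ...   | k , n = ∙-cancelʳ k _ _ (begin
      g ∙ h ∙ k       ≡⟨ assoc g h k ⟩
      g ∙ (h ∙ k)     ≡⟨ cong (g ∙_) (commute-apart h k (λ c → n (transitive _ _ _ gh c))) ⟩
      g ∙ (k ∙ h)     ≡⟨ assoc g k h ⟨
      g ∙ k ∙ h       ≡⟨ commute-apart h (g ∙ k) (λ c → H-product-apart g k n (transitive _ _ _ gh c)) ⟨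
      h ∙ (g ∙ k)     ≡⟨ assoc h g k ⟨
      h ∙ g ∙ k       ∎)
    where open ≡-Reasoning

  ∙-^ : ∀ g k n → (g ∙ k) ^ n ≡ g ^ n ∙ k ^ n
  ∙-^ g k zero = sym (identityˡ ε)
  ∙-^ g k (suc n) = begin
    g ∙ k ∙ (g ∙ k) ^ n         ≡⟨ cong (g ∙ k ∙_) (∙-^ g k n) ⟩
    g ∙ k ∙ (g ^ n ∙ k ^ n)     ≡⟨ assoc _ _ _ ⟨
    g ∙ k ∙ g ^ n ∙ k ^ n       ≡⟨ cong (_∙ k ^ n)
      (trans (assoc g k _) (trans (cong (g ∙_) (commutative k _)) (sym (assoc g _ k)))) ⟩
    g ∙ g ^ n ∙ k ∙ k ^ n       ≡⟨ assoc _ _ _ ⟩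
    g ∙ g ^ n ∙ (k ∙ k ^ n)     ∎
    where open ≡-Reasoning

  -- If g^m = ε then (gk)^m = k^m lies in the blocks of gk and of k, which differ.
  torsion-apart : ∀ g k m → g ≢ ε → ¬ H g k → g ^ m ≡ ε → k ^ m ≡ ε
  torsion-apart g k m g≢ε n gm with k ^ m ≟ ε
  ... | yes e = e
  ... | no km≢ε = contradiction k∈g n
    where
    x = g ∙ k
    x~k : H x k
    x~k = meet (subst (H x) (trans (∙-^ g k m) (trans (cong (_∙ k ^ m) gm) (identityˡ _))) (∋^ m)) (∋^ m) km≢ε
    x~g : H x g
    x~g = subst (H x) (xy∙y⁻¹ g k) (∋∙ (∋self x) (∋⁻¹ x~k))
    k∈g : H g k
    k∈g = transitive _ _ _ (symmetric _ _ x~g g≢ε) x~k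

  torsion : ∀ g h m → g ≢ ε → h ≢ ε → g ^ m ≡ ε → h ^ m ≡ ε
  torsion g h m g≢ε h≢ε gm with H? g h
  ... | no n = torsion-apart g h m g≢ε n gm
  -- Two elements of one block are compared through an element `k` outside it.
  ... | yes gh with proper g g≢ε
  ...   | k , n = torsion-apart k h m (λ { refl → n (∋ε g) }) (λ kh → n (meet gh kh h≢ε)) (torsion-apart g k m g≢ε n gm)

  noncyclic : Nontrivial Γ → ∀ g → ¬ (∀ x → ∃[ i ] x ≡ g ^ i)
  noncyclic (x , x≢ε) g gen with g ≟ ε
  ... | yes refl = x≢ε (trans (proj₂ (gen x)) (ε^ (proj₁ (gen x))))
  ... | no g≢ε with proper g g≢ε
  ...   | k , n = n (subst (H g) (sym (proj₂ (gen k))) (∋^ (proj₁ (gen k))))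

-- Orders of elements and primality

module LeastExponent (Γ : FiniteGroup) where
  open GroupFacts Γ
  open Powers Γ

  some-exponent : ∀ x → ∃[ m ] x ^ suc m ≡ ε
  some-exponent x with Fin.pigeonhole (ℕ.n<1+n order) (λ i → code (x ^ toℕ i))
  ... | i , j , i<j , e = toℕ j ∸ suc (toℕ i) , ∙-cancelˡ (x ^ toℕ i) _ _ (begin
    x ^ toℕ i ∙ x ^ suc (toℕ j ∸ suc (toℕ i))   ≡⟨ ^-+ x (toℕ i) _ ⟨
    x ^ (toℕ i + suc (toℕ j ∸ suc (toℕ i)))     ≡⟨ cong (x ^_) (trans (ℕ.+-suc (toℕ i) _) (ℕ.m+[n∸m]≡n i<j)) ⟩
    x ^ toℕ j                                   ≡⟨ code-injective e ⟨
    x ^ toℕ i                                   ≡⟨ identityʳ _ ⟨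
    x ^ toℕ i ∙ ε                               ∎)
    where open ≡-Reasoning

  least-exponent : ∀ x → ∃[ p ] (1 ≤ p × x ^ p ≡ ε × (∀ q → 1 ≤ q → q < p → x ^ q ≢ ε))
  least-exponent x with some-exponent x
  ... | m , e = search m 1 ℕ.≤-refl (λ q 1≤q q<1 → contradiction (ℕ.<-≤-trans q<1 1≤q) (ℕ.<-irrefl refl))
    (subst (λ k → x ^ k ≡ ε) (ℕ.+-comm 1 m) e)
    where
    search : ∀ fuel s → 1 ≤ s → (∀ q → 1 ≤ q → q < s → x ^ q ≢ ε) → x ^ (fuel + s) ≡ ε →
      ∃[ p ] (1 ≤ p × x ^ p ≡ ε × (∀ q → 1 ≤ q → q < p → x ^ q ≢ ε))
    search zero s 1≤s below e = s , 1≤s , e , below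
    search (suc fuel) s 1≤s below e with x ^ s ≟ ε
    ... | yes e′ = s , 1≤s , e′ , below
    ... | no ne = search fuel (suc s) (ℕ.m≤n⇒m≤1+n 1≤s) below′ (subst (λ k → x ^ k ≡ ε) (sym (ℕ.+-suc fuel s)) e)
      where
      below′ : ∀ q → 1 ≤ q → q < suc s → x ^ q ≢ ε
      below′ q 1≤q q<1+s with ℕ.m≤n⇒m<n∨m≡n (ℕ.≤-pred q<1+s)
      ... | inj₁ q<s = below q 1≤q q<s
      ... | inj₂ refl = ne

  -- If p = qd with 1 < d < p, then `x ^ d` is not ε and its q-th power is ε, so by uniformity the
  -- q-th power of `x` is ε, against minimality of `p`. The uniformity may be doubly negated because
  -- primality is itself a refutation.
  uniform-torsion⇒prime : ∀ {x p} → x ≢ ε → 1 ≤ p → x ^ p ≡ ε → (∀ q → 1 ≤ q → q < p → x ^ q ≢ ε) →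
    ¬ ¬ (∀ h m → h ≢ ε → h ^ m ≡ ε → x ^ m ≡ ε) → Prime p
  uniform-torsion⇒prime {x} {suc zero} x≢ε _ e _ _ = contradiction (trans (sym (identityʳ x)) e) x≢ε
  uniform-torsion⇒prime {x} {p@(suc (suc _))} x≢ε _ e least tor = prime λ where
    (composite {d} d<p (divides q p≡q*d)) → tor λ torsion →
      let 1<d : 1 < d
          1<d = nonTrivial⇒n>1 d
          1≤q : 1 ≤ q
          1≤q = ℕ.n≢0⇒n>0 λ { refl → contradiction p≡q*d λ () }
          q<p : q < p
          q<p = subst (q <_) (sym p≡q*d) (ℕ.m<m*n q d ⦃ >-nonZero 1≤q ⦄ 1<d)
      in least q 1≤q q<p (torsion (x ^ d) q (least d (ℕ.<⇒≤ 1<d) d<p)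
        (trans (sym (^-* x q d)) (trans (cong (x ^_) (sym p≡q*d)) e)))

module Partitions (Γ : FiniteGroup) where
  open GroupFacts Γ

  module _ {H : Carrier → Carrier → Set} (S : IsSpread Γ H) (H? : ∀ g h → Dec (H g h)) (nt : Nontrivial Γ) where
    open SpreadFacts S

    private
      Separated : List Carrier → Set
      Separated [] = ⊤
      Separated (x ∷ xs) = (∀ {r} → r ∈ xs → ¬ H r x) × Separated xs

      -- A greedy transversal of the blocks: a nonidentity element is kept exactly when no
      -- representative kept so far has it in its block. Positions in this list will number the
      -- blocks.
      representatives : ∀ xs → ∃[ rs ] ((∀ {r} → r ∈ rs → r ≢ ε) × Separated rs ×
        (∀ {x} → x ∈ xs → x ≢ ε → Any (λ r → H r x) rs))
      representatives [] = [] , (λ ()) , tt , λ ()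
      representatives (x ∷ xs) with representatives xs
      ... | rs , ne , sep , cov with x ≟ ε | any? (λ r → H? r x) rs
      ...   | yes x≡ε | _ = rs , ne , sep , λ { (here refl) n → contradiction x≡ε n ; (there m) → cov m }
      ...   | no _ | yes a = rs , ne , sep , λ { (here refl) _ → a ; (there m) → cov m }
      ...   | no x≢ε | no na = x ∷ rs , (λ { (here refl) → x≢ε ; (there m) → ne m }) , ((λ m h → na (lose m h)) , sep) ,
                λ { (here refl) _ → here (∋self x) ; (there m) n → there (cov m n) }

      reps = proj₁ (representatives (proj₁ enum))
      k = length reps
      rep : Fin k → Carrier
      rep = List.lookup reps

      rep≢ε : ∀ i → rep i ≢ ε
      rep≢ε i = proj₁ (proj₂ (representatives (proj₁ enum))) (∈-lookup i)

      separated-unique : ∀ {rs} → (∀ {r} → r ∈ rs → r ≢ ε) → Separated rs → ∀ i j → H (List.lookup rs i) (List.lookup rs j) →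
        i ≡ j
      separated-unique {x ∷ rs} ne (n , s) fzero fzero h = refl
      separated-unique {x ∷ rs} ne (n , s) fzero (fsuc j) h = contradiction (symmetric _ _ h (ne (there (∈-lookup j))))
        (n (∈-lookup j))
      separated-unique {x ∷ rs} ne (n , s) (fsuc i) fzero h = contradiction h (n (∈-lookup i))
      separated-unique {x ∷ rs} ne (n , s) (fsuc i) (fsuc j) h = cong fsuc (separated-unique (ne ∘ there) s i j h)

      rep-unique : ∀ {i j x} → H (rep i) x → H (rep j) x → x ≢ ε → i ≡ j
      rep-unique {i} {j} p q x≢ε = let (_ , ne , sep , _) = representatives (proj₁ enum) in
        separated-unique ne sep i j (meet p q x≢ε)

      nonid-class : ∀ x → x ≢ ε → ∃[ i ] H (rep i) x
      nonid-class x x≢ε = let a = proj₂ (proj₂ (proj₂ (representatives (proj₁ enum)))) (proj₂ enum x) x≢ε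
        in index a , Any.lookup-index a

      class : ∀ x → ∃[ i ] (x ≢ ε → H (rep i) x)
      class x with x ≟ ε
      ... | no x≢ε = proj₁ (nonid-class x x≢ε) , λ _ → proj₂ (nonid-class x x≢ε)
      -- A default: the colour of ε is never read, but some colour must exist, and nontriviality
      -- supplies one.
      ... | yes x≡ε = proj₁ (nonid-class _ (proj₂ nt)) , λ n → contradiction x≡ε n

      c : Carrier → Fin k
      c = proj₁ ∘ class

      two : ∀ {k} {i j : Fin k} → i ≢ j → 2 ≤ k
      two {suc zero} {fzero} {fzero} n = contradiction refl n
      two {suc (suc _)} _ = s≤s (s≤s z≤n)

      2≤k : 2 ≤ k
      2≤k with proper _ (proj₂ nt)
      ... | y , n = two {i = c (proj₁ nt)} {j = c y} λ e → n (transitive _ _ _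
            (symmetric _ _ (proj₂ (class _) (proj₂ nt)) (proj₂ nt))
            (subst (λ i → H (rep i) y) (sym e) (proj₂ (class y) λ { refl → n (∋ε _) })))

      to-block : ∀ {i g} → H (rep i) g → g ≡ ε ⊎ (g ≢ ε × c g ≡ i)
      to-block {i} {g} h = case g ≟ ε of λ where
        (yes e) → inj₁ e
        (no n) → inj₂ (n , rep-unique (proj₂ (class g) n) h n)

      from-block : ∀ {i g} → g ≡ ε ⊎ (g ≢ ε × c g ≡ i) → H (rep i) g
      from-block (inj₁ refl) = ∋ε _
      from-block {g = g} (inj₂ (n , refl)) = proj₂ (class g) n

    spread⇒partition : HasNontrivialPartition Γ
    spread⇒partition = k , 2≤k , c ,
      (λ i → rep i , rep≢ε i , rep-unique (proj₂ (class (rep i)) (rep≢ε i)) (∋self _) (rep≢ε i)) ,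
      λ i → inj₁ refl , (λ x y p q → to-block (∋∙ (from-block p) (from-block q))) , λ x p → to-block (∋⁻¹ (from-block p))

  module _ (nt : Nontrivial Γ) where
    private
      relation : Vec Bool _ → Carrier → Carrier → Set
      relation v g h = lookup v (combine (code g) (code h)) ≡ true

      relation? : ∀ v g h → Dec (relation v g h)
      relation? v g h = _ Bool.≟ _

      spread? : ∀ v → Dec (IsSpread Γ (relation v))
      spread? v = map′
        (λ (a , b , c , d , e , f) → record { ∋ε = a ; ∋self = b ; ∋quotient = c ; symmetric = d ; transitive = e ; proper =
          f })
        (λ s → let open IsSpread s in ∋ε , ∋self , ∋quotient , symmetric , transitive , proper)
        (all (λ g → R g ε) ×-dec all (λ g → R g g) ×-dec
         all (λ g → all λ a → all λ b → R g a →-dec R g b →-dec R g (a ⁻¹ ∙ b)) ×-dec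
         all (λ g → all λ h → R g h →-dec ¬? (h ≟ ε) →-dec R h g) ×-dec
         all (λ g → all λ h → all λ k → R g h →-dec R h k →-dec R g k) ×-dec
         all (λ g → ¬? (g ≟ ε) →-dec ∃-dec enum (λ k → ¬? (R g k))))
        where
        R = relation? v
        all : ∀ {Q : Carrier → Set} → (∀ a → Dec (Q a)) → Dec (∀ a → Q a)
        all = ∀-dec enum

      tabulated : ∀ {H} → IsSpread Γ H → (∀ g h → Dec (H g h)) → ∃[ v ] IsSpread Γ (relation v)
      tabulated {H} S H? = v , record
        { ∋ε = λ g → in-v (∋ε g) ; ∋self = λ g → in-v (∋self g)
        ; ∋quotient = λ g a b p q → in-v (∋quotient g a b (out p) (out q))
        ; symmetric = λ g h p n → in-v (symmetric g h (out p) n)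
        ; transitive = λ g h k p q → in-v (transitive g h k (out p) (out q))
        ; proper = λ g n → let (k , m) = proper g n in k , λ p → m (out p) }
        where
        open IsSpread S
        at : Fin order × Fin order → Bool
        at (i , j) = does (H? (uncode i) (uncode j))
        v = tabulate (at ∘ remQuot order)
        value : ∀ g h → lookup v (combine (code g) (code h)) ≡ does (H? g h)
        value g h = trans (Vec.lookup∘tabulate (at ∘ remQuot order) _)
          (trans (cong at (Fin.remQuot-combine (code g) (code h)))
            (cong₂ (λ x y → does (H? x y)) (uncode-code g) (uncode-code h)))
        in-v : ∀ {g h} → H g h → relation v g h
        in-v {g} {h} p = trans (value g h) (dec-true (H? g h) p)
        out : ∀ {g h} → relation v g h → H g h
        out {g} {h} p = does⁻ (H? g h) (trans (sym (value g h)) p)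

    -- A decidable relation on a finite group is one of finitely many bit tables, and being a spread
    -- is decidable for each table. Search therefore removes the double negation.
    ¬¬spread⇒partition : ¬ ¬ (∃[ H ] (IsSpread Γ H × (∀ g h → Dec (H g h)))) → HasNontrivialPartition Γ
    ¬¬spread⇒partition nn = let (v , S) = decidable-stable (∃-dec-Vec spread?) (λ none → nn λ (H , S , H?) → none (tabulated S H?))
      in spread⇒partition S (relation? v) nt

  module _ (part : HasNontrivialPartition Γ) where
    private
      c = proj₁ (proj₂ (proj₂ part))
      surjective = proj₁ (proj₂ (proj₂ (proj₂ part)))
      subgroup = proj₂ (proj₂ (proj₂ (proj₂ part)))

    conj : Carrier → Carrier → Carrier
    conj x g = x ∙ g ∙ x ⁻¹

    conj-∙ : ∀ x g h → conj x (g ∙ h) ≡ conj x g ∙ conj x h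
    conj-∙ x g h = sym (begin
      x ∙ g ∙ x ⁻¹ ∙ (x ∙ h ∙ x ⁻¹)    ≡⟨ cong (x ∙ g ∙ x ⁻¹ ∙_) (assoc x h _) ⟩
      x ∙ g ∙ x ⁻¹ ∙ (x ∙ (h ∙ x ⁻¹))  ≡⟨ cancelᵐ′ (x ∙ g) x _ ⟩
      x ∙ g ∙ (h ∙ x ⁻¹)               ≡⟨ assoc (x ∙ g) h _ ⟨
      x ∙ g ∙ h ∙ x ⁻¹                 ≡⟨ cong (_∙ x ⁻¹) (assoc x g h) ⟩
      x ∙ (g ∙ h) ∙ x ⁻¹               ∎)
      where open ≡-Reasoning

    conj-ε : ∀ x → conj x ε ≡ ε
    conj-ε x = trans (cong (_∙ x ⁻¹) (identityʳ x)) (inverseʳ x)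

    conj-⁻¹ : ∀ x g → conj x (g ⁻¹) ≡ conj x g ⁻¹
    conj-⁻¹ x g = inverseˡ-unique _ _ (trans (sym (conj-∙ x (g ⁻¹) g)) (trans (cong (conj x) (inverseˡ g)) (conj-ε x)))

    conj-conj : ∀ x y g → conj x (conj y g) ≡ conj (x ∙ y) g
    conj-conj x y g = begin
      x ∙ (y ∙ g ∙ y ⁻¹) ∙ x ⁻¹       ≡⟨ cong (_∙ x ⁻¹) (assoc x _ _) ⟨
      x ∙ (y ∙ g) ∙ y ⁻¹ ∙ x ⁻¹       ≡⟨ cong (λ z → z ∙ y ⁻¹ ∙ x ⁻¹) (assoc x y g) ⟨
      x ∙ y ∙ g ∙ y ⁻¹ ∙ x ⁻¹         ≡⟨ assoc _ _ _ ⟩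
      x ∙ y ∙ g ∙ (y ⁻¹ ∙ x ⁻¹)       ≡⟨ cong (x ∙ y ∙ g ∙_) (⁻¹-anti-homo-∙ x y) ⟨
      x ∙ y ∙ g ∙ (x ∙ y) ⁻¹          ∎
      where open ≡-Reasoning

    conj-id : ∀ g → conj ε g ≡ g
    conj-id g = trans (cong₂ _∙_ (identityˡ g) ε⁻¹≈ε) (identityʳ g)

    conj≡ε : ∀ {x g} → conj x g ≡ ε → g ≡ ε
    conj≡ε {x} {g} e = ∙-cancelˡ x g ε (trans (xy⁻¹≡ε⇒x≡y e) (sym (identityʳ x)))

    -- The common refinement of all conjugates of the given partition.
    Block : Carrier → Carrier → Set
    Block g h = h ≡ ε ⊎ (g ≢ ε × h ≢ ε × ∀ x → c (conj x g) ≡ c (conj x h))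

    Block? : ∀ g h → Dec (Block g h)
    Block? g h = h ≟ ε ⊎-dec (¬? (g ≟ ε) ×-dec ¬? (h ≟ ε) ×-dec ∀-dec enum (λ x → c (conj x g) Fin.≟ c (conj x h)))

    private
      in-block : ∀ {g h} x → Block g h → conj x h ≡ ε ⊎ (conj x h ≢ ε × c (conj x h) ≡ c (conj x g))
      in-block x (inj₁ refl) = inj₁ (conj-ε x)
      in-block x (inj₂ (_ , h≢ε , e)) = inj₂ (h≢ε ∘ conj≡ε , sym (e x))

    Block-isSpread : IsSpread Γ Block
    Block-isSpread = record
      { ∋ε = λ g → inj₁ refl
      ; ∋self = self
      ; ∋quotient = quotient
      ; symmetric = λ { g h (inj₁ h≡ε) n → contradiction h≡ε n ; g h (inj₂ (p , q , e)) _ → inj₂ (q , p , λ x → sym (e x)) }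
      ; transitive = λ { g h k _ (inj₁ k≡ε) → inj₁ k≡ε
                       ; g h k (inj₁ h≡ε) (inj₂ (n , _)) → contradiction h≡ε n
                       ; g h k (inj₂ (p , _ , e)) (inj₂ (_ , q , f)) → inj₂ (p , q , λ x → trans (e x) (f x)) }
      ; proper = λ g n → prop g n (proj₁ (proj₂ part)) }
      where
      self : ∀ g → Block g g
      self g with g ≟ ε
      ... | yes e = inj₁ e
      ... | no n = inj₂ (n , n , λ _ → refl)
      quotient : ∀ g a b → Block g a → Block g b → Block g (a ⁻¹ ∙ b)
      quotient g a b p q with a ⁻¹ ∙ b ≟ ε | g ≟ ε
      ... | yes e | _ = inj₁ e
      ... | no n | yes g≡ε = contradiction (trans (cong₂ (λ x y → x ⁻¹ ∙ y) (trivial p) (trivial q))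
        (trans (identityʳ _) ε⁻¹≈ε)) n
        where
        trivial : ∀ {a} → Block g a → a ≡ ε
        trivial (inj₁ e) = e
        trivial (inj₂ (m , _)) = contradiction g≡ε m
      ... | no n | no g≢ε = inj₂ (g≢ε , n , λ x → at x
        (subst (λ z → z ≡ ε ⊎ (z ≢ ε × c z ≡ c (conj x g))) (sym (trans (conj-∙ x _ b) (cong (_∙ conj x b) (conj-⁻¹ x a))))
              (proj₁ (proj₂ (sub x)) _ _ (proj₂ (proj₂ (sub x)) _ (in-block x p)) (in-block x q))))
        where
        sub : ∀ x → IsSubgroup Γ (λ z → z ≡ ε ⊎ (z ≢ ε × c z ≡ c (conj x g)))
        sub x = subgroup (c (conj x g))
        at : ∀ x → conj x (a ⁻¹ ∙ b) ≡ ε ⊎ (conj x (a ⁻¹ ∙ b) ≢ ε × c (conj x (a ⁻¹ ∙ b)) ≡ c (conj x g)) → c (conj x g) ≡ c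
          (conj x (a ⁻¹ ∙ b))
        at x (inj₁ e) = contradiction (conj≡ε e) n
        at x (inj₂ (_ , e)) = sym e
      other : ∀ {k} → 2 ≤ k → (i : Fin k) → ∃[ j ] i ≢ j
      other (s≤s (s≤s _)) fzero = fsuc fzero , λ ()
      other (s≤s (s≤s _)) (fsuc i) = fzero , λ ()
      prop : ∀ g → g ≢ ε → 2 ≤ proj₁ part → ∃[ k ] ¬ Block g k
      prop g n 2≤k with other 2≤k (c g)
      ... | j , cg≢j with surjective j
      ...   | h , h≢ε , refl = h , λ { (inj₁ e) → h≢ε e ; (inj₂ (_ , _ , e)) → cg≢j
        (subst₂ (λ x y → c x ≡ c y) (conj-id g) (conj-id h) (e ε)) }

    -- Quantifying over all conjugates makes conjugation permute the blocks. Lines and planes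
    -- described by potentials that differ by a constant factor are compared by means of this.
    Block-conj : ∀ {g h} x → Block g h → Block (conj x g) (conj x h)
    Block-conj x (inj₁ refl) = inj₁ (conj-ε x)
    Block-conj x (inj₂ (p , q , e)) = inj₂ (p ∘ conj≡ε , q ∘ conj≡ε ,
      λ y → subst₂ (λ g h → c g ≡ c h) (sym (conj-conj y x _)) (sym (conj-conj y x _)) (e (y ∙ x)))

-- Removing the decidability assumption and concluding necessity

module Necessity {Γ : FiniteGroup} (nt : Nontrivial Γ) where
  open GroupFacts Γ
  open Powers Γ

  ¬¬-decidable-indep : ∀ {n k} (K : Matroid (Edge n Γ ⊎ Fin k)) → ¬ ¬ (∀ X → Dec (Indep K X))
  ¬¬-decidable-indep {n} {k} K = ¬¬-dec-subsets (enum-⊎ (Graph.enumᴱ n Γ) (enum-Fin k)) (Indep K)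
    -- Heredity makes independence respect pointwise equality of subsets.
    λ {X} {Y} e → indep-⊆ K X Y (λ x p → trans (e x) p)

  three : ∀ {m} (L : Matroid (Edge (3 + m) Γ)) → InClass (3 + m) Γ L → NonElementary (3 + m) Γ L → HasNontrivialPartition Γ
  three L ((k , K , contr , del) , circ) ne = Partitions.¬¬spread⇒partition Γ nt λ none →
    ¬¬-decidable-indep K λ indep? → let open ThreeVertices L K contr del circ indep? in none (H , H-isSpread ne , H?)

  four : ∀ {m} (L : Matroid (Edge (4 + m) Γ)) → InClass (4 + m) Γ L → NonElementary (4 + m) Γ L →
    ∃[ p ] ∃[ j ] (Prime p × 2 ≤ j × IsoToZpj Γ p j)
  four L ((k , K , contr , del) , circ) ne = p , j , Elementary.isPrime elementary , 2≤j , iso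
    where
    x₀ = proj₁ nt
    x₀≢ε = proj₂ nt
    -- The number `p` is read off from the group alone, outside the double negation; the remaining
    -- claims about it are stable and may be proved under it.
    order-data = LeastExponent.least-exponent Γ x₀
    p = proj₁ order-data
    x₀^p = proj₁ (proj₂ (proj₂ order-data))
    ¬¬normal : ¬ ¬ (∃[ H ] (IsSpread Γ H × (∀ g h → Dec (H g h)) × (∀ g a → H g (a ∙ g ∙ a ⁻¹))))
    ¬¬normal none = ¬¬-decidable-indep K λ indep? → let open FourVertices L K contr del circ indep? in none (H , H-isSpread ne , H? , H-normal)
    elementary : Elementary Γ p
    elementary = record
      { isPrime = LeastExponent.uniform-torsion⇒prime Γ x₀≢ε (proj₁ (proj₂ order-data)) x₀^p
        (proj₂ (proj₂ (proj₂ order-data)))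
          λ none → ¬¬normal λ (H , S , H? , N) → none λ h m h≢ε → NormalSpread.torsion S H? N h x₀ m h≢ε x₀≢ε
      ; commutative = λ x y → decidable-stable (_ ≟ _) λ none → ¬¬normal λ (H , S , H? , N) → none
        (NormalSpread.commutative S H? N x y)
      ; exponent = λ x → decidable-stable (_ ≟ _) λ none → ¬¬normal λ (H , S , H? , N) → none (exponent′ S H? N x) }
      where
      exponent′ : ∀ {H} (S : IsSpread Γ H) (H? : ∀ g h → Dec (H g h)) (N : ∀ g a → H g (a ∙ g ∙ a ⁻¹)) x → x ^ p ≡ ε
      exponent′ S H? N x with x ≟ ε
      ... | yes refl = ε^ p
      ... | no n = NormalSpread.torsion S H? N x₀ x p x₀≢ε n x₀^p
    coordinates = Coordinates.elementary⇒iso elementary nt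
      λ g gen → ¬¬normal λ (H , S , H? , N) → NormalSpread.noncyclic S H? N nt g gen
    j = proj₁ coordinates
    2≤j = proj₁ (proj₂ coordinates)
    iso = proj₂ (proj₂ coordinates)

  necessity : ∀ n → 3 ≤ n → (Σ (Matroid (Edge n Γ)) λ L → InClass n Γ L × NonElementary n Γ L) →
    (n ≡ 3 × HasNontrivialPartition Γ) ⊎ (4 ≤ n × ∃[ p ] ∃[ j ] (Prime p × 2 ≤ j × IsoToZpj Γ p j))
  necessity (suc (suc (suc zero))) _ (L , cl , ne) = inj₁ (refl , three L cl ne)
  necessity (suc (suc (suc (suc m)))) _ (L , cl , ne) = inj₂ (s≤s (s≤s (s≤s (s≤s z≤n))) , four L cl ne)
  necessity zero () _
  necessity (suc zero) (s≤s ()) _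
  necessity (suc (suc zero)) (s≤s (s≤s ())) _

-- Deletion and contraction

module Deletion {E : Set} {k : ℕ} (K : Matroid (E ⊎ Fin k)) where
  private
    inj₁-inj : ∀ {x y : E} → inj₁ {B = Fin k} x ≡ inj₁ y → x ≡ y
    inj₁-inj refl = refl

    size⁺ : ∀ {X a} → HasSize X a → HasSize [ X , const false ] a
    size⁺ (f , inj , fX , sur) = inj₁ ∘ f , (λ e → inj (inj₁-inj e)) , fX , λ where
      (inj₁ e) p → let (i , q) = sur e p in i , cong inj₁ q
      (inj₂ _) ()

  deletion : Matroid E
  deletion = record
    { Indep = DeleteIndep K
    ; indep-∅ = indep-⊆ K _ _ (λ { (inj₁ _) () ; (inj₂ _) () }) (indep-∅ K)
    ; indep-⊆ = λ X Y s → indep-⊆ K _ _ λ { (inj₁ x) p → s x p ; (inj₂ _) () }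
    ; augment = aug }
    where
    aug : ∀ X Y a b → DeleteIndep K X → DeleteIndep K Y → HasSize X a → HasSize Y b → a < b →
      ∃[ e ] (Y e ≡ true × X e ≡ false × ∃[ Z ] (IsInsert X e Z × DeleteIndep K Z))
    aug X Y a b iX iY sX sY lt with augment K _ _ a b iX iY (size⁺ sX) (size⁺ sY) lt
    ... | inj₁ e , Ye , Xe , Z , ins , iZ = e , Ye , Xe , Z ∘ inj₁ ,
          (λ x → (λ p → [ inj₁ , inj₂ ∘ inj₁-inj ]′ (proj₁ (ins (inj₁ x)) p)) ,
                 (λ p → proj₂ (ins (inj₁ x)) ([ inj₁ , inj₂ ∘ cong {B = E ⊎ Fin k} inj₁ ]′ p))) ,
          indep-⊆ K _ _ (λ { (inj₁ x) p → p ; (inj₂ _) () }) iZ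
    ... | inj₂ _ , () , _

  deletion-isLift : ∀ {M} → (∀ X → ContractIndep K X ⇔ M X) → IsLift deletion M
  deletion-isLift contr = k , K , contr , λ X → mk⇔ id id

ind-map : ∀ {P Q} (G : Pregeometry P) (g : Q → P) {ys} → Pregeometry.Ind (pullback G g) ys → Pregeometry.Ind G (map g ys)
ind-map G g {[]} _ = tt
ind-map G g {y ∷ ys} (n , i) = n , ind-map G g i

module _ {A B : Set} where
  lefts : List (A ⊎ B) → List A
  lefts [] = []
  lefts (inj₁ a ∷ xs) = a ∷ lefts xs
  lefts (inj₂ _ ∷ xs) = lefts xs

  rights : List (A ⊎ B) → List B
  rights [] = []
  rights (inj₁ _ ∷ xs) = rights xs
  rights (inj₂ b ∷ xs) = b ∷ rights xs

  lefts⁻ : ∀ xs {a} → a ∈ lefts xs → inj₁ a ∈ xs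
  lefts⁻ (inj₁ _ ∷ xs) (here refl) = here refl
  lefts⁻ (inj₁ _ ∷ xs) (there m) = there (lefts⁻ xs m)
  lefts⁻ (inj₂ _ ∷ xs) m = there (lefts⁻ xs m)

  rights⁻ : ∀ xs {b} → b ∈ rights xs → inj₂ b ∈ xs
  rights⁻ (inj₂ _ ∷ xs) (here refl) = here refl
  rights⁻ (inj₂ _ ∷ xs) (there m) = there (rights⁻ xs m)
  rights⁻ (inj₁ _ ∷ xs) m = there (rights⁻ xs m)

  lefts⁺ : ∀ {xs a} → inj₁ a ∈ xs → a ∈ lefts xs
  lefts⁺ (here refl) = here refl
  lefts⁺ {inj₁ _ ∷ xs} (there m) = there (lefts⁺ m)
  lefts⁺ {inj₂ _ ∷ xs} (there m) = lefts⁺ m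

  rights⁺ : ∀ {xs b} → inj₂ b ∈ xs → b ∈ rights xs
  rights⁺ (here refl) = here refl
  rights⁺ {inj₂ _ ∷ xs} (there m) = there (rights⁺ m)
  rights⁺ {inj₁ _ ∷ xs} (there m) = rights⁺ m

  ⊑-lefts-rights : ∀ xs → xs ⊑ map inj₁ (lefts xs) ++ map inj₂ (rights xs)
  ⊑-lefts-rights xs {inj₁ a} m = ∈-++⁺ˡ (∈-map⁺ inj₁ (lefts⁺ m))
  ⊑-lefts-rights xs {inj₂ b} m = ∈-++⁺ʳ (map inj₁ (lefts xs)) (∈-map⁺ inj₂ (rights⁺ m))

module Contraction {E : Set} {k : ℕ} (_≟ᴱ_ : DecidableEquality E) (G : Pregeometry (E ⊎ Fin k)) where
  open Pregeometry G

  infix 4 _≟ᴾ_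
  _≟ᴾ_ : DecidableEquality (E ⊎ Fin k)
  _≟ᴾ_ = Sum.≡-dec _≟ᴱ_ Fin._≟_

  open Subsets _≟ᴾ_

  fs : List (E ⊎ Fin k)
  fs = map inj₂ (List.allFin k)

  inj₂∈fs : ∀ i → inj₂ i ∈ fs
  inj₂∈fs i = ∈-map⁺ inj₂ (∈-allFin i)

  modF : Pregeometry E
  modF = pullback (localize G fs) inj₁

  K : Matroid (E ⊎ Fin k)
  K = pregeometryMatroid G _≟ᴾ_

  ⊑-modF : ∀ xs → xs ⊑ map inj₁ (lefts xs) ++ fs
  ⊑-modF xs m = ++-mono-⊑ (map inj₁ (lefts xs)) id (λ p → case ∈-map⁻ inj₂ p of λ { (i , _ , refl) → inj₂∈fs i })
    (⊑-lefts-rights xs m)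

  -- A set independent modulo F adds nothing to the closure within F: otherwise exchange would
  -- express an element of `X` by other elements of `X` together with F.
  skew : ∀ {X} → Pregeometry.IndSet modF X → ∀ xs → (∀ {x} → x ∈ xs → X x ≡ true) → ∀ gs {i} →
    Cl (map inj₁ xs ++ map inj₂ gs) (inj₂ i) → Cl (map inj₂ gs) (inj₂ i)
  skew ind xs xsX gs {i} c with cl? (map inj₂ gs) (inj₂ i)
  ... | yes c′ = c′
  ... | no n with exchange-++ (map inj₁ xs) c n
  ...   | as , x , bs , e , cx , nx with ∈-map⁻ inj₁ (subst (x ∈_) (sym e) (∈-++⁺ʳ as (here refl)))
  ...     | y , y∈xs , refl = contradiction
    (cl-mono (∷-⊑ (∈-++⁺ʳ (map inj₁ (lefts bs)) (inj₂∈fs i)) (++-⊑ bs (⊑-modF bs)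
      (λ p → case ∈-map⁻ inj₂ p of λ { (j , _ , refl) → ∈-++⁺ʳ (map inj₁ (lefts bs)) (inj₂∈fs j) }))) cx)
    (ind (lefts bs) y (λ m → xsX (bs⊑ (lefts⁻ bs m))) (xsX y∈xs) (λ m → nx (cl-∈ (∈-++⁺ˡ (lefts⁻ bs m)))))
    where
    bs⊑ : ∀ {z} → inj₁ z ∈ bs → z ∈ xs
    bs⊑ m = case ∈-map⁻ inj₁ (subst (_ ∈_) (sym e) (∈-++⁺ʳ as (there m))) of λ { (_ , p , refl) → p }

  contract-indep⇒ : ∀ X → ContractIndep K X → Pregeometry.IndSet modF X
  contract-indep⇒ X (B , (indB , maxB) , ind) ws w wsX wX w∉ws c = ind (map inj₁ ws ++ gs) (inj₁ w)
    (λ m → [ (λ p → case ∈-map⁻ inj₁ p of λ { (_ , q , refl) → wsX q }) , gsB ]′ (∈-++⁻ (map inj₁ ws) m)) wX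
    (λ m → [ (λ p → case ∈-map⁻ inj₁ p of λ { (_ , q , refl) → w∉ws q }) ,
      (λ p → case ∈-map⁻ inj₂ p of λ { (_ , _ , ()) }) ]′ (∈-++⁻ (map inj₁ ws) m))
    (cl-trans (λ m → [ (λ p → cl-∈ (∈-++⁺ˡ p)) , (λ p →
      case ∈-map⁻ inj₂ p of λ { (i , _ , refl) → cl-mono (∈-++⁺ʳ (map inj₁ ws)) (spans i) }) ]′ (∈-++⁻ (map inj₁ ws) m)) c)
    where
    inB? : ∀ i → Dec (B i ≡ true)
    inB? i = B i Bool.≟ true
    gs : List (E ⊎ Fin k)
    gs = map inj₂ (filter inB? (List.allFin k))
    gsB : ∀ {x} → x ∈ gs → [ X , B ] x ≡ true
    gsB m = case ∈-map⁻ inj₂ m of λ { (_ , q , refl) → proj₂ (∈-filter⁻ inB? {xs = List.allFin k} q) }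
    B-gs : ∀ {i} → B i ≡ true → inj₂ i ∈ gs
    B-gs {i} b = ∈-map⁺ inj₂ (∈-filter⁺ inB? (∈-allFin i) b)
    spans : ∀ i → Cl gs (inj₂ i)
    spans i with inB? i
    ... | yes b = cl-∈ (B-gs b)
    -- If `gs` did not span `inj₂ i`, then `B` enlarged by `i` would still be independent, against
    -- maximality.
    ... | no nb = decidable-stable (cl? gs (inj₂ i)) λ n → nb (maxB (λ j → does (inB? j) ∨ does (j Fin.≟ i))
        (λ j b → trans (cong (_∨ does (j Fin.≟ i)) (dec-true (inB? j) b)) refl)
        (λ ws w wsZ wZ w∉ws c →
          ind-extended n ws w (λ {x} m → into x (wsZ m)) (into w wZ) w∉ws c)
        i (trans (cong (does (inB? i) ∨_) (dec-true (i Fin.≟ i) refl)) (Bool.∨-zeroʳ _)))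
      where
      Z : Subset (Fin k)
      Z j = does (inB? j) ∨ does (j Fin.≟ i)
      into : ∀ x → [ const false , Z ] x ≡ true → toSubset (inj₂ i ∷ gs) x ≡ true
      into (inj₁ _) ()
      into (inj₂ j) e = toSubset⁺ {xs = inj₂ i ∷ gs}
        ([ (λ p → there (B-gs (does⁻ (inB? j) p))) , (λ p → here (cong inj₂ (does⁻ (j Fin.≟ i) p))) ]′
        (∨⁻ (does (inB? j)) e))
      gs-ind : Ind gs
      gs-ind = distinct (List.allFin k) (tabulate-distinct id)
        where
        distinct : ∀ is → Distinct is → Ind (map inj₂ (filter inB? is))
        distinct [] _ = tt
        distinct (j ∷ is) (m , d) with inB? j
        ... | no _ = distinct is d
        ... | yes b = indB _ (inj₂ j)
              (λ q → case ∈-map⁻ inj₂ q of λ { (_ , r , refl) → proj₂ (∈-filter⁻ inB? {xs = is} r) }) b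
              (λ q → case ∈-map⁻ inj₂ q of λ { (_ , r , refl) → m (proj₁ (∈-filter⁻ inB? {xs = is} r)) }) ,
            distinct is d
      ind-extended : ¬ Cl gs (inj₂ i) → IndSet (toSubset (inj₂ i ∷ gs))
      ind-extended n = ind⇒indSet {ys = inj₂ i ∷ gs} (n , gs-ind) (λ x → toSubset⁻ (inj₂ i ∷ gs))

  ⇒contract-indep : ∀ X → Pregeometry.IndSet modF X → ContractIndep K X
  ⇒contract-indep X indX with basis fs
  ... | bs , bs⊑ , ind , spans = B , (indB , maxB) , indXB
    where
    B : Subset (Fin k)
    B i = toSubset bs (inj₂ i)
    in-bs : ∀ x → [ const false , B ] x ≡ true → x ∈ bs
    in-bs (inj₁ _) ()
    in-bs (inj₂ i) = toSubset⁻ bs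
    bs-B : ∀ {x} → x ∈ bs → ∃[ i ] (x ≡ inj₂ i × B i ≡ true)
    bs-B m with ∈-map⁻ inj₂ (bs⊑ m)
    ... | i , _ , refl = i , refl , toSubset⁺ m
    indB : IndSet [ const false , B ]
    indB = ind⇒indSet ind in-bs
    maxB : ∀ Z → B ⊆ Z → IndSet [ const false , Z ] → Z ⊆ B
    maxB Z B⊆Z indZ i Zi = decidable-stable (B i Bool.≟ true) λ n →
      indZ bs (inj₂ i) (λ m → case bs-B m of λ { (j , refl , b) → B⊆Z j b }) Zi (λ m → n (toSubset⁺ m)) (spans (inj₂∈fs i))
    indXB : IndSet [ X , B ]
    indXB zs w zsX wX w∉ c = go w wX w∉ c
      where
      lX : ∀ {x} → x ∈ lefts zs → X x ≡ true
      lX m = zsX (lefts⁻ zs m)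
      go : ∀ w → [ X , B ] w ≡ true → w ∉ zs → Cl zs w → ⊥
      go (inj₁ e) wX w∉ c = indX (lefts zs) e lX wX (λ m → w∉ (lefts⁻ zs m)) (cl-mono (⊑-modF zs) c)
      go (inj₂ i) wX w∉ c = ind-separated ind (toSubset⁻ bs wX)
        (λ m → case ∈-map⁻ inj₂ m of λ { (j , p , refl) → toSubset⁻ bs (zsX (rights⁻ zs p)) })
        (λ m → case ∈-map⁻ inj₂ m of λ { (j , p , refl) → w∉ (rights⁻ zs p) })
        (skew indX (lefts zs) lX (rights zs) (cl-mono (⊑-lefts-rights zs) c))

  deletion-indep⇒ : ∀ {X} → IndSet [ X , const false ] → Pregeometry.IndSet (pullback G inj₁) X
  deletion-indep⇒ ind ws w wsX wX w∉ c = ind (map inj₁ ws) (inj₁ w)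
    (λ m → case ∈-map⁻ inj₁ m of λ { (_ , p , refl) → wsX p }) wX
    (λ m → case ∈-map⁻ inj₁ m of λ { (_ , p , refl) → w∉ p }) c

  ⇒deletion-indep : ∀ {X} → Pregeometry.IndSet (pullback G inj₁) X → IndSet [ X , const false ]
  ⇒deletion-indep ind zs (inj₁ w) zsX wX w∉ c = ind (lefts zs) w (λ m → zsX (lefts⁻ zs m)) wX (λ m → w∉ (lefts⁻ zs m))
    (cl-mono (λ m → only-left (zsX m) m) c)
    where
    only-left : ∀ {x} → [ _ , const false ] x ≡ true → x ∈ zs → x ∈ map inj₁ (lefts zs)
    only-left {inj₁ _} _ m = ∈-map⁺ inj₁ (lefts⁺ m)
    only-left {inj₂ _} () _
  ⇒deletion-indep ind zs (inj₂ _) zsX () w∉ c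

-- Paths

module Paths (n : ℕ) (Γ : FiniteGroup) where
  open GroupFacts Γ
  open Graph n Γ

  data Path : Fin n → Fin n → Set where
    nil : ∀ {v} → Path v v
    cons : ∀ {a b c} (e : E) → Joins e a c → Path c b → Path a b

  verts : ∀ {a b} → Path a b → List (Fin n)
  verts (nil {v}) = v ∷ []
  verts (cons {a} e _ p) = a ∷ verts p

  pathEdges : ∀ {a b} → Path a b → List E
  pathEdges nil = []
  pathEdges (cons e _ p) = e ∷ pathEdges p

  Simple : ∀ {a b} → Path a b → Set
  Simple nil = ⊤
  Simple (cons {a} _ _ p) = a ∉ verts p × Simple p

  start∈verts : ∀ {a b} (p : Path a b) → a ∈ verts p
  start∈verts nil = here refl
  start∈verts (cons _ _ p) = here refl

  append : ∀ {a u w b} → Path a u → (e : E) → Joins e u w → Path w b → Path a b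
  append nil e j q = cons e j q
  append (cons f i p) e j q = cons f i (append p e j q)

  verts-append : ∀ {a u w b} (p : Path a u) e (j : Joins e u w) (q : Path w b) {v} → v ∈ verts (append p e j q) →
    v ∈ verts p ⊎ v ∈ verts q
  verts-append nil e j q (here r) = inj₁ (here r)
  verts-append nil e j q (there m) = inj₂ m
  verts-append (cons f i p) e j q (here r) = inj₁ (here r)
  verts-append (cons f i p) e j q (there m) = [ inj₁ ∘ there , inj₂ ]′ (verts-append p e j q m)

  edges-append : ∀ {a u w b} (p : Path a u) e (j : Joins e u w) (q : Path w b) {f} → f ∈ pathEdges (append p e j q) →
    f ∈ pathEdges p ⊎ f ∈ e ∷ pathEdges q
  edges-append nil e j q m = inj₂ m
  edges-append (cons f i p) e j q (here r) = inj₁ (here r)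
  edges-append (cons f i p) e j q (there m) = [ inj₁ ∘ there , inj₂ ]′ (edges-append p e j q m)

  simple-append : ∀ {a u w b} (p : Path a u) e (j : Joins e u w) (q : Path w b) → Simple p → Simple q →
    (∀ {v} → v ∈ verts p → v ∉ verts q) → Simple (append p e j q)
  simple-append nil e j q sp sq dis = dis (here refl) , sq
  simple-append (cons f i p) e j q (n , sp) sq dis =
    (λ m → [ n , dis (here refl) ]′ (verts-append p e j q m)) , simple-append p e j q sp sq (dis ∘ there)

  mono-verts : ∀ {s : Fin n → Bool} {a b} (p : Path a b) → (∀ {e} → e ∈ pathEdges p → Mono s e) → ∀ {v} → v ∈ verts p →
    s v ≡ s a
  mono-verts nil _ (here refl) = refl
  mono-verts (cons e j p) mono (here refl) = refl
  mono-verts {s} (cons e j p) mono (there m) = trans (mono-verts {s} p (mono ∘ there) m)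
    (sym (joins-mono {s = s} {e = e} j (mono (here refl))))

  -- The two faces of connectivity: `side` is a cut crossed by no edge of `xs`, and every vertex on
  -- the side of the root is reached by a simple path.
  record Component (xs : List E) (a : Fin n) : Set where
    field
      side : Fin n → Bool
      side-root : side a ≡ true
      side-mono : ∀ {e} → e ∈ xs → Mono side e
      reach : ∀ v → side v ≡ true → Σ (Path a v) λ p → Simple p × pathEdges p ⊑ xs

  component : ∀ xs a → Component xs a
  component [] a = record
    { side = λ v → does (v Fin.≟ a) ; side-root = dec-true (a Fin.≟ a) refl ; side-mono = λ ()
    ; reach = λ v e → case does⁻ (v Fin.≟ a) e of λ { refl → nil , tt , λ () } }
  component (e ∷ xs) a with component xs a
  ... | Ca = go (side (src e)) (side (tgt e)) refl refl
    where
    open Component Ca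
    merge : ∀ u w → Joins e u w → side u ≡ true → side w ≡ false → Component (e ∷ xs) a
    merge u w j su sw = record
      { side = s
      ; side-root = cong (_∨ Cw.side a) side-root
      ; side-mono = λ { (here refl) → mono-joins {s = s} {e = e} j
        (trans (cong (_∨ Cw.side u) su) (sym (trans (cong (side w ∨_) Cw.side-root) (Bool.∨-zeroʳ (side w)))))
                      ; (there m) → cong₂ _∨_ (side-mono m) (Cw.side-mono m) }
      ; reach = λ v sv → [ old v , new v ]′ (∨⁻ (side v) sv) }
      where
      module Cw = Component (component xs w)
      s : Fin n → Bool
      s v = side v ∨ Cw.side v
      old : ∀ v → side v ≡ true → Σ (Path a v) λ p → Simple p × pathEdges p ⊑ (e ∷ xs)
      old v sv = let (p , sp , m) = reach v sv in p , sp , there ∘ m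
      new : ∀ v → Cw.side v ≡ true → Σ (Path a v) λ p → Simple p × pathEdges p ⊑ (e ∷ xs)
      new v sv with reach u su | Cw.reach v sv
      ... | p , sp , mp | q , sq , mq = append p e j q , simple-append p e j q sp sq disjoint ,
            λ m → [ there ∘ mp , (λ { (here r) → here r ; (there m′) → there (mq m′) }) ]′ (edges-append p e j q m)
        where
        -- No edge of `xs` crosses the old `side`, so the path from `a` stays on it and the path
        -- from `w` stays off it.
        disjoint : ∀ {v} → v ∈ verts p → v ∉ verts q
        disjoint m m′ = contradiction (trans (sym (trans (mono-verts {side} p (side-mono ∘ mp) m) side-root))
          (trans (mono-verts {side} q (side-mono ∘ mq) m′) sw)) λ ()
    go : ∀ x y → side (src e) ≡ x → side (tgt e) ≡ y → Component (e ∷ xs) a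
    go true false p q = merge _ _ (inj₁ (refl , refl)) p q
    go false true p q = merge _ _ (inj₂ (refl , refl)) q p
    go true true p q = record
      { side = side ; side-root = side-root ; side-mono = λ { (here refl) → trans p (sym q) ; (there m) → side-mono m }
      ; reach = λ v sv → let (p , sp , m) = reach v sv in p , sp , there ∘ m }
    go false false p q = record
      { side = side ; side-root = side-root ; side-mono = λ { (here refl) → trans p (sym q) ; (there m) → side-mono m }
      ; reach = λ v sv → let (p , sp , m) = reach v sv in p , sp , there ∘ m }

  len : ∀ {a b} → Path a b → ℕ
  len nil = 0
  len (cons _ _ p) = suc (len p)

  vertAt : ∀ {a b} (p : Path a b) → Fin (suc (len p)) → Fin n
  vertAt (nil {v}) fzero = v
  vertAt (cons {a} _ _ p) fzero = a
  vertAt (cons _ _ p) (fsuc i) = vertAt p i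

  -- The edge `y` that will close the path to a cycle takes the last index.
  edgeAt : ∀ {a b} (p : Path a b) → E → Fin (suc (len p)) → E
  edgeAt nil y fzero = y
  edgeAt (cons e _ p) y fzero = e
  edgeAt (cons e _ p) y (fsuc i) = edgeAt p y i

  vertAt-zero : ∀ {a b} (p : Path a b) → vertAt p fzero ≡ a
  vertAt-zero nil = refl
  vertAt-zero (cons _ _ p) = refl

  vertAt-last : ∀ {a b} (p : Path a b) → vertAt p (fromℕ (len p)) ≡ b
  vertAt-last nil = refl
  vertAt-last (cons _ _ p) = vertAt-last p

  edgeAt-last : ∀ {a b} (p : Path a b) y → edgeAt p y (fromℕ (len p)) ≡ y
  edgeAt-last nil y = refl
  edgeAt-last (cons _ _ p) y = edgeAt-last p y

  edgeAt-∈ : ∀ {a b} (p : Path a b) y i → edgeAt p y i ∈ pathEdges p ⊎ edgeAt p y i ≡ y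
  edgeAt-∈ nil y fzero = inj₂ refl
  edgeAt-∈ (cons e _ p) y fzero = inj₁ (here refl)
  edgeAt-∈ (cons e _ p) y (fsuc i) = [ inj₁ ∘ there , inj₂ ]′ (edgeAt-∈ p y i)

  vertAt-∈ : ∀ {a b} (p : Path a b) i → vertAt p i ∈ verts p
  vertAt-∈ nil fzero = here refl
  vertAt-∈ (cons _ _ p) fzero = here refl
  vertAt-∈ (cons _ _ p) (fsuc i) = there (vertAt-∈ p i)

  edgeAt-joins : ∀ {a b} (p : Path a b) y (i : Fin (len p)) → Joins (edgeAt p y (inject₁ i)) (vertAt p (inject₁ i))
    (vertAt p (fsuc i))
  edgeAt-joins (cons e j p) y fzero = subst (Joins e _) (sym (vertAt-zero p)) j
  edgeAt-joins (cons e j p) y (fsuc i) = edgeAt-joins p y i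

  vertAt-injective : ∀ {a b} (p : Path a b) → Simple p → ∀ i j → vertAt p i ≡ vertAt p j → i ≡ j
  vertAt-injective nil _ fzero fzero _ = refl
  vertAt-injective (cons _ _ p) _ fzero fzero _ = refl
  vertAt-injective (cons _ _ p) (n , _) fzero (fsuc j) e = contradiction (subst (_∈ verts p) (sym e) (vertAt-∈ p j)) n
  vertAt-injective (cons _ _ p) (n , _) (fsuc i) fzero e = contradiction (subst (_∈ verts p) e (vertAt-∈ p i)) n
  vertAt-injective (cons _ _ p) (_ , s) (fsuc i) (fsuc j) e = cong fsuc (vertAt-injective p s i j e)

  Joins-endpoint : ∀ {e : E} {u w u′ w′} → Joins e u w → Joins e u′ w′ → u ≡ u′ ⊎ u ≡ w′
  Joins-endpoint (inj₁ (p , q)) (inj₁ (p′ , q′)) = inj₁ (trans (sym p) p′)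
  Joins-endpoint (inj₁ (p , q)) (inj₂ (p′ , q′)) = inj₂ (trans (sym p) p′)
  Joins-endpoint (inj₂ (p , q)) (inj₁ (p′ , q′)) = inj₂ (trans (sym q) q′)
  Joins-endpoint (inj₂ (p , q)) (inj₂ (p′ , q′)) = inj₁ (trans (sym q) q′)

  endpoint∈verts : ∀ {a b} (p : Path a b) {e u w} → e ∈ pathEdges p → Joins e u w → u ∈ verts p
  endpoint∈verts (cons e i p) (here refl) j with Joins-endpoint {e = e} j i
  ... | inj₁ refl = here refl
  ... | inj₂ refl = there (start∈verts p)
  endpoint∈verts (cons _ _ p) (there m) j = there (endpoint∈verts p m j)

  edgeAt-injective : ∀ {a b} (p : Path a b) y → Simple p → y ∉ pathEdges p → ∀ i j → edgeAt p y i ≡ edgeAt p y j → i ≡ j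
  edgeAt-injective nil y _ _ fzero fzero _ = refl
  edgeAt-injective (cons _ _ p) y _ _ fzero fzero _ = refl
  edgeAt-injective (cons e k p) y (n , _) ny fzero (fsuc j) q =
    [ (λ m → contradiction (endpoint∈verts p (subst (_∈ pathEdges p) (sym q) m) k) n) ,
      (λ r → contradiction (here (sym (trans q r))) ny) ]′ (edgeAt-∈ p y j)
  edgeAt-injective (cons e k p) y (n , _) ny (fsuc i) fzero q =
    [ (λ m → contradiction (endpoint∈verts p (subst (_∈ pathEdges p) q m) k) n) ,
      (λ r → contradiction (here (trans (sym r) q)) ny) ]′ (edgeAt-∈ p y i)
  edgeAt-injective (cons _ _ p) y (_ , s) ny (fsuc i) (fsuc j) q = cong fsuc (edgeAt-injective p y s (ny ∘ there) i j q)

  close-path : ∀ {a b} (p : Path a b) → Simple p → a ≢ b → ∀ y → y ∉ pathEdges p → Joins y b a →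
    Σ (Cycle n Γ) λ C → ∀ k → Cycle.edg C k ∈ pathEdges p ⊎ Cycle.edg C k ≡ y
  close-path nil _ a≢b _ _ _ = contradiction refl a≢b
  close-path p@(cons _ _ p′) s _ y ny j = record
    { len = len p′ ; vert = vertAt p ; edg = edgeAt p y
    ; vinj = λ {i} {k} → vertAt-injective p s i k
    ; einj = λ {i} {k} → edgeAt-injective p y s ny i k
    ; joins = joins } , edgeAt-∈ p y
    where
    joins : ∀ k → Joins (edgeAt p y k) (vertAt p k) (vertAt p (next k))
    joins k with view k
    ... | ‵fromℕ rewrite next-fromℕ {suc (len p′)} | edgeAt-last p y | vertAt-last p = j
    ... | ‵inject₁ i rewrite next-inject₁ i = edgeAt-joins p y i

  -- If the component of `src y` reaches `tgt y`, a simple path is closed by `y`; otherwise that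
  -- component is the cut.
  cycle-or-cut : ∀ {xs y} → y ∉ xs → (∃[ C ] (∀ k → Cycle.edg C k ∈ y ∷ xs)) ⊎
    (∃[ s ] ((∀ e → e ∈ xs → Mono s e) × ¬ Mono s y))
  cycle-or-cut {xs} {y} y∉xs = go (component xs (src y))
    where
    go : Component xs (src y) → _
    go Cs with Component.side Cs (tgt y) in eq
    ... | false = inj₂ (side , (λ _ → side-mono) , λ mono → contradiction (trans (sym side-root) (trans mono eq)) λ ())
      where open Component Cs
    ... | true with Component.reach Cs (tgt y) eq
    ...   | p , sp , m with close-path p sp (src≢tgt y) y (λ q → y∉xs (m q)) (inj₂ (refl , refl))
    ...     | C , inC = inj₁ (C , λ k → [ there ∘ m , here ]′ (inC k))

-- The lift over F_p

-- The edge (i,j,g) becomes the vector (g, uᵢ - uⱼ) of the F_p-space Γ × Γⁿ, where uᵢ is a fixed u ≠ ε in coordinate i,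
-- and F becomes all of Γ × 0; coordinate 0 of Fin (suc n) is the label.
module Representation {Γ : FiniteGroup} {p : ℕ} (el : Elementary Γ p) (u : Elt Γ) (u≢ε : u ≢ FiniteGroup.ε Γ) (n : ℕ) where
  open GroupFacts Γ
  open ElementaryFacts el
  open Graph n Γ
  open Vectors (suc n)

  single : Fin n → Fin n → Carrier
  single j v = if does (v Fin.≟ j) then u else ε

  -- The vector that an edge from `a` to `b` fitting `h` would have. These vectors telescope, so
  -- lying in a fixed subspace is an equivalence relation on vertices.
  diff : (Fin n → Carrier) → Fin n → Fin n → W
  diff h a b fzero = h a ⁻¹ ∙ h b
  diff h a b (fsuc v) = single a v // single b v

  vec : E ⊎ Fin order → W
  vec (inj₁ e) fzero = label e
  vec (inj₁ e) (fsuc v) = single (src e) v // single (tgt e) v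
  vec (inj₂ i) fzero = uncode i
  vec (inj₂ i) (fsuc v) = ε

  open Span vec
  G : Pregeometry (E ⊎ Fin order)
  G = spanGeometry
  module P = Pregeometry G
  module F = Contraction _≟ᴱ_ G
  module M = Pregeometry F.modF
  module L = Pregeometry (pullback G inj₁)

  module Diff {Q : W → Set} (S : Subspace Q) (h : Fin n → Carrier) where
    open Subspace S

    R : Fin n → Fin n → Set
    R a b = Q (diff h a b)

    R-refl : ∀ {a} → R a a
    R-refl {a} = resp (λ { fzero → sym (inverseˡ (h a)) ; (fsuc v) → sym (inverseʳ (single a v)) }) has-ε

    R-sym : ∀ {a b} → R a b → R b a
    R-sym {a} {b} q = resp (λ { fzero → inverse-step (h a) (h b)
      ; (fsuc v) → trans (⁻¹-anti-homo-∙ _ _) (cong (_∙ single a v ⁻¹) (⁻¹-involutive (single b v))) }) (has-⁻¹ q)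

    R-trans : ∀ {a b c} → R a b → R b c → R a c
    R-trans {a} {b} {c} q r = resp (λ { fzero → cancelᵐ (h a ⁻¹) (h b) (h c) ; (fsuc v) → cancelᵐ′ (single a v)
      (single b v) _ }) (has-∙ q r)

    R-joins : ∀ {e : E} {a b} → Joins e a b → R (src e) (tgt e) → R a b
    R-joins (inj₁ (refl , refl)) q = q
    R-joins (inj₂ (refl , refl)) q = R-sym q

    joins-R : ∀ {e : E} {a b} → Joins e a b → R a b → R (src e) (tgt e)
    joins-R (inj₁ (refl , refl)) q = q
    joins-R (inj₂ (refl , refl)) q = R-sym q

    around-cycle : (C : Cycle n Γ) → ∀ k → (∀ i → i ≢ k → R (src (Cycle.edg C i)) (tgt (Cycle.edg C i))) →
      R (src (Cycle.edg C k)) (tgt (Cycle.edg C k))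
    around-cycle C k st = joins-R {edg k} (joins k) (Around.around (λ i j → R (vert i) (vert j)) R-refl R-sym R-trans k
      (λ i i≢k → R-joins {edg i} (joins i) (st i i≢k)))
      where open Cycle C

  diff-fits : ∀ {h e} → Fits h e → vec (inj₁ e) ≐ diff h (src e) (tgt e)
  diff-fits f fzero = f
  diff-fits f (fsuc v) = refl

  fits-diff : ∀ {h e} → Fits h e → diff h (src e) (tgt e) ≐ vec (inj₁ e)
  fits-diff f i = sym (diff-fits f i)

  -- F contains a vector for every label, so modulo F the label coordinate can be adjusted at will.
  change-label : ∀ xs {w w′} → Spans (xs ++ F.fs) w → (∀ v → w (fsuc v) ≡ w′ (fsuc v)) → Spans (xs ++ F.fs) w′
  change-label xs {w} {w′} q e = resp
    (λ { fzero → trans (cong (w fzero ∙_) (uncode-code _)) (x∙x⁻¹y _ _) ; (fsuc v) → trans (identityʳ _) (e v) })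
    (has-∙ q (spans-∈ (∈-++⁺ʳ xs (F.inj₂∈fs (code (w fzero ⁻¹ ∙ w′ fzero))))))
    where open Subspace (spans-subspace (xs ++ F.fs))

  -- If `w` closes no cycle with `ws`, some cut is crossed by `w` but by none of `ws`, and a
  -- homomorphism that vanishes on F and on non-crossing edges separates `w` from the span.
  graphic⇒M-indep : ∀ {X} → GraphicIndep n Γ X → M.IndSet X
  graphic⇒M-indep {X} gX ws w wsX wX w∉ws c with Paths.cycle-or-cut n Γ w∉ws
  ... | inj₁ (C , inC) = gX C (cycleSet C) (cycleSet-isEdgeSet C)
        λ f m → case ∈-tabulate⁻ {f = Cycle.edg C} (toSubset⁻ {f} (edges C) m) of λ { (k , refl) → inX (inC k) }
    where
    inX : ∀ {f} → f ∈ w ∷ ws → X f ≡ true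
    inX (here refl) = wX
    inX (there m) = wsX m
  ... | inj₂ (s , mono , cross) = cross (balanced-sides (spans-least χ-subspace onX c))
    where
    -- χ multiplies the coordinates on one side of the cut, so it takes the value u or u⁻¹ on a crossing edge.
    pick : Bool → Carrier → Carrier
    pick b x = if b then x else ε
    χ : W → Carrier
    χ v = prod Γ n (λ i → pick (s i) (v (fsuc i)))

    prod-cong : ∀ {l} {f g : Fin l → Carrier} → (∀ i → f i ≡ g i) → prod Γ l f ≡ prod Γ l g
    prod-cong {zero} e = refl
    prod-cong {suc l} e = cong₂ _∙_ (e fzero) (prod-cong (e ∘ fsuc))
    prod-ε : ∀ l → prod Γ l (λ _ → ε) ≡ ε
    prod-ε zero = refl
    prod-ε (suc l) = trans (identityˡ _) (prod-ε l)
    prod-∙ : ∀ {l} (f g : Fin l → Carrier) → prod Γ l (λ i → f i ∙ g i) ≡ prod Γ l f ∙ prod Γ l g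
    prod-∙ {zero} f g = sym (identityˡ ε)
    prod-∙ {suc l} f g = trans (cong (f fzero ∙ g fzero ∙_) (prod-∙ (f ∘ fsuc) (g ∘ fsuc))) (interchange _ _ _ _)
    prod-⁻¹ : ∀ {l} (f : Fin l → Carrier) → prod Γ l (λ i → f i ⁻¹) ≡ prod Γ l f ⁻¹
    prod-⁻¹ {zero} f = sym ε⁻¹≈ε
    prod-⁻¹ {suc l} f = trans (cong (f fzero ⁻¹ ∙_) (prod-⁻¹ (f ∘ fsuc))) (sym (⁻¹-∙ _ _))
    prod-single : ∀ {l} (j : Fin l) x → prod Γ l (λ v → pick (does (v Fin.≟ j)) x) ≡ x
    prod-single {suc l} fzero x = trans (cong (x ∙_) (prod-ε l)) (identityʳ x)
    prod-single {suc l} (fsuc j) x = trans (identityˡ _) (prod-single j x)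

    pick-ε : ∀ b → pick b ε ≡ ε
    pick-ε true = refl
    pick-ε false = refl
    pick-∙ : ∀ b x y → pick b (x ∙ y) ≡ pick b x ∙ pick b y
    pick-∙ true x y = refl
    pick-∙ false x y = sym (identityˡ ε)
    pick-⁻¹ : ∀ b x → pick b (x ⁻¹) ≡ pick b x ⁻¹
    pick-⁻¹ true x = refl
    pick-⁻¹ false x = sym ε⁻¹≈ε

    χ-subspace : Subspace (λ v → χ v ≡ ε)
    χ-subspace = record
      { resp = λ e q → trans (sym (prod-cong (λ i → cong (pick (s i)) (e (fsuc i))))) q
      ; has-ε = trans (prod-cong (λ i → pick-ε (s i))) (prod-ε n)
      ; has-∙ = λ {v} {v′} q r → trans (prod-cong (λ i → pick-∙ (s i) (v (fsuc i)) (v′ (fsuc i))))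
        (trans (prod-∙ (λ i → pick (s i) (v (fsuc i))) (λ i → pick (s i) (v′ (fsuc i))))
        (trans (cong₂ _∙_ q r) (identityˡ ε))) }

    χ-single : ∀ j → prod Γ n (λ v → pick (s v) (single j v)) ≡ pick (s j) u
    χ-single j = trans (prod-cong at) (prod-single j (pick (s j) u))
      where
      at : ∀ v → pick (s v) (single j v) ≡ pick (does (v Fin.≟ j)) (pick (s j) u)
      at v with v Fin.≟ j
      ... | yes refl = refl
      ... | no _ = pick-ε (s v)

    χ-edge : ∀ e → χ (vec (inj₁ e)) ≡ pick (s (src e)) u // pick (s (tgt e)) u
    χ-edge e = trans (prod-cong (λ v → trans (pick-∙ (s v) _ _)
      (cong (pick (s v) (single (src e) v) ∙_) (pick-⁻¹ (s v) (single (tgt e) v)))))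
      (trans (prod-∙ (at (src e)) (λ v → at (tgt e) v ⁻¹))
        (cong₂ _∙_ (χ-single (src e)) (trans (prod-⁻¹ (at (tgt e))) (cong _⁻¹ (χ-single (tgt e))))))
      where
      at : Fin n → Fin n → Carrier
      at j v = pick (s v) (single j v)

    balanced-sides : χ (vec (inj₁ w)) ≡ ε → Mono s w
    balanced-sides q = go (s (src w)) (s (tgt w)) (trans (sym (χ-edge w)) q)
      where
      go : ∀ x y → pick x u // pick y u ≡ ε → x ≡ y
      go true true _ = refl
      go false false _ = refl
      go true false e = contradiction (xy⁻¹≡ε⇒x≡y e) u≢ε
      go false true e = contradiction (sym (xy⁻¹≡ε⇒x≡y e)) u≢ε

    onX : ∀ {x} → x ∈ map inj₁ ws ++ F.fs → χ (vec x) ≡ ε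
    onX m with ∈-++⁻ (map inj₁ ws) m
    ... | inj₁ q = case ∈-map⁻ inj₁ q of λ { (e , r , refl) → trans (χ-edge e)
      (trans (cong (λ b → pick (s (src e)) u // pick b u) (sym (mono e r))) (inverseʳ _)) }
    ... | inj₂ q = case ∈-map⁻ inj₂ q of λ { (i , _ , refl) → trans (prod-cong (λ i → pick-ε (s i))) (prod-ε n) }

  -- Modulo F labels can be ignored, so every cycle behaves like one fitting the constant potential
  -- ε and its first edge lies in the span of the others.
  M-indep⇒graphic : ∀ {X} → M.IndSet X → GraphicIndep n Γ X
  M-indep⇒graphic {X} ind C Y eq Y⊆X = ind ws (edg fzero)
    (λ m → case ∈-tabulate⁻ {f = edg ∘ fsuc} m of λ { (i , refl) → inX (fsuc i) }) (inX fzero)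
    (λ m → case ∈-tabulate⁻ {f = edg ∘ fsuc} m of λ { (i , e) → case einj e of λ () })
    (change-label (map inj₁ ws) (Diff.around-cycle S (λ _ → ε) C fzero others) (λ v → refl))
    where
    open Cycle C
    ws = List.tabulate (edg ∘ fsuc)
    S = spans-subspace (map inj₁ ws ++ F.fs)
    inX : ∀ i → X (edg i) ≡ true
    inX i = Y⊆X _ (Equivalence.from (eq _) (i , refl))
    others : ∀ i → i ≢ fzero → Spans (map inj₁ ws ++ F.fs) (diff (λ _ → ε) (src (edg i)) (tgt (edg i)))
    others fzero n = contradiction refl n
    others (fsuc i) _ = change-label (map inj₁ ws) (spans-∈ (∈-++⁺ˡ (∈-map⁺ inj₁ (∈-tabulate⁺ {f = edg ∘ fsuc} i))))
      (λ v → refl)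

  contraction : ∀ X → ContractIndep F.K X ⇔ GraphicIndep n Γ X
  contraction X = mk⇔ (M-indep⇒graphic ∘ F.contract-indep⇒ X) (F.⇒contract-indep X ∘ graphic⇒M-indep)

  coordinate-subspace : ∀ i → Subspace (λ w → w i ≡ ε)
  coordinate-subspace i = record
    { resp = λ e q → trans (sym (e i)) q ; has-ε = refl ; has-∙ = λ q r → trans (cong₂ _∙_ q r) (identityˡ ε) }

  single-self : ∀ j → single j j ≡ u
  single-self j = cong (if_then u else ε) (dec-true (j Fin.≟ j) refl)

  single-other : ∀ {j v} → v ≢ j → single j v ≡ ε
  single-other {j} {v} n = cong (if_then u else ε) (dec-false (v Fin.≟ j) n)

  vec-endpoint : ∀ {e v w} → Joins e v w → v ≢ w → vec (inj₁ e) (fsuc v) ≢ ε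
  vec-endpoint {e} {v} {w} (inj₁ (refl , refl)) n q = u≢ε
    (trans (sym (trans (cong₂ _//_ (single-self v) (single-other n)) (trans (cong (u ∙_) ε⁻¹≈ε) (identityʳ u)))) q)
  vec-endpoint {e} {v} {w} (inj₂ (refl , refl)) n q = u≢ε
    (sym (xy⁻¹≡ε⇒x≡y (trans (sym (cong₂ _//_ (single-other n) (single-self v))) q)))

  vec-nonendpoint : ∀ {e v a b} → Joins e a b → v ≢ a → v ≢ b → vec (inj₁ e) (fsuc v) ≡ ε
  vec-nonendpoint (inj₁ (refl , refl)) n n′ = trans (cong₂ _//_ (single-other n) (single-other n′)) (inverseʳ ε)
  vec-nonendpoint (inj₂ (refl , refl)) n n′ = trans (cong₂ _//_ (single-other n′) (single-other n)) (inverseʳ ε)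

  -- The coordinate at `a i` vanishes on F and on all edges after `f i`, but not on `f i`; it
  -- separates `f i` from what follows.
  triangular : ∀ {k} (f : Fin k → E) (a : Fin k → Fin n) → (∀ i → vec (inj₁ (f i)) (fsuc (a i)) ≢ ε) →
    (∀ i j → i <ᶠ j → vec (inj₁ (f j)) (fsuc (a i)) ≡ ε) → M.Ind (List.tabulate f)
  triangular {zero} f a ne ze = tt
  triangular {suc k} f a ne ze =
    (λ c → ne fzero (spans-least (coordinate-subspace (fsuc (a fzero))) rest c)) ,
    triangular (f ∘ fsuc) (a ∘ fsuc) (ne ∘ fsuc) (λ i j lt → ze (fsuc i) (fsuc j) (s<s lt))
    where
    rest : ∀ {x} → x ∈ map inj₁ (List.tabulate (f ∘ fsuc)) ++ F.fs → vec x (fsuc (a fzero)) ≡ ε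
    rest m with ∈-++⁻ (map inj₁ (List.tabulate (f ∘ fsuc))) m
    ... | inj₁ q = case ∈-map⁻ inj₁ q of λ { (_ , r , refl) →
      case ∈-tabulate⁻ {f = f ∘ fsuc} r of λ { (j , refl) → ze fzero (fsuc j) z<s } }
    ... | inj₂ q = case ∈-map⁻ inj₂ q of λ { (_ , _ , refl) → refl }

  M-ind⇒L-ind : ∀ {xs} → M.Ind xs → L.Ind xs
  M-ind⇒L-ind {[]} _ = tt
  M-ind⇒L-ind {x ∷ xs} (n , i) = (λ c → n (P.cl-mono {map inj₁ xs} {map inj₁ xs ++ F.fs} {inj₁ x} ∈-++⁺ˡ c)) , M-ind⇒L-ind i

  module OnCycle (C : Cycle n Γ) where
    open Cycle C

    path : List E
    path = List.tabulate (edg ∘ inject₁)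

    path-ind : M.Ind path
    path-ind = triangular (edg ∘ inject₁) (vert ∘ inject₁)
      (λ i → vec-endpoint {edg (inject₁ i)} (joinsᵢ i) (λ e → inject₁≢suc i (vinj e)))
      (λ i j i<j → vec-nonendpoint {edg (inject₁ j)} (joinsᵢ j) (λ e → Fin.<⇒≢ i<j (Fin.inject₁-injective (vinj e)))
        (λ e → ℕ.<-irrefl (trans (sym (Fin.toℕ-inject₁ i)) (cong toℕ (vinj e))) (ℕ.m≤n⇒m≤1+n i<j)))
      where
      joinsᵢ : ∀ i → Joins (edg (inject₁ i)) (vert (inject₁ i)) (vert (fsuc i))
      joinsᵢ i = subst (λ k → Joins (edg (inject₁ i)) (vert (inject₁ i)) (vert k)) (next-inject₁ i) (joins (inject₁ i))
      inject₁≢suc : ∀ {l} (i : Fin l) → inject₁ i ≢ fsuc i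
      inject₁≢suc i e = ℕ.1+n≢n (sym (trans (sym (Fin.toℕ-inject₁ i)) (cong toℕ e)))

    path-length : length path ≡ suc len
    path-length = List.length-tabulate (edg ∘ inject₁)

    balanced⇒span : Balanced C → ∀ k {xs} → (∀ i → i ≢ k → L.Cl xs (edg i)) → L.Cl xs (edg k)
    balanced⇒span b k {xs} st = resp (fits-diff {e = edg k} (fits k))
      (Diff.around-cycle (spans-subspace (map inj₁ xs)) (pathPotential C) C k
      (λ i i≢k → resp (diff-fits {e = edg i} (fits i)) (st i i≢k)))
      where
      fits = balanced⇒fits C b
      open Subspace (spans-subspace (map inj₁ xs)) using (resp)

    others : Fin (suc (suc len)) → List E
    others k = List.tabulate (edg ∘ punchIn k)

    ∈-others : ∀ k {i} → i ≢ k → edg i ∈ others k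
    ∈-others k {i} i≢k = subst (λ j → edg j ∈ others k) (Fin.punchIn-punchOut (i≢k ∘ sym))
      (∈-tabulate⁺ {f = edg ∘ punchIn k} (punchOut (i≢k ∘ sym)))

    module _ {X} (X-set : EdgeSetOf C X) where
      inX : ∀ k → X (edg k) ≡ true
      inX k = Equivalence.from (X-set _) (k , refl)

      balanced⇒circuit : Balanced C → IsCircuit L.IndSet X
      balanced⇒circuit b = dependent , proper
        where
        dependent : ¬ L.IndSet X
        dependent ind = ind (others fzero) (edg fzero)
          (λ m → case ∈-tabulate⁻ {f = edg ∘ punchIn fzero} m of λ { (i , refl) → inX _ }) (inX fzero)
          (λ m → case ∈-tabulate⁻ {f = edg ∘ punchIn fzero} m of λ { (i , e) → Fin.punchInᵢ≢i fzero i (sym (einj e)) })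
          (balanced⇒span b fzero {others fzero} (λ i i≢0 → L.cl-∈ (∈-others fzero i≢0)))
        proper : ∀ Y → Y ⊆ X → (∃[ e ] (X e ≡ true × Y e ≡ false)) → L.IndSet Y
        proper Y Y⊆X (e , Xe , Ye) with Equivalence.to (X-set e) Xe
        ... | k , refl = λ ws w wsY wY w∉ws c → overfull w∉ws wsY c (split-∈ (inY w wY))
          where
          inY : ∀ x → Y x ≡ true → x ∈ others k
          inY x Yx with Equivalence.to (X-set x) (Y⊆X x Yx)
          ... | i , refl = ∈-others k λ { refl → contradiction (trans (sym Ye) Yx) λ () }
          -- Removing both e and w from C would leave a spanning list shorter than the independent path.
          overfull : ∀ {ws w} → w ∉ ws → (∀ {x} → x ∈ ws → Y x ≡ true) → L.Cl ws w → ¬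
            (∃[ as ] ∃[ bs ] others k ≡ as ++ w ∷ bs)
          overfull {ws} {w} w∉ws wsY c (as , bs , eq) = ℕ.<-irrefl refl (ℕ.≤-trans
            (ℕ.≤-reflexive (trans (sym (length-delete as)) (trans (sym (cong length eq))
              (trans (List.length-tabulate (edg ∘ punchIn k)) (sym path-length)))))
            (L.steinitz path {as ++ bs} (M-ind⇒L-ind path-ind)
              (λ m → case ∈-tabulate⁻ {f = edg ∘ inject₁} m of λ { (i , refl) → all (inject₁ i) })))
            where
            most : ∀ {x} → x ∈ others k → L.Cl (as ++ bs) x
            most {x} m with x ≟ᴱ w
            ... | no x≢w = L.cl-∈ (∈-delete as (subst (x ∈_) eq m) x≢w)
            ... | yes refl = L.cl-mono {ws} {as ++ bs} {w}
              (λ {z} q → ∈-delete as (subst (z ∈_) eq (inY z (wsY q))) λ { refl → w∉ws q }) c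
            all : ∀ i → L.Cl (as ++ bs) (edg i)
            all i with i Fin.≟ k
            ... | no i≢k = most (∈-others k i≢k)
            ... | yes refl = balanced⇒span b k {as ++ bs} (λ i i≢k → most (∈-others k i≢k))

      last : Fin (suc (suc len))
      last = fromℕ (suc len)

      -- If the path spanned the closing edge, subtracting the vector that fits `pathPotential`
      -- would leave a pure label vector `gap` in the span of the path. By `skew` that span meets F
      -- trivially, so `gap` is ε and the closing edge fits.
      unbalanced⇒indep : ¬ Balanced C → L.IndSet X
      unbalanced⇒indep nb = L.ind⇒indSet {ys = edg last ∷ path} (last∉ , M-ind⇒L-ind path-ind) covers
        where
        covers : ∀ x → X x ≡ true → x ∈ edg last ∷ path
        covers x Xx with Equivalence.to (X-set x) Xx
        ... | k , refl with view k
        ...   | ‵fromℕ = here refl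
        ...   | ‵inject₁ i = there (∈-tabulate⁺ {f = edg ∘ inject₁} i)
        h = pathPotential C
        e = edg last
        γ = h (src e) ⁻¹ ∙ h (tgt e)
        S = spans-subspace (map inj₁ path)
        open Subspace S
        on-path : ∀ i → i ≢ last → Spans (map inj₁ path) (diff h (src (edg i)) (tgt (edg i)))
        on-path i i≢last with view i
        ... | ‵fromℕ = contradiction refl i≢last
        ... | ‵inject₁ j = resp (diff-fits {e = edg (inject₁ j)} (pathPotential-fits C j))
          (spans-∈ (∈-map⁺ inj₁ (∈-tabulate⁺ {f = edg ∘ inject₁} j)))
        last∉ : ¬ L.Cl path e
        last∉ c = nb (fits-last⇒balanced C (xy⁻¹≡ε⇒x≡y gap≡ε))
          where
          gap = label e // γ
          pure : Spans (map inj₁ path) (vec (inj₂ (code gap)))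
          pure = resp (λ { fzero → sym (uncode-code gap) ; (fsuc v) → inverseʳ _ })
            (has-∙ c (has-⁻¹ (Diff.around-cycle S h C last on-path)))
          gap≡ε : gap ≡ ε
          gap≡ε = trans (sym (uncode-code gap)) (spans-[] {w = vec (inj₂ (code gap))}
            (F.skew {X = toSubset path} (M.ind⇒indSet path-ind (λ x → toSubset⁻ path)) path toSubset⁺ []
              (P.cl-mono {map inj₁ path} {map inj₁ path ++ []} {inj₂ (code gap)} ∈-++⁺ˡ pure)) fzero)

      circuit⇔balanced : IsCircuit L.IndSet X ⇔ Balanced C
      circuit⇔balanced = mk⇔ (λ (dep , _) → decidable-stable (_ ≟ _) (λ nb → dep (unbalanced⇒indep nb))) balanced⇒circuit

isCircuit-cong : ∀ {E} {I J : IndepPred E} → (∀ X → I X ⇔ J X) → ∀ {X} → IsCircuit I X → IsCircuit J X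
isCircuit-cong eq (dep , proper) = dep ∘ Equivalence.from (eq _) , λ Y s m → Equivalence.to (eq Y) (proper Y s m)

-- Class membership and rank of the linear lift

module LinearLift {Γ : FiniteGroup} {p : ℕ} (el : Elementary Γ p) (u k : Elt Γ) (u≢ε : u ≢ FiniteGroup.ε Γ)
  (independent : ¬ (∃[ i ] k ≡ Powers._^_ Γ u i)) (m : ℕ) where
  open GroupFacts Γ
  open ElementaryFacts el
  open Graph (2 + m) Γ
  open Star (1 + m) Γ
  open Representation el u u≢ε (2 + m)
  open Vectors (suc (2 + m))
  open Span vec

  lift : Matroid E
  lift = Deletion.deletion F.K

  lift-indep : ∀ X → Indep lift X ⇔ L.IndSet X
  lift-indep X = mk⇔ F.deletion-indep⇒ F.⇒deletion-indep

  lift-inClass : InClass (2 + m) Γ lift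
  lift-inClass = Deletion.deletion-isLift F.K contraction , λ C X X-set →
    let open Equivalence (OnCycle.circuit⇔balanced C X-set) in
    mk⇔ (to ∘ isCircuit-cong lift-indep) (isCircuit-cong (λ X → mk⇔ F.⇒deletion-indep F.deletion-indep⇒) ∘ from)

  star-ind : M.Ind star
  star-ind = triangular spoke fsuc (λ i → vec-endpoint {spoke i} {fsuc i} {fzero} (inj₂ (refl , refl)) λ ())
    (λ i j i<j → vec-nonendpoint {spoke j} {fsuc i} (inj₁ (refl , refl)) (λ ()) (λ { refl → Fin.<-irrefl refl i<j }))

  star-spans : ∀ e → M.Cl star e
  star-spans e = change-label (map inj₁ star) (R-trans (R-sym (from-root (src e))) (from-root (tgt e))) (λ v → refl)
    where
    open Diff (spans-subspace (map inj₁ star ++ F.fs)) (λ _ → ε)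
    from-root : ∀ v → R fzero v
    from-root fzero = R-refl
    from-root (fsuc j) = change-label (map inj₁ star) (spans-∈ (∈-++⁺ˡ (∈-map⁺ inj₁ (∈-tabulate⁺ {f = spoke} j))))
      (λ v → refl)

  graphic-rank : IsRank (GraphicIndep (2 + m) Γ) (1 + m)
  graphic-rank = (toSubset star , star-graphic , star-size) , λ { X s gX (f , inj , fX , _) →
    subst₂ _≤_ (List.length-tabulate f) (List.length-tabulate spoke)
      (M.steinitz (List.tabulate f) {star} (M.indSet⇒ind (graphic⇒M-indep gX) f inj fX) (λ {y} _ → star-spans y)) }

  A : Carrier → E
  A = edge fzero (fsuc fzero) z<s

  power-subspace : Subspace (λ w → ∃[ i ] w fzero ≡ u ^ i)
  power-subspace = record
    { resp = λ e (i , q) → i , trans (sym (e fzero)) q ; has-ε = 0 , refl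
    ; has-∙ = λ (i , q) (j , r) → i + j , trans (cong₂ _∙_ q r) (sym (^-+ u i j)) }

  -- Star edges have label ε, so `A u` is outside their span; together with `A u` they only give
  -- labels that are powers of `u`, and `k` is none. This exceeds the rank of the cycle matroid by
  -- two.
  large-ind : L.Ind (A k ∷ A u ∷ star)
  large-ind = (λ c → independent (spans-least power-subspace on-Au∷star c)) ,
    (λ c → u≢ε (spans-least (coordinate-subspace fzero) on-star c)) , M-ind⇒L-ind star-ind
    where
    on-star : ∀ {x} → x ∈ map inj₁ star → vec x fzero ≡ ε
    on-star q = case ∈-map⁻ inj₁ q of λ { (_ , r , refl) → case ∈-tabulate⁻ {f = spoke} r of λ { (_ , refl) → refl } }
    on-Au∷star : ∀ {x} → x ∈ map inj₁ (A u ∷ star) → ∃[ i ] vec x fzero ≡ u ^ i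
    on-Au∷star (here refl) = 1 , sym (^-1 u)
    on-Au∷star (there q) = 0 , on-star q

  -- Its length serves as the rank of the lift, which is only bounded from below, by `large-ind`.
  edge-basis : ∃[ rs ] (L.Ind rs × ∀ e → L.Cl rs e)
  edge-basis = let (rs , _ , ind , spans) = L.basis (proj₁ enumᴱ) in rs , ind , λ e → spans (proj₂ enumᴱ e)

  lift-rank : IsRank (Indep lift) (length (proj₁ edge-basis))
  lift-rank = (toSubset rs , Equivalence.from (lift-indep _) (L.ind⇒indSet ind (λ x → toSubset⁻ rs)) , toSubset-size
    (L.ind⇒distinct ind)) , bound
    where
    rs = proj₁ edge-basis
    ind = proj₁ (proj₂ edge-basis)
    bound : ∀ X s → Indep lift X → HasSize X s → s ≤ length rs
    bound X s iX (f , inj , fX , _) = subst (_≤ length rs) (List.length-tabulate f)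
      (L.steinitz (List.tabulate f) {rs} (L.indSet⇒ind (Equivalence.to (lift-indep X) iX) f inj fX)
        (λ {y} _ → proj₂ (proj₂ edge-basis) y))

  lift-nonElementary : NonElementary (2 + m) Γ lift
  lift-nonElementary = 1 + m , length (proj₁ edge-basis) , graphic-rank , lift-rank ,
    ℕ.≤-trans (ℕ.≤-reflexive (trans (ℕ.+-comm (1 + m) 2) (cong (2 +_) (sym (List.length-tabulate spoke)))))
      (L.steinitz (A k ∷ A u ∷ star) {proj₁ edge-basis} large-ind (λ {y} _ → proj₂ (proj₂ edge-basis) y))

-- Transport of elementary abelian structure from ℤ_p^j

module FromIso {Γ : FiniteGroup} {q j : ℕ} (isPrime : Prime (2 + q)) (iso : IsoToZpj Γ (2 + q) (2 + j)) where
  open GroupFacts Γ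
  open Powers Γ

  private
    p = 2 + q
    to = Inverse.to (proj₁ iso)
    from = Inverse.from (proj₁ iso)
    to-from : ∀ v → to (from v) ≡ v
    to-from = Inverse.strictlyInverseˡ (proj₁ iso)
    to-injective : ∀ {x y} → to x ≡ to y → x ≡ y
    to-injective {x} {y} e = trans (sym (Inverse.strictlyInverseʳ (proj₁ iso) x))
      (trans (cong from e) (Inverse.strictlyInverseʳ (proj₁ iso) y))

    coord : Carrier → Fin (2 + j) → ℕ
    coord x i = toℕ (lookup (to x) i)

    coord-injective : ∀ {x y} → (∀ i → coord x i ≡ coord y i) → x ≡ y
    coord-injective {x} {y} e = to-injective (trans (sym (Vec.tabulate∘lookup (to x)))
      (trans (Vec.tabulate-cong (λ i → Fin.toℕ-injective (e i))) (Vec.tabulate∘lookup (to y))))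

    coord-∙ : ∀ x y i → coord (x ∙ y) i ≡ (coord x i + coord y i) % p
    coord-∙ x y i = trans (cong (λ v → toℕ (lookup v i)) (proj₂ iso x y))
      (trans (cong toℕ (Vec.lookup-zipWith addMod i (to x) (to y))) (Fin.toℕ-fromℕ< (m%n<n (coord x i + coord y i) p)))

    coord<p : ∀ x i → coord x i < p
    coord<p x i = Fin.toℕ<n _

    -- The isomorphism is given by compatibility with products alone; ε is located as an idempotent,
    -- and 0 is the only idempotent residue under addition.
    idempotent⇒0 : ∀ z → z < p → z ≡ (z + z) % p → z ≡ 0
    idempotent⇒0 z z<p e with z + z ℕ.<? p
    ... | yes lt = sym (ℕ.+-cancelˡ-≡ z 0 z (trans (ℕ.+-identityʳ z) (trans e (m<n⇒m%n≡m lt))))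
    ... | no ge = contradiction (ℕ.+-cancelˡ-≡ z p z (begin
      z + p                     ≡⟨ cong (_+ p) e ⟩
      (z + z) % p + p           ≡⟨ cong (λ w → w % p + p) z+z≡ ⟩
      (z + z ∸ p + p) % p + p   ≡⟨ cong (_+ p) ([m+n]%n≡m%n (z + z ∸ p) p) ⟩
      (z + z ∸ p) % p + p       ≡⟨ cong (_+ p) (m<n⇒m%n≡m small) ⟩
      z + z ∸ p + p             ≡⟨ z+z≡ ⟨
      z + z                     ∎)) (λ p≡z → ℕ.<-irrefl (sym p≡z) z<p)
      where
      open ≡-Reasoning
      z+z≡ : z + z ≡ z + z ∸ p + p
      z+z≡ = sym (ℕ.m∸n+n≡m (ℕ.≮⇒≥ ge))
      small : z + z ∸ p < p
      small = ℕ.+-cancelʳ-< p _ p (subst (_< p + p) z+z≡ (ℕ.+-mono-< z<p z<p))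

    coord-ε : ∀ i → coord ε i ≡ 0
    coord-ε i = idempotent⇒0 _ (coord<p ε i) (trans (cong (λ x → coord x i) (sym (identityˡ ε))) (coord-∙ ε ε i))

    coord-^ : ∀ x n i → coord (x ^ n) i ≡ (n * coord x i) % p
    coord-^ x zero i = coord-ε i
    coord-^ x (suc n) i = begin
      coord (x ∙ x ^ n) i                            ≡⟨ coord-∙ x (x ^ n) i ⟩
      (a + coord (x ^ n) i) % p                      ≡⟨ cong (λ w → (a + w) % p) (coord-^ x n i) ⟩
      (a + (n * a) % p) % p                          ≡⟨ %-distribˡ-+ a ((n * a) % p) p ⟩
      (a % p + (n * a) % p % p) % p                  ≡⟨ cong (λ w → (a % p + w) % p) (m%n%n≡m%n (n * a) p) ⟩
      (a % p + (n * a) % p) % p                      ≡⟨ %-distribˡ-+ a (n * a) p ⟨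
      (a + n * a) % p                                ∎
      where
      open ≡-Reasoning
      a = coord x i

  elementary : Elementary Γ p
  elementary = record
    { isPrime = isPrime
    ; commutative = λ x y → coord-injective λ i → trans (coord-∙ x y i)
      (trans (cong (_% p) (ℕ.+-comm (coord x i) _)) (sym (coord-∙ y x i)))
    ; exponent = λ x → coord-injective λ i → trans (coord-^ x p i)
        (trans (cong (_% p) (ℕ.*-comm p (coord x i))) (trans (m*n%n≡0 (coord x i) p) (sym (coord-ε i)))) }

  e₀ e₁ : Carrier
  e₀ = from (fsuc fzero ∷ fzero ∷ replicate j fzero)
  e₁ = from (fzero ∷ fsuc fzero ∷ replicate j fzero)

  e₀≢ε : e₀ ≢ ε
  e₀≢ε e = contradiction (trans (sym (cong (λ v → toℕ (lookup v fzero)) (to-from _)))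
    (trans (cong (λ x → coord x fzero) e) (coord-ε fzero))) λ ()

  e₁-independent : ¬ (∃[ i ] e₁ ≡ e₀ ^ i)
  e₁-independent (i , e) = contradiction (begin
    1                                   ≡⟨ cong (λ v → toℕ (lookup v (fsuc fzero))) (to-from _) ⟨
    coord e₁ (fsuc fzero)               ≡⟨ cong (λ x → coord x (fsuc fzero)) e ⟩
    coord (e₀ ^ i) (fsuc fzero)         ≡⟨ coord-^ e₀ i (fsuc fzero) ⟩
    (i * coord e₀ (fsuc fzero)) % p     ≡⟨ cong (λ v → (i * toℕ (lookup v (fsuc fzero))) % p) (to-from _) ⟩
    (i * 0) % p                         ≡⟨ cong (_% p) (ℕ.*-zeroʳ i) ⟩
    0                                   ∎) λ ()
    where open ≡-Reasoning

elementary-sufficiency : ∀ {Γ m p j} → Prime p → 2 ≤ j → IsoToZpj Γ p j →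
  Σ (Matroid (Edge (2 + m) Γ)) λ L → InClass (2 + m) Γ L × NonElementary (2 + m) Γ L
elementary-sufficiency {p = zero} isPrime _ _ = contradiction (nonTrivial⇒n>1 0 ⦃ prime⇒nonTrivial isPrime ⦄) λ ()
elementary-sufficiency {p = suc zero} isPrime _ _ = contradiction
  (nonTrivial⇒n>1 1 ⦃ prime⇒nonTrivial isPrime ⦄) λ { (s≤s ()) }
elementary-sufficiency {Γ} {m} {suc (suc q)} {suc (suc j)} isPrime _ iso = lift , lift-inClass , lift-nonElementary
  where
  open FromIso {Γ} {q} {j} isPrime iso
  open LinearLift elementary e₀ e₁ e₀≢ε e₁-independent m
elementary-sufficiency {p = suc (suc _)} {suc zero} _ (s≤s ()) _

-- Matroids of rank 4 from lines and planes

-- Prepending the missed value turns the injection into a permutation.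
missed-once : ∀ {n} (σ : Fin n → Fin (suc n)) → Injective _≡_ _≡_ σ → ∃[ m ] (∀ i → i ≡ m ⊎ ∃[ t ] σ t ≡ i)
missed-once {n} σ inj with escape Fin._≟_ σ id id (ℕ.n<1+n n)
... | m , miss = m , λ i → case injective⇒surjective
  (λ {x} {y} → τ-inj {x} {y}) i of λ { (fzero , e) → inj₁ (sym e) ; (fsuc t , e) → inj₂ (t , e) }
  where
  τ : Fin (suc n) → Fin (suc n)
  τ fzero = m
  τ (fsuc t) = σ t
  τ-inj : Injective _≡_ _≡_ τ
  τ-inj {fzero} {fzero} _ = refl
  τ-inj {fzero} {fsuc t} e = contradiction (sym e) (miss t)
  τ-inj {fsuc t} {fzero} e = contradiction e (miss t)
  τ-inj {fsuc _} {fsuc _} e = cong fsuc (inj e)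

-- Lines with only two points need not be listed, since independence tests lines on three distinct points.
record LinesAndPlanes (P : Set) : Set₁ where
  infix 4 _∈ˡ_ _∈ᵖ_
  field
    _≟_ : DecidableEquality P
    Line Plane : Set
    _∈ˡ_ : P → Line → Set
    _∈ᵖ_ : P → Plane → Set
    ∈ˡ? : ∀ x l → Dec (x ∈ˡ l)
    ∈ᵖ? : ∀ x π → Dec (x ∈ᵖ π)
    collinear? : ∀ x y z → Dec (∃[ l ] (x ∈ˡ l × y ∈ˡ l × z ∈ˡ l))
    coplanar? : ∀ x y z w → Dec (∃[ π ] (x ∈ᵖ π × y ∈ᵖ π × z ∈ᵖ π × w ∈ᵖ π))
    line-unique : ∀ {x y z} l l′ → x ≢ y → x ∈ˡ l → y ∈ˡ l → x ∈ˡ l′ → y ∈ˡ l′ → z ∈ˡ l′ → z ∈ˡ l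
    plane-unique : ∀ {x y z w} π π′ → x ≢ y → x ≢ z → y ≢ z → ¬ (∃[ l ] (x ∈ˡ l × y ∈ˡ l × z ∈ˡ l)) →
      x ∈ᵖ π → y ∈ᵖ π → z ∈ᵖ π → x ∈ᵖ π′ → y ∈ᵖ π′ → z ∈ᵖ π′ → w ∈ᵖ π′ → w ∈ᵖ π
    line-point : ∀ {x} l w → x ∈ˡ l → ∃[ π ] ((∀ y → y ∈ˡ l → y ∈ᵖ π) × w ∈ᵖ π)

  -- Independence of `k` distinct points in rank 4: there are no loops or parallel pairs, three
  -- points must not be collinear, four must not be coplanar, and five are always dependent.
  Good : ∀ k → (Fin k → P) → Set
  Good 0 _ = ⊤
  Good 1 _ = ⊤
  Good 2 _ = ⊤
  Good 3 f = ¬ (∃[ l ] ∀ i → f i ∈ˡ l)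
  Good 4 f = ¬ (∃[ π ] ∀ i → f i ∈ᵖ π)
  Good (suc (suc (suc (suc (suc _))))) _ = ⊥

  good-cong : ∀ k {f g : Fin k → P} → (∀ i → f i ≡ g i) → Good k f → Good k g
  good-cong 0 _ _ = tt
  good-cong 1 _ _ = tt
  good-cong 2 _ _ = tt
  good-cong 3 e n (l , on) = n (l , λ i → subst (_∈ˡ l) (sym (e i)) (on i))
  good-cong 4 e n (π , on) = n (π , λ i → subst (_∈ᵖ π) (sym (e i)) (on i))

  too-many : ∀ {k a} {A : Set} {σ : Fin k → Fin a} → Injective _≡_ _≡_ σ → a < k → A
  too-many inj lt = contradiction (λ {x} {y} → inj {x} {y}) (Fin.<⇒notInjective lt)

  good-sub : ∀ {k} a (h : Fin a → P) (σ : Fin k → Fin a) → Injective _≡_ _≡_ σ → Good a h → Good k (h ∘ σ)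
  good-sub {0} a h σ inj g = tt
  good-sub {1} a h σ inj g = tt
  good-sub {2} a h σ inj g = tt
  good-sub {3} 0 h σ inj g = too-many inj (s≤s z≤n)
  good-sub {3} 1 h σ inj g = too-many inj (s≤s (s≤s z≤n))
  good-sub {3} 2 h σ inj g = too-many inj (s≤s (s≤s (s≤s z≤n)))
  good-sub {3} 3 h σ inj g (l , on) = g (l , λ i → let (t , e) = injective⇒surjective inj i in subst (λ j → h j ∈ˡ l) e (on t))
  -- Three collinear points among four would make all four coplanar, by the plane through the line
  -- and the remaining point.
  good-sub {3} 4 h σ inj g (l , on) with missed-once σ inj
  ... | m , cover with line-point l (h m) (on fzero)
  ...   | π , ⊇l , hm = g (π , λ i → [ (λ { refl → hm }) , (λ { (t , refl) → ⊇l _ (on t) }) ]′ (cover i))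
  good-sub {4} 0 h σ inj g = too-many inj (s≤s z≤n)
  good-sub {4} 1 h σ inj g = too-many inj (s≤s (s≤s z≤n))
  good-sub {4} 2 h σ inj g = too-many inj (s≤s (s≤s (s≤s z≤n)))
  good-sub {4} 3 h σ inj g = too-many inj (s≤s (s≤s (s≤s (s≤s z≤n))))
  good-sub {4} 4 h σ inj g (π , on) = g (π , λ i → let (t , e) = injective⇒surjective inj i in subst (λ j → h j ∈ᵖ π) e (on t))
  good-sub {suc (suc (suc (suc (suc k))))} 0 h σ inj g = too-many inj (s≤s z≤n)
  good-sub {suc (suc (suc (suc (suc k))))} 1 h σ inj g = too-many inj (s≤s (s≤s z≤n))
  good-sub {suc (suc (suc (suc (suc k))))} 2 h σ inj g = too-many inj (s≤s (s≤s (s≤s z≤n)))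
  good-sub {suc (suc (suc (suc (suc k))))} 3 h σ inj g = too-many inj (s≤s (s≤s (s≤s (s≤s z≤n))))
  good-sub {suc (suc (suc (suc (suc k))))} 4 h σ inj g = too-many inj (s≤s (s≤s (s≤s (s≤s (s≤s z≤n)))))

  IndepSet : Subset P → Set
  IndepSet X = ∀ k (f : Fin k → P) → Injective _≡_ _≡_ f → (∀ i → X (f i) ≡ true) → Good k f

  good⇒indepSet : ∀ {a X} (h : Fin a → P) → Good a h → (∀ x → X x ≡ true → ∃[ i ] h i ≡ x) → IndepSet X
  good⇒indepSet {a} {X} h g sur k f inj fX = good-cong _ (λ i → proj₂ (at i)) (good-sub a h (proj₁ ∘ at) σ-inj g)
    where
    at : ∀ i → ∃[ j ] h j ≡ f i
    at i = sur (f i) (fX i)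
    σ-inj : Injective _≡_ _≡_ (proj₁ ∘ at)
    σ-inj {x} {y} e = inj (trans (sym (proj₂ (at x))) (trans (cong h e) (proj₂ (at y))))

  infixr 5 _◂_
  _◂_ : ∀ {a} → P → (Fin a → P) → Fin (suc a) → P
  (e ◂ f) fzero = e
  (e ◂ f) (fsuc i) = f i

  private
    Extension : Subset P → Subset P → Set
    Extension X Y = ∃[ e ] (Y e ≡ true × X e ≡ false × ∃[ Z ] (IsInsert X e Z × IndepSet Z))

    extend : ∀ {X Y a b} ((f , _) : HasSize X a) ((g , _) : HasSize Y b) j → (∀ i → f i ≢ g j) → Good (suc a) (g j ◂ f) →
      Extension X Y
    extend {X} {Y} (f , f-inj , fX , f-sur) (g , g-inj , gY , _) j new good = e , gY j , eX , Z , (λ x → Z⁻ x , Z⁺ x) ,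
      good⇒indepSet (e ◂ f) good λ x Zx → [ (λ p → let (i , q) = f-sur x p in fsuc i , q) , (λ p → fzero , sym p) ]′ (Z⁻ x Zx)
      where
      e = g j
      eX : X e ≡ false
      eX with X e in eq
      ... | false = refl
      ... | true = contradiction (proj₂ (f-sur e eq)) (new _)
      Z : Subset P
      Z x = X x ∨ does (x ≟ e)
      Z⁻ : ∀ x → Z x ≡ true → X x ≡ true ⊎ x ≡ e
      Z⁻ x q = [ inj₁ , (λ r → inj₂ (does⁻ (x ≟ e) r)) ]′ (∨⁻ (X x) q)
      Z⁺ : ∀ x → X x ≡ true ⊎ x ≡ e → Z x ≡ true
      Z⁺ x (inj₁ q) rewrite q = refl
      Z⁺ x (inj₂ q) rewrite dec-true (x ≟ e) q = Bool.∨-zeroʳ (X x)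

    aug : ∀ X Y a b → IndepSet X → IndepSet Y → HasSize X a → HasSize Y b → a < b → Extension X Y
    aug X Y 0 (suc b) iX iY sX sY _ = extend sX sY fzero (λ ()) tt
    aug X Y 1 b iX iY sX@(f , _) sY@(g , g-inj , _) lt with escape _≟_ f g g-inj lt
    ... | j , new = extend sX sY j new tt
    aug X Y 2 b iX iY sX@(f , f-inj , _) sY@(g , g-inj , gY , _) lt with escape _≟_ f g g-inj lt
    ... | j , new with collinear? (f fzero) (f (fsuc fzero)) (g j)
    ...   | no n = extend sX sY j new λ (l , on) → n (l , on (fsuc fzero) , on (fsuc (fsuc fzero)) , on fzero)
    -- The first candidate lies on the line through `X`. Since `Y` contains three noncollinear
    -- points, one of its points is off `l`, and by `line-unique` it is off every line through both
    -- points of `X`.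
    ...   | yes (l , x∈ , y∈ , _) with Fin.any? (λ i → ¬? (∈ˡ? (g i) l))
    ...     | yes (i , gi∉) = extend sX sY i (λ { fzero e → gi∉ (subst (_∈ˡ l) e x∈) ; (fsuc fzero) e → gi∉
      (subst (_∈ˡ l) e y∈) })
                λ (l′ , on) → gi∉ (line-unique l l′ (λ e → case f-inj e of λ ()) x∈ y∈ (on (fsuc fzero))
                  (on (fsuc (fsuc fzero))) (on fzero))
    ...     | no none = contradiction (l , λ i → decidable-stable (∈ˡ? _ l) (λ n → none (inject≤ i lt , n)))
                (iY _ (λ i → g (inject≤ i lt)) (λ e → Fin.inject≤-injective lt lt _ _ (g-inj e)) (λ i → gY _))
    aug X Y 3 b iX iY sX@(f , f-inj , fX , _) sY@(g , g-inj , gY , _) lt with escape _≟_ f g g-inj lt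
    ... | j , new with coplanar? (f fzero) (f (fsuc fzero)) (f (fsuc (fsuc fzero))) (g j)
    ...   | no n = extend sX sY j new λ (π , on) → n
      (π , on (fsuc fzero) , on (fsuc (fsuc fzero)) , on (fsuc (fsuc (fsuc fzero))) , on fzero)
    ...   | yes (π , x∈ , y∈ , z∈ , _) with Fin.any? (λ i → ¬? (∈ᵖ? (g i) π))
    -- The same argument one dimension higher; independence of `X` supplies the noncollinearity that
    -- `plane-unique` demands.
    ...     | yes (i , gi∉) = extend sX sY i (λ { fzero e → gi∉ (subst (_∈ᵖ π) e x∈) ; (fsuc fzero) e → gi∉
      (subst (_∈ᵖ π) e y∈)
                                               ; (fsuc (fsuc fzero)) e → gi∉ (subst (_∈ᵖ π) e z∈) })
                λ (π′ , on) → gi∉ (plane-unique π π′ (λ e → case f-inj e of λ ()) (λ e → case f-inj e of λ ())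
                  (λ e → case f-inj e of λ ())
                  (λ (l , p , q , r) → iX 3 f f-inj fX (l , λ { fzero → p ; (fsuc fzero) → q ; (fsuc (fsuc fzero)) → r }))
                  x∈ y∈ z∈ (on (fsuc fzero)) (on (fsuc (fsuc fzero))) (on (fsuc (fsuc (fsuc fzero)))) (on fzero))
    ...     | no none = contradiction (π , λ i → decidable-stable (∈ᵖ? _ π) (λ n → none (inject≤ i lt , n)))
                (iY _ (λ i → g (inject≤ i lt)) (λ e → Fin.inject≤-injective lt lt _ _ (g-inj e)) (λ i → gY _))
    aug X Y (suc (suc (suc (suc _)))) _ iX iY _ (g , g-inj , gY , _) (s≤s (s≤s (s≤s (s≤s (s≤s _))))) = ⊥-elim
      (iY _ g g-inj gY)

  rank4Matroid : Matroid P
  rank4Matroid = record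
    { Indep = IndepSet
    ; indep-∅ = λ { 0 _ _ _ → tt ; (suc k) _ _ e → contradiction (e fzero) λ () }
    ; indep-⊆ = λ X Y s iX k f inj fY → iX k f inj (λ i → s _ (fY i))
    ; augment = aug }

-- The lift for n = 3

module TriangleLift {Γ : FiniteGroup} (part : HasNontrivialPartition Γ) where
  open GroupFacts Γ
  open Graph 3 Γ
  open Star 2 Γ
  open Partitions Γ using (conj; conj-ε; conj-conj; conj≡ε; Block; Block?; Block-isSpread; Block-conj)
  open SpreadFacts (Block-isSpread part)

  H : Carrier → Carrier → Set
  H = Block part

  cj : Carrier → Carrier → Carrier
  cj = conj part

  Pot : Set
  Pot = Fin 3 → Carrier

  -- The label after switching by `p`; it is ε exactly when the edge fits `p`.
  val : Pot → E → Carrier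
  val p e = p (src e) ∙ label e ∙ p (tgt e) ⁻¹

  Same : E → E → Set
  Same x y = src x ≡ src y × tgt x ≡ tgt y

  Same? : ∀ x y → Dec (Same x y)
  Same? x y = src x Fin.≟ src y ×-dec tgt x Fin.≟ tgt y

  -- Two edges in different parallel classes form a path with middle vertex c.
  record Wedge (x y : E) : Set where
    field
      c a b : Fin 3
      xj : Joins x c a
      yj : Joins y c b
      c≢a : c ≢ a
      c≢b : c ≢ b
      a≢b : a ≢ b
      cover : ∀ v → v ≡ c ⊎ v ≡ a ⊎ v ≡ b

  private
    pattern 0F = fzero
    pattern 1F = fsuc fzero
    pattern 2F = fsuc (fsuc fzero)

  data Class : E → Set where
    c₀₁ : ∀ {g} → Class (edge 0F 1F z<s g)
    c₀₂ : ∀ {g} → Class (edge 0F 2F z<s g)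
    c₁₂ : ∀ {g} → Class (edge 1F 2F (s<s z<s) g)

  classOf : ∀ e → Class e
  classOf (edge 0F 1F _ g) = c₀₁
  classOf (edge 0F 2F _ g) = c₀₂
  classOf (edge 1F 2F _ g) = c₁₂
  classOf (edge 0F 0F () g)
  classOf (edge (fsuc _) 0F () g)
  classOf e@(edge 1F 1F _ g) = contradiction refl (src≢tgt e)
  classOf e@(edge 2F 2F _ g) = contradiction refl (src≢tgt e)
  classOf e@(edge 2F 1F _ g) = contradiction (src<tgt e) λ { (s≤s ()) }

  wedge : ∀ x y → ¬ Same x y → Wedge x y
  wedge x y n = go (classOf x) (classOf y) n
    where
    go : ∀ {x y} → Class x → Class y → ¬ Same x y → Wedge x y
    go c₀₁ c₀₁ n = contradiction (refl , refl) n
    go c₀₂ c₀₂ n = contradiction (refl , refl) n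
    go c₁₂ c₁₂ n = contradiction (refl , refl) n
    go c₀₁ c₀₂ _ = record { c = 0F ; a = 1F ; b = 2F ; xj = inj₁ (refl , refl) ; yj = inj₁ (refl , refl) ; c≢a = λ () ; c≢b =
      λ () ; a≢b = λ ()
      ; cover = λ { 0F → inj₁ refl ; 1F → inj₂ (inj₁ refl) ; 2F → inj₂ (inj₂ refl) } }
    go c₀₂ c₀₁ _ = record { c = 0F ; a = 2F ; b = 1F ; xj = inj₁ (refl , refl) ; yj = inj₁ (refl , refl) ; c≢a = λ () ; c≢b =
      λ () ; a≢b = λ ()
      ; cover = λ { 0F → inj₁ refl ; 2F → inj₂ (inj₁ refl) ; 1F → inj₂ (inj₂ refl) } }
    go c₀₁ c₁₂ _ = record { c = 1F ; a = 0F ; b = 2F ; xj = inj₂ (refl , refl) ; yj = inj₁ (refl , refl) ; c≢a = λ () ; c≢b =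
      λ () ; a≢b = λ ()
      ; cover = λ { 1F → inj₁ refl ; 0F → inj₂ (inj₁ refl) ; 2F → inj₂ (inj₂ refl) } }
    go c₁₂ c₀₁ _ = record { c = 1F ; a = 2F ; b = 0F ; xj = inj₁ (refl , refl) ; yj = inj₂ (refl , refl) ; c≢a = λ () ; c≢b =
      λ () ; a≢b = λ ()
      ; cover = λ { 1F → inj₁ refl ; 2F → inj₂ (inj₁ refl) ; 0F → inj₂ (inj₂ refl) } }
    go c₀₂ c₁₂ _ = record { c = 2F ; a = 0F ; b = 1F ; xj = inj₂ (refl , refl) ; yj = inj₂ (refl , refl) ; c≢a = λ () ; c≢b =
      λ () ; a≢b = λ ()
      ; cover = λ { 2F → inj₁ refl ; 0F → inj₂ (inj₁ refl) ; 1F → inj₂ (inj₂ refl) } }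
    go c₁₂ c₀₂ _ = record { c = 2F ; a = 1F ; b = 0F ; xj = inj₂ (refl , refl) ; yj = inj₂ (refl , refl) ; c≢a = λ () ; c≢b =
      λ () ; a≢b = λ ()
      ; cover = λ { 2F → inj₁ refl ; 1F → inj₂ (inj₁ refl) ; 0F → inj₂ (inj₂ refl) } }

  fits⇒val : ∀ p e → Fits p e → val p e ≡ ε
  fits⇒val p e f = trans (cong (_// p (tgt e)) (trans (cong (p (src e) ∙_) f) (x∙x⁻¹y _ _))) (inverseʳ _)

  val⇒fits : ∀ p e → val p e ≡ ε → Fits p e
  val⇒fits p e q = trans (sym (x⁻¹∙xy (p (src e)) (label e))) (cong (p (src e) ⁻¹ ∙_) (xy⁻¹≡ε⇒x≡y q))

  val-cong : ∀ {p q} → (∀ v → p v ≡ q v) → ∀ e → val p e ≡ val q e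
  val-cong pq e = cong₂ (λ x y → x ∙ label e ∙ y ⁻¹) (pq (src e)) (pq (tgt e))

  same-val-ε : ∀ p {x y} → Same x y → val p x ≡ ε → val p y ≡ ε → x ≡ y
  same-val-ε p {x} {y} (s , t) vx vy = edge-ext s t (trans (val⇒fits p x vx)
    (trans (cong₂ (λ a b → p a ⁻¹ ∙ p b) s t) (sym (val⇒fits p y vy))))

  val-change : ∀ p q e → val q e ≡ (q (src e) // p (src e)) ∙ val p e ∙ (q (tgt e) // p (tgt e)) ⁻¹
  val-change p q e = sym (begin
    (qs // ps) ∙ (ps ∙ g ∙ pt ⁻¹) ∙ (qt // pt) ⁻¹     ≡⟨ cong₂ _∙_
      (trans (cong ((qs // ps) ∙_) (assoc ps g _)) (cancelᵐ′ qs ps _))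
      (trans (⁻¹-anti-homo-∙ qt _) (cong (_∙ qt ⁻¹) (⁻¹-involutive pt))) ⟩
    qs ∙ (g ∙ pt ⁻¹) ∙ (pt ∙ qt ⁻¹)                    ≡⟨ cong (_∙ (pt ∙ qt ⁻¹)) (assoc qs g _) ⟨
    qs ∙ g ∙ pt ⁻¹ ∙ (pt ∙ qt ⁻¹)                      ≡⟨ cancelᵐ′ (qs ∙ g) pt _ ⟩
    qs ∙ g ∙ qt ⁻¹                                     ∎)
    where
    open ≡-Reasoning
    g = label e
    ps = p (src e) ; pt = p (tgt e) ; qs = q (src e) ; qt = q (tgt e)

  -- Changing the potential by factors from the block of `a` preserves the plane it describes, so
  -- potentials can be normalised at chosen edges.
  H-renormalize : ∀ {a p q} → (∀ v → H a (q v // p v)) → ∀ e → H a (val p e) → H a (val q e)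
  H-renormalize {a} {p} {q} h e v = subst (H a) (sym (val-change p q e)) (∋∙ (∋∙ (h _) v) (∋⁻¹ (h _)))

  H-renormalize⁻ : ∀ {a p q} → (∀ v → H a (q v // p v)) → ∀ e → H a (val q e) → H a (val p e)
  H-renormalize⁻ {a} {p} {q} h = H-renormalize {a} {q} {p}
    (λ v → subst (H a) (trans (⁻¹-anti-homo-∙ (q v) _) (cong (_∙ q v ⁻¹) (⁻¹-involutive (p v)))) (∋⁻¹ (h v)))

  val-difference : ∀ p {x y} → Same x y → val p x // val p y ≡ cj (p (src x)) (label x // label y)
  val-difference p {x} {y} (s , t) = begin
    ps ∙ label x ∙ pt ⁻¹ ∙ (p (src y) ∙ label y ∙ p (tgt y) ⁻¹) ⁻¹  ≡⟨ cong₂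
      (λ a b → ps ∙ label x ∙ pt ⁻¹ ∙ (p a ∙ label y ∙ p b ⁻¹) ⁻¹) s t ⟨
    ps ∙ label x ∙ pt ⁻¹ ∙ (ps ∙ label y ∙ pt ⁻¹) ⁻¹                ≡⟨ cong (ps ∙ label x ∙ pt ⁻¹ ∙_)
      (trans (⁻¹-anti-homo-∙ _ _) (cong₂ _∙_ (⁻¹-involutive pt) (⁻¹-anti-homo-∙ ps (label y)))) ⟩
    ps ∙ label x ∙ pt ⁻¹ ∙ (pt ∙ (label y ⁻¹ ∙ ps ⁻¹))              ≡⟨ cancelᵐ′ (ps ∙ label x) pt _ ⟩
    ps ∙ label x ∙ (label y ⁻¹ ∙ ps ⁻¹)                             ≡⟨ assoc _ _ _ ⟨
    ps ∙ label x ∙ label y ⁻¹ ∙ ps ⁻¹                               ≡⟨ cong (_∙ ps ⁻¹) (assoc ps _ _) ⟩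
    ps ∙ (label x // label y) ∙ ps ⁻¹                               ∎
    where
    open ≡-Reasoning
    ps = p (src x) ; pt = p (tgt x)

  -- Two nonparallel edges form a spanning tree of the triangle, so a potential that both fit is
  -- determined up to a constant left factor.
  common-shift : ∀ {x y} → ¬ Same x y → ∀ {p q} → val p x ≡ ε → val q x ≡ ε → val p y ≡ ε → val q y ≡ ε →
    ∀ v → p v ≡ (p fzero // q fzero) ∙ q v
  common-shift {x} {y} n {p} {q} px qx py qy v = trans (sym (xy⁻¹∙y (p v) (q v)))
    (cong (_∙ q v) (trans (constant v) (sym (constant fzero))))
    where
    open Wedge (wedge x y n)
    d : Fin 3 → Carrier
    d v = p v // q v
    edge-d : ∀ e → val p e ≡ ε → val q e ≡ ε → d (src e) ≡ d (tgt e)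
    edge-d e f g = xy⁻¹≡ε⇒x≡y (trans (cong (_// d (tgt e)) (sym (trans (cong (d (src e) ∙_) g) (identityʳ _))))
      (trans (sym (val-change q p e)) f))
    joined-d : ∀ {e u w} → Joins e u w → val p e ≡ ε → val q e ≡ ε → d u ≡ d w
    joined-d {e} (inj₁ (refl , refl)) f g = edge-d e f g
    joined-d {e} (inj₂ (refl , refl)) f g = sym (edge-d e f g)
    constant : ∀ v → d v ≡ d c
    constant v with cover v
    ... | inj₁ refl = refl
    ... | inj₂ (inj₁ refl) = sym (joined-d {x} xj px qx)
    ... | inj₂ (inj₂ refl) = sym (joined-d {y} yj py qy)

  val-shift : ∀ {p q k} → (∀ v → p v ≡ k ∙ q v) → ∀ e → val p e ≡ cj k (val q e)
  val-shift {p} {q} {k} pq e = begin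
    p (src e) ∙ label e ∙ p (tgt e) ⁻¹                       ≡⟨ cong₂ (λ a b → a ∙ label e ∙ b ⁻¹) (pq _) (pq _) ⟩
    k ∙ q (src e) ∙ label e ∙ (k ∙ q (tgt e)) ⁻¹             ≡⟨ cong₂ _∙_ (assoc k _ _) (⁻¹-anti-homo-∙ k _) ⟩
    k ∙ (q (src e) ∙ label e) ∙ (q (tgt e) ⁻¹ ∙ k ⁻¹)        ≡⟨ assoc _ _ _ ⟨
    k ∙ (q (src e) ∙ label e) ∙ q (tgt e) ⁻¹ ∙ k ⁻¹          ≡⟨ cong (_∙ k ⁻¹) (assoc k _ _) ⟩
    k ∙ val q e ∙ k ⁻¹                                       ∎
    where open ≡-Reasoning

  update : Fin 3 → Carrier → Pot → Pot
  update a x p v = if does (v Fin.≟ a) then x else p v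

  update-at : ∀ a x p → update a x p a ≡ x
  update-at a x p = cong (if_then x else p a) (dec-true (a Fin.≟ a) refl)

  update-off : ∀ {a v} x p → v ≢ a → update a x p v ≡ p v
  update-off {a} {v} x p n = cong (if_then x else p v) (dec-false (v Fin.≟ a) n)

  balance-edge : ∀ q e {u w} → Joins e u w → q w ≡ q u ∙ travLabel e u → val q e ≡ ε
  balance-edge q e {u} {w} j r = fits⇒val q e (travLabel⇒fits q e j (sym (trans (cong (q u ⁻¹ ∙_) r) (x⁻¹∙xy _ _))))

  H-travLabel : ∀ {a} p e {u w} → Joins e u w → H a (val p e) → H a (p u ∙ travLabel e u // p w)
  H-travLabel {a} p e (inj₁ (refl , refl)) h = subst (λ g → H a (p (src e) ∙ g // p (tgt e))) (sym (travLabel-src e refl)) h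
  H-travLabel {a} p e (inj₂ (refl , refl)) h = subst (H a) (begin
    (p (src e) ∙ label e ∙ p (tgt e) ⁻¹) ⁻¹          ≡⟨ trans (⁻¹-anti-homo-∙ _ _)
      (cong₂ _∙_ (⁻¹-involutive _) (⁻¹-anti-homo-∙ _ _)) ⟩
    p (tgt e) ∙ (label e ⁻¹ ∙ p (src e) ⁻¹)          ≡⟨ assoc _ _ _ ⟨
    p (tgt e) ∙ label e ⁻¹ ∙ p (src e) ⁻¹            ≡⟨ cong (λ g → p (tgt e) ∙ g // p (src e)) (travLabel-tgt e refl) ⟨
    p (tgt e) ∙ travLabel e (tgt e) // p (src e)     ∎) (∋⁻¹ h)
    where open ≡-Reasoning

  -- Keep the potential at the middle vertex of the path formed by `x` and `y` and propagate it
  -- along the two edges. The other two values change only by factors from the block, because both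
  -- edges lie in the plane.
  renormalize : ∀ {x y} → ¬ Same x y → ∀ {a p} → H a (val p x) → H a (val p y) →
    ∃[ q ] (val q x ≡ ε × val q y ≡ ε × ∀ v → H a (q v // p v))
  renormalize {x} {y} n {g} {p} hx hy = q , balance-edge q x xj (trans qa (cong (_∙ travLabel x c) (sym qc))) ,
    balance-edge q y yj (trans qb (cong (_∙ travLabel y c) (sym qc))) , close
    where
    open Wedge (wedge x y n)
    q : Pot
    q = update a (p c ∙ travLabel x c) (update b (p c ∙ travLabel y c) p)
    qa : q a ≡ p c ∙ travLabel x c
    qa = update-at a _ (update b (p c ∙ travLabel y c) p)
    qb : q b ≡ p c ∙ travLabel y c
    qb = trans (update-off _ (update b (p c ∙ travLabel y c) p) (a≢b ∘ sym)) (update-at b _ p)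
    qc : q c ≡ p c
    qc = trans (update-off _ (update b (p c ∙ travLabel y c) p) c≢a) (update-off _ p c≢b)
    close : ∀ v → H g (q v // p v)
    close v with cover v
    ... | inj₁ refl = subst (H g) (sym (trans (cong (_// p c) qc) (inverseʳ _))) (∋ε g)
    ... | inj₂ (inj₁ refl) = subst (λ z → H g (z // p a)) (sym qa) (H-travLabel p x xj hx)
    ... | inj₂ (inj₂ refl) = subst (λ z → H g (z // p b)) (sym qb) (H-travLabel p y yj hy)

  -- Normalise both planes so that `x` and `y` get value ε. The potentials then differ by a
  -- constant, whose conjugation permutes the blocks. The value of `z` is not ε, as the three points
  -- would otherwise be collinear, so it determines the block.
  block-determined : ∀ {x y z w p q a b} → ¬ Same x y → ¬ (∃[ r ] (val r x ≡ ε × val r y ≡ ε × val r z ≡ ε)) →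
    H a (val p x) → H a (val p y) → H a (val p z) → H b (val q x) → H b (val q y) → H b (val q z) → H b (val q w) → H a
      (val p w)
  block-determined {x} {y} {z} {w} {p} {q} {a} {b} n nc px py pz qx qy qz qw with renormalize {x} {y} n {a} {p} px py |
    renormalize {x} {y} n {b} {q} qx qy
  ... | p′ , p′x , p′y , hp | q′ , q′x , q′y , hq = H-renormalize⁻ {a} {p} {p′} hp w
    (transitive a (val p′ z) _ (H-renormalize {a} {p} {p′} hp z pz)
          (subst₂ H (sym (val-shift {p′} {q′} shift z)) (sym (val-shift {p′} {q′} shift w))
            (Block-conj part (p′ fzero // q′ fzero) same)))
    where
    shift : ∀ v → p′ v ≡ (p′ fzero // q′ fzero) ∙ q′ v
    shift = common-shift {x} {y} n {p′} {q′} p′x q′x p′y q′y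
    same : H (val q′ z) (val q′ w)
    same = transitive _ _ _ (symmetric _ _ (H-renormalize {b} {q} {q′} hq z qz) (λ e → nc (q′ , q′x , q′y , e)))
      (H-renormalize {b} {q} {q′} hq w qw)

  Point : Set
  Point = E ⊎ Fin 2

  -- A coset line is described by a potential and a block, so that it is literally the part of a
  -- `block` plane inside one parallel class.
  data Line : Set where
    balanced : Pot → Line
    coset : Fin 3 → Fin 3 → Pot → Carrier → Line

  -- block p a consists of the edges whose label, after switching by the potential p, lies in the block of a.
  -- The two points of F are placed freely on the line in which all planes parallel s t meet.
  data Plane : Set where
    block : Pot → Carrier → Plane
    parallel : Fin 3 → Fin 3 → Plane
    spike : Pot → Fin 2 → Plane

  infix 4 _∈ˡ_ _∈ᵖ_
  _∈ˡ_ : Point → Line → Set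
  inj₁ e ∈ˡ balanced p = val p e ≡ ε
  inj₁ e ∈ˡ coset s t p a = (src e ≡ s × tgt e ≡ t) × H a (val p e)
  inj₂ _ ∈ˡ _ = ⊥

  _∈ᵖ_ : Point → Plane → Set
  inj₁ e ∈ᵖ block p a = H a (val p e)
  inj₁ e ∈ᵖ parallel s t = src e ≡ s × tgt e ≡ t
  inj₁ e ∈ᵖ spike p _ = val p e ≡ ε
  inj₂ _ ∈ᵖ block _ _ = ⊥
  inj₂ _ ∈ᵖ parallel _ _ = ⊤
  inj₂ j ∈ᵖ spike _ i = j ≡ i

  H? : ∀ a g → Dec (H a g)
  H? = Block? part

  ∈ˡ? : ∀ x l → Dec (x ∈ˡ l)
  ∈ˡ? (inj₁ e) (balanced p) = val p e ≟ ε
  ∈ˡ? (inj₁ e) (coset s t p a) = (src e Fin.≟ s ×-dec tgt e Fin.≟ t) ×-dec H? a (val p e)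
  ∈ˡ? (inj₂ _) (balanced _) = no id
  ∈ˡ? (inj₂ _) (coset _ _ _ _) = no id

  ∈ᵖ? : ∀ x π → Dec (x ∈ᵖ π)
  ∈ᵖ? (inj₁ e) (block p a) = H? a (val p e)
  ∈ᵖ? (inj₁ e) (parallel s t) = src e Fin.≟ s ×-dec tgt e Fin.≟ t
  ∈ᵖ? (inj₁ e) (spike p _) = val p e ≟ ε
  ∈ᵖ? (inj₂ _) (block _ _) = no id
  ∈ᵖ? (inj₂ _) (parallel _ _) = yes tt
  ∈ᵖ? (inj₂ j) (spike _ i) = j Fin.≟ i

  lookup-tabulate : ∀ (p : Pot) v → lookup (tabulate p) v ≡ p v
  lookup-tabulate = Vec.lookup∘tabulate

  -- A potential is searched as the vector of its values, which gives it back only up to pointwise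
  -- equality; the two congruence hypotheses absorb the difference.
  ∃-line? : {Q : Line → Set} → (∀ l → Dec (Q l)) → (∀ {p q} → (∀ v → q v ≡ p v) → Q (balanced p) → Q (balanced q)) →
    (∀ {s t p q a} → (∀ v → q v ≡ p v) → Q (coset s t p a) → Q (coset s t q a)) → Dec (∃ Q)
  ∃-line? Q? rb rc = map′
    (λ { (inj₁ (v , q)) → balanced (lookup v) , q ; (inj₂ (((s , t) , v , a) , q)) → coset s t (lookup v) a , q })
    (λ { (balanced p , q) → inj₁ (tabulate p , rb (lookup-tabulate p) q) ; (coset s t p a , q) → inj₂
      (((s , t) , tabulate p , a) , rc (lookup-tabulate p) q) })
    (∃-dec (enum-Vec′ 3) (λ v → Q? (balanced (lookup v))) ⊎-dec
     ∃-dec (enum-× (enum-× (enum-Fin 3) (enum-Fin 3)) (enum-× (enum-Vec′ 3) enum))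
       (λ ((s , t) , v , a) → Q? (coset s t (lookup v) a)))
    where
    enum-Vec′ : ∀ n → Enum (Vec Carrier n)
    enum-Vec′ = enum-Vec enum

  ∃-plane? : {Q : Plane → Set} → (∀ π → Dec (Q π)) → (∀ {p q a} → (∀ v → q v ≡ p v) → Q (block p a) → Q (block q a)) →
    (∀ {p q i} → (∀ v → q v ≡ p v) → Q (spike p i) → Q (spike q i)) → Dec (∃ Q)
  ∃-plane? Q? rb rs = map′
    (λ { (inj₁ ((v , a) , q)) → block (lookup v) a , q ; (inj₂ (inj₁ ((s , t) , q))) → parallel s t , q ;
      (inj₂ (inj₂ ((v , i) , q))) → spike (lookup v) i , q })
    (λ { (block p a , q) → inj₁ ((tabulate p , a) , rb (lookup-tabulate p) q) ; (parallel s t , q) → inj₂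
      (inj₁ ((s , t) , q))
       ; (spike p i , q) → inj₂ (inj₂ ((tabulate p , i) , rs (lookup-tabulate p) q)) })
    (∃-dec (enum-× (enum-Vec enum 3) enum) (λ (v , a) → Q? (block (lookup v) a)) ⊎-dec
     ∃-dec (enum-× (enum-Fin 3) (enum-Fin 3)) (λ (s , t) → Q? (parallel s t)) ⊎-dec
     ∃-dec (enum-× (enum-Vec enum 3) (enum-Fin 2)) (λ (v , i) → Q? (spike (lookup v) i)))

  balanced-cong : ∀ {p q} → (∀ v → q v ≡ p v) → ∀ {x} → x ∈ˡ balanced p → x ∈ˡ balanced q
  balanced-cong pq {inj₁ e} m = trans (val-cong pq e) m

  coset-cong : ∀ {s t p q a} → (∀ v → q v ≡ p v) → ∀ {x} → x ∈ˡ coset s t p a → x ∈ˡ coset s t q a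
  coset-cong {a = a} pq {inj₁ e} (m , h) = m , subst (H a) (sym (val-cong pq e)) h

  block-cong : ∀ {p q a} → (∀ v → q v ≡ p v) → ∀ {x} → x ∈ᵖ block p a → x ∈ᵖ block q a
  block-cong {a = a} pq {inj₁ e} h = subst (H a) (sym (val-cong pq e)) h

  spike-cong : ∀ {p q i} → (∀ v → q v ≡ p v) → ∀ {x} → x ∈ᵖ spike p i → x ∈ᵖ spike q i
  spike-cong pq {inj₁ e} m = trans (val-cong pq e) m
  spike-cong pq {inj₂ j} m = m

  Collinear : Point → Point → Point → Set
  Collinear x y z = ∃[ l ] (x ∈ˡ l × y ∈ˡ l × z ∈ˡ l)

  collinear? : ∀ x y z → Dec (Collinear x y z)
  collinear? x y z = ∃-line? (λ l → ∈ˡ? x l ×-dec ∈ˡ? y l ×-dec ∈ˡ? z l)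
    (λ pq (a , b , c) → balanced-cong pq {x} a , balanced-cong pq {y} b , balanced-cong pq {z} c)
    (λ pq (a , b , c) → coset-cong pq {x} a , coset-cong pq {y} b , coset-cong pq {z} c)

  coplanar? : ∀ x y z w → Dec (∃[ π ] (x ∈ᵖ π × y ∈ᵖ π × z ∈ᵖ π × w ∈ᵖ π))
  coplanar? x y z w = ∃-plane? (λ π → ∈ᵖ? x π ×-dec ∈ᵖ? y π ×-dec ∈ᵖ? z π ×-dec ∈ᵖ? w π)
    (λ pq (a , b , c , d) → block-cong pq {x} a , block-cong pq {y} b , block-cong pq {z} c , block-cong pq {w} d)
    (λ pq (a , b , c , d) → spike-cong pq {x} a , spike-cong pq {y} b , spike-cong pq {z} c , spike-cong pq {w} d)

  same-class : ∀ {x y s t} → src x ≡ s × tgt x ≡ t → src y ≡ s × tgt y ≡ t → Same x y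
  same-class (refl , refl) (p , q) = sym p , sym q

  balanced-unique : ∀ {x y p q} → x ≢ y → val p x ≡ ε → val p y ≡ ε → val q x ≡ ε → val q y ≡ ε → ∀ z → val q z ≡ ε →
    val p z ≡ ε
  balanced-unique {x} {y} {p} {q} x≢y px py qx qy z qz = trans
    (val-shift {p} {q} (common-shift {x} {y} n {p} {q} px qx py qy) z)
    (trans (cong (cj (p fzero // q fzero)) qz) (conj-ε part _))
    where
    n : ¬ Same x y
    n s = x≢y (same-val-ε p s px py)

  line-unique : ∀ {x y z} l l′ → x ≢ y → x ∈ˡ l → y ∈ˡ l → x ∈ˡ l′ → y ∈ˡ l′ → z ∈ˡ l′ → z ∈ˡ l
  line-unique {inj₁ x} {inj₁ y} {inj₁ z} (balanced p) (balanced q) x≢y px py qx qy qz = balanced-unique {x} {y} {p} {q}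
    (x≢y ∘ cong inj₁) px py qx qy z qz
  line-unique {inj₁ x} {inj₁ y} {inj₁ z} (balanced p) (coset _ _ _ _) x≢y px py (cx , _) (cy , _) _ =
    contradiction (cong inj₁ (same-val-ε p (same-class {x} {y} cx cy) px py)) x≢y
  line-unique {inj₁ x} {inj₁ y} {inj₁ z} (coset _ _ _ _) (balanced p) x≢y (cx , _) (cy , _) px py _ =
    contradiction (cong inj₁ (same-val-ε p (same-class {x} {y} cx cy) px py)) x≢y
  line-unique {inj₁ x} {inj₁ y} {inj₁ z} (coset s t p a) (coset _ _ q b) x≢y (cx@(refl , refl) , px) (cy , py)
    (cx′@(refl , refl) , qx) (cy′ , qy) (cz , qz) =
    cz , subst (H a) (xy⁻¹∙y _ _) (∋∙ (transitive a (cj k rxy) _ inA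
      (subst (H (cj k rxy)) (sym (val-difference p {z} {y} zy)) zInA)) py)
    where
    xy = same-class {x} {y} cx cy
    zy = same-class {z} {y} cz cy
    k = p (src x)
    l = q (src x)
    rxy = label x // label y
    rzy = label z // label y
    inA : H a (cj k rxy)
    inA = subst (H a) (val-difference p {x} {y} xy) (∋∙ px (∋⁻¹ py))
    inB : H b (cj l rxy)
    inB = subst (H b) (val-difference q {x} {y} xy) (∋∙ qx (∋⁻¹ qy))
    zInB : H b (cj l rzy)
    zInB = subst (λ v → H b (cj (q v) rzy)) (proj₁ cz) (subst (H b) (val-difference q {z} {y} zy) (∋∙ qz (∋⁻¹ qy)))
    -- Both cosets are compared through label quotients relative to `y`, conjugated by `k` in one
    -- and by `l` in the other; conjugation by `k // l` mediates. The quotient for `x` is not ε,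
    -- since `x` and `y` differ, and hence fixes the block.
    move : ∀ g → cj (k // l) (cj l g) ≡ cj k g
    move g = trans (conj-conj part (k // l) l g) (cong (λ h → cj h g) (xy⁻¹∙y k l))
    zInA : H (cj k rxy) (cj (p (src z)) rzy)
    zInA = subst (λ v → H (cj k rxy) (cj (p v) rzy)) (sym (proj₁ cz))
      (subst₂ H (move rxy) (move rzy) (Block-conj part (k // l) (transitive _ b _ (symmetric _ _ inB
      (λ e → x≢y (cong inj₁ (edge-ext (proj₁ xy) (proj₂ xy) (xy⁻¹≡ε⇒x≡y (conj≡ε part e)))))) zInB)))

  two-of-three : ∀ {x y z : Fin 2} → x ≢ y → x ≢ z → y ≢ z → ⊥
  two-of-three {0F} {0F} p _ _ = p refl
  two-of-three {1F} {1F} p _ _ = p refl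
  two-of-three {0F} {1F} {0F} _ p _ = p refl
  two-of-three {0F} {1F} {1F} _ _ p = p refl
  two-of-three {1F} {0F} {0F} _ _ p = p refl
  two-of-three {1F} {0F} {1F} _ p _ = p refl

  -- A parallel class has at most one edge fitting `p`, and a `spike` plane has one point of F, so
  -- the two planes share at most two points.
  parallel-spike : ∀ {x y z s t p i} → x ≢ y → x ≢ z → y ≢ z → x ∈ᵖ parallel s t → y ∈ᵖ parallel s t → z ∈ᵖ parallel s t →
    x ∈ᵖ spike p i → y ∈ᵖ spike p i → z ∈ᵖ spike p i → ⊥
  parallel-spike {inj₁ x} {inj₁ y} {_} {p = p} n _ _ cx cy _ px py _ = n
    (cong inj₁ (same-val-ε p (same-class {x} {y} cx cy) px py))
  parallel-spike {inj₁ x} {_} {inj₁ z} {p = p} _ n _ cx _ cz px _ pz = n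
    (cong inj₁ (same-val-ε p (same-class {x} {z} cx cz) px pz))
  parallel-spike {_} {inj₁ y} {inj₁ z} {p = p} _ _ n _ cy cz _ py pz = n
    (cong inj₁ (same-val-ε p (same-class {y} {z} cy cz) py pz))
  parallel-spike {inj₂ _} {inj₂ _} n _ _ _ _ _ refl refl _ = n refl
  parallel-spike {inj₂ _} {_} {inj₂ _} _ n _ _ _ _ refl _ refl = n refl
  parallel-spike {_} {inj₂ _} {inj₂ _} _ _ n _ _ _ _ refl refl = n refl

  spike-unique : ∀ {x y p q i j} → x ≢ y → val p x ≡ ε → val p y ≡ ε → val q x ≡ ε → val q y ≡ ε → j ≡ i → ∀ w →
    w ∈ᵖ spike q j → w ∈ᵖ spike p i
  spike-unique {x} {y} {p} {q} n px py qx qy refl (inj₁ w) qw = balanced-unique {x} {y} {p} {q} n px py qx qy w qw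
  spike-unique n px py qx qy refl (inj₂ _) qw = qw

  -- Planes of different kinds meet inside a listed line or in at most two points, so three
  -- noncollinear points force the same kind. Two `block` planes are compared by `block-determined`,
  -- two `parallel` ones by any edge among the points, and two `spike` ones by two edges and a point
  -- of F.
  plane-unique : ∀ {x y z w} π π′ → x ≢ y → x ≢ z → y ≢ z → ¬ Collinear x y z →
    x ∈ᵖ π → y ∈ᵖ π → z ∈ᵖ π → x ∈ᵖ π′ → y ∈ᵖ π′ → z ∈ᵖ π′ → w ∈ᵖ π′ → w ∈ᵖ π
  plane-unique {inj₁ x} {inj₁ y} {inj₁ z} {inj₁ w} (block p a)
    (block q b) _ _ _ nc px py pz qx qy qz qw with Same? x y | Same? x z
  ... | no n | _ = block-determined {x} {y} {z} {w} {p} {q} n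
    (λ (r , rx , ry , rz) → nc (balanced r , rx , ry , rz)) px py pz qx qy qz qw
  ... | yes _ | no n = block-determined {x} {z} {y} {w} {p} {q} n
    (λ (r , rx , rz , ry) → nc (balanced r , rx , ry , rz)) px pz py qx qz qy qw
  ... | yes (s , t) | yes (s′ , t′) = contradiction
    (coset (src x) (tgt x) p a , ((refl , refl) , px) , ((sym s , sym t) , py) , ((sym s′ , sym t′) , pz)) nc
  plane-unique {inj₁ x} {inj₁ y} {inj₁ z} (block p a) (parallel s t) _ _ _ nc px py pz cx cy cz _ =
    contradiction (coset s t p a , (cx , px) , (cy , py) , (cz , pz)) nc
  plane-unique {inj₁ x} {inj₁ y} {inj₁ z} (parallel s t) (block p a) _ _ _ nc cx cy cz px py pz _ =
    contradiction (coset s t p a , (cx , px) , (cy , py) , (cz , pz)) nc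
  plane-unique {inj₁ x} {inj₁ y} {inj₁ z} (block _ _) (spike p _) _ _ _ nc _ _ _ px py pz _ = contradiction
    (balanced p , px , py , pz) nc
  plane-unique {inj₁ x} {inj₁ y} {inj₁ z} (spike p _) (block _ _) _ _ _ nc px py pz _ _ _ _ = contradiction
    (balanced p , px , py , pz) nc
  plane-unique {inj₁ x} {w = w} (parallel s t) (parallel s′ t′) _ _ _ _ (refl , refl) _ _ (refl , refl) _ _ qw = qw
  plane-unique {_} {inj₁ y} {w = w} (parallel s t) (parallel s′ t′) _ _ _ _ _ (refl , refl) _ _ (refl , refl) _ qw = qw
  plane-unique {_} {_} {inj₁ z} {w = w} (parallel s t) (parallel s′ t′) _ _ _ _ _ _ (refl , refl) _ _ (refl , refl) qw = qw
  plane-unique {inj₂ _} {inj₂ _} {inj₂ _} (parallel _ _) (parallel _ _) x≢y x≢z y≢z _ _ _ _ _ _ _ _ =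
    ⊥-elim (two-of-three (x≢y ∘ cong inj₂) (x≢z ∘ cong inj₂) (y≢z ∘ cong inj₂))
  plane-unique {x} {y} {z} (parallel s t) (spike p i) x≢y x≢z y≢z _ cx cy cz px py pz _ =
    ⊥-elim (parallel-spike {x} {y} {z} x≢y x≢z y≢z cx cy cz px py pz)
  plane-unique {x} {y} {z} (spike p i) (parallel s t) x≢y x≢z y≢z _ px py pz cx cy cz _ =
    ⊥-elim (parallel-spike {x} {y} {z} x≢y x≢z y≢z cx cy cz px py pz)
  plane-unique {inj₁ x} {inj₁ y} {inj₁ z} (spike p _) (spike _ _) _ _ _ nc px py pz _ _ _ _ = contradiction
    (balanced p , px , py , pz) nc
  plane-unique {inj₁ x} {inj₁ y} {inj₂ _} {w} (spike p _) (spike q _) n _ _ _ px py refl qx qy e qw =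
    spike-unique {x} {y} {p} {q} (n ∘ cong inj₁) px py qx qy (sym e) w qw
  plane-unique {inj₁ x} {inj₂ _} {inj₁ z} {w} (spike p _) (spike q _) _ n _ _ px refl pz qx e qz qw =
    spike-unique {x} {z} {p} {q} (n ∘ cong inj₁) px pz qx qz (sym e) w qw
  plane-unique {inj₂ _} {inj₁ y} {inj₁ z} {w} (spike p _) (spike q _) _ _ n _ refl py pz e qy qz qw =
    spike-unique {y} {z} {p} {q} (n ∘ cong inj₁) py pz qy qz (sym e) w qw
  plane-unique {inj₂ _} {inj₂ _} (spike _ _) (spike _ _) n _ _ _ refl refl _ _ _ _ _ = contradiction refl n
  plane-unique {inj₂ _} {_} {inj₂ _} (spike _ _) (spike _ _) _ n _ _ refl _ refl _ _ _ _ = contradiction refl n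
  plane-unique {_} {inj₂ _} {inj₂ _} (spike _ _) (spike _ _) _ _ n _ _ refl refl _ _ _ _ = contradiction refl n

  line-point : ∀ {x} l w → x ∈ˡ l → ∃[ π ] ((∀ y → y ∈ˡ l → y ∈ᵖ π) × w ∈ᵖ π)
  line-point (balanced p) (inj₁ w) _ = block p (val p w) , (λ { (inj₁ y) m → subst (H _) (sym m) (∋ε _) }) , ∋self _
  line-point (balanced p) (inj₂ i) _ = spike p i , (λ { (inj₁ y) m → m }) , refl
  line-point (coset s t p a) (inj₂ i) _ = parallel s t , (λ { (inj₁ y) (m , _) → m }) , tt
  line-point {inj₁ x} (coset s t p g) (inj₁ w) ((refl , refl) , _) with Same? x w
  ... | yes (s≡ , t≡) = parallel s t , (λ { (inj₁ y) (m , _) → m }) , sym s≡ , sym t≡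
  -- `b` is the end of `w` that is not an end of `x`. Changing the potential there makes `w` fit and
  -- leaves all values on the parallel class of `x` unchanged.
  ... | no n = block q g , (λ { (inj₁ y) (m , h) → subst (H g)
    (cong₂ (λ u v → u ∙ label y ∙ v ⁻¹) (trans (cong p (proj₁ m)) (trans (sym (proj₁ unchanged)) (cong q (sym (proj₁ m)))))
        (trans (cong p (proj₂ m)) (trans (sym (proj₂ unchanged)) (cong q (sym (proj₂ m)))))) h }) ,
        subst (H g) (sym (balance-edge q w yj (trans (update-at b _ p) (cong (_∙ travLabel w c) (sym qc))))) (∋ε g)
    where
    open Wedge (wedge x w n)
    q : Pot
    q = update b (p c ∙ travLabel w c) p
    qc : q c ≡ p c
    qc = update-off _ p c≢b
    qa : q _ ≡ p _
    qa = update-off _ p a≢b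
    unchanged : q (src x) ≡ p (src x) × q (tgt x) ≡ p (tgt x)
    unchanged = go xj
      where
      go : Joins x c _ → q (src x) ≡ p (src x) × q (tgt x) ≡ p (tgt x)
      go (inj₁ (e , f)) = trans (cong q e) (trans qc (cong p (sym e))) , trans (cong q f) (trans qa (cong p (sym f)))
      go (inj₂ (e , f)) = trans (cong q e) (trans qa (cong p (sym e))) , trans (cong q f) (trans qc (cong p (sym f)))

  geometry : LinesAndPlanes Point
  geometry = record
    { _≟_ = Sum.≡-dec _≟ᴱ_ Fin._≟_ ; Line = Line ; Plane = Plane ; _∈ˡ_ = _∈ˡ_ ; _∈ᵖ_ = _∈ᵖ_ ; ∈ˡ? = ∈ˡ? ; ∈ᵖ? = ∈ᵖ?
    ; collinear? = collinear? ; coplanar? = coplanar?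
    ; line-unique = λ {x} {y} {z} → line-unique {x} {y} {z}
    ; plane-unique = λ {x} {y} {z} {w} → plane-unique {x} {y} {z} {w}
    ; line-point = λ {x} → line-point {x} }

-- The rank-4 matroid as a lift in the class for n = 3

module TriangleLiftClass {Γ : FiniteGroup} (part : HasNontrivialPartition Γ) (nt : Nontrivial Γ) where
  open GroupFacts Γ
  open Graph 3 Γ
  open Star 2 Γ
  open Partitions Γ using (Block-isSpread; Block-conj; conj-id; conj-conj)
  open SpreadFacts (Block-isSpread part)
  open TriangleLift {Γ} part
  open LinesAndPlanes geometry using (IndepSet; Good; good⇒indepSet; rank4Matroid)

  private
    pattern 0F = fzero
    pattern 1F = fsuc fzero
    pattern 2F = fsuc (fsuc fzero)
    pattern 3F = fsuc (fsuc (fsuc fzero))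

  K : Matroid Point
  K = rank4Matroid

  lift : Matroid E
  lift = Deletion.deletion K

  small⇒good : ∀ {k} {f : Fin k → Point} → k ≤ 2 → Good k f
  small⇒good {0} _ = tt
  small⇒good {1} _ = tt
  small⇒good {2} _ = tt
  small⇒good {suc (suc (suc _))} (s≤s (s≤s ()))

  coded : ∀ {k b} {f : Fin k → Point} → Injective _≡_ _≡_ f → (c : Fin k → Fin b) → (∀ i j → c i ≡ c j → f i ≡ f j) → k ≤ b
  coded inj c c-inj = Fin.injective⇒≤ {f = c} (λ {i} {j} e → inj (c-inj i j e))

  same-joins : ∀ {e e′ u w} → Joins e u w → Joins e′ u w → Same e e′
  same-joins (inj₁ (p , q)) (inj₁ (p′ , q′)) = trans p (sym p′) , trans q (sym q′)
  same-joins (inj₂ (p , q)) (inj₂ (p′ , q′)) = trans p (sym p′) , trans q (sym q′)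
  same-joins {e} {e′} (inj₁ (refl , refl)) (inj₂ (p′ , q′)) = contradiction (subst₂ _<ᶠ_ p′ q′ (src<tgt e′))
    (Fin.<-asym (src<tgt e))
  same-joins {e} {e′} (inj₂ (refl , refl)) (inj₁ (p′ , q′)) = contradiction (subst₂ _<ᶠ_ p′ q′ (src<tgt e′))
    (Fin.<-asym (src<tgt e))

  joins-flip : ∀ {e : E} {u w} → Joins e u w → Joins e w u
  joins-flip (inj₁ p) = inj₂ p
  joins-flip (inj₂ p) = inj₁ p

  same-transfer : ∀ {e e′ u w} → Same e e′ → Joins e u w → Joins e′ u w
  same-transfer (s , t) (inj₁ (p , q)) = inj₁ (trans (sym s) p , trans (sym t) q)
  same-transfer (s , t) (inj₂ (p , q)) = inj₂ (trans (sym s) p , trans (sym t) q)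

  other-endpoint : ∀ {e u w z} → Joins e u w → Joins e w z → u ≡ z
  other-endpoint {e} (inj₁ (p , q)) (inj₁ (p′ , q′)) = contradiction (trans p′ (sym q)) (src≢tgt e)
  other-endpoint {e} (inj₂ (p , q)) (inj₂ (p′ , q′)) = contradiction (trans p (sym q′)) (src≢tgt e)
  other-endpoint (inj₁ (p , q)) (inj₂ (p′ , q′)) = trans (sym p) p′
  other-endpoint (inj₂ (p , q)) (inj₁ (p′ , q′)) = trans (sym q) q′

  cls : ∀ {e} → Class e → Fin 3
  cls c₀₁ = 0F
  cls c₀₂ = 1F
  cls c₁₂ = 2F

  cls-same : ∀ {x y} (c : Class x) (d : Class y) → cls c ≡ cls d → Same x y
  cls-same c₀₁ c₀₁ _ = refl , refl
  cls-same c₀₂ c₀₂ _ = refl , refl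
  cls-same c₁₂ c₁₂ _ = refl , refl

  graphic-parallel : ∀ {X x y} → GraphicIndep 3 Γ X → X x ≡ true → X y ≡ true → Same x y → x ≡ y
  graphic-parallel {X} {x} {y} gX Xx Xy (s , t) = decidable-stable (x ≟ᴱ y) λ n →
    gX (twoCycle x y n s t) (cycleSet (twoCycle x y n s t)) (cycleSet-isEdgeSet (twoCycle x y n s t))
      λ f m → case toSubset⁻ {f} (edges (twoCycle x y n s t)) m of λ { (here refl) → Xx ; (there (here refl)) → Xy }

  -- One edge from each of the three parallel classes would form a triangle. So an acyclic set has
  -- at most two edges, which the parallel classes encode in `Fin 2`.
  graphic-missing : ∀ {X} → GraphicIndep 3 Γ X → ∃[ κ ] (∀ e → X e ≡ true → κ ≢ cls (classOf e))
  graphic-missing {X} gX = go (present? 0F) (present? 1F) (present? 2F)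
    where
    Present : Fin 3 → Set
    Present κ = ∃[ e ] (X e ≡ true × κ ≡ cls (classOf e))
    present? : ∀ κ → Dec (Present κ)
    present? κ = ∃-dec enumᴱ (λ e → X e Bool.≟ true ×-dec κ Fin.≟ cls (classOf e))
    full : ∀ {x y z} (c : Class x) (d : Class y) (b : Class z) → 0F ≡ cls c → 1F ≡ cls d → 2F ≡ cls b → X x ≡ true →
      X y ≡ true → X z ≡ true → ⊥
    full {x} {y} {z} c₀₁ c₀₂ c₁₂ _ _ _ Xx Xy Xz = gX (triangle x z y refl refl refl)
      (cycleSet (triangle x z y refl refl refl)) (cycleSet-isEdgeSet (triangle x z y refl refl refl))
      λ f m → case toSubset⁻ {f} (edges (triangle x z y refl refl refl)) m of
        λ { (here refl) → Xx ; (there (here refl)) → Xz ; (there (there (here refl))) → Xy }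
    go : Dec (Present 0F) → Dec (Present 1F) → Dec (Present 2F) → ∃[ κ ] (∀ e → X e ≡ true → κ ≢ cls (classOf e))
    go (no n) _ _ = 0F , λ e m q → n (e , m , q)
    go _ (no n) _ = 1F , λ e m q → n (e , m , q)
    go _ _ (no n) = 2F , λ e m q → n (e , m , q)
    go (yes (x , Xx , p)) (yes (y , Xy , q)) (yes (z , Xz , r)) = ⊥-elim
      (full (classOf x) (classOf y) (classOf z) p q r Xx Xy Xz)

  F-indep : IndepSet [ const false , const true ]
  F-indep k f inj fF = small⇒good (coded inj (λ i → proj₁ (at i)) λ i j e → trans (proj₂ (at i))
    (trans (cong inj₂ e) (sym (proj₂ (at j)))))
    where
    right : ∀ x → [ const false , const true ] x ≡ true → ∃[ j ] x ≡ inj₂ j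
    right (inj₁ _) ()
    right (inj₂ j) _ = j , refl
    at : ∀ i → ∃[ j ] f i ≡ inj₂ j
    at i = right (f i) (fF i)

  good-list : ∀ {X} → IndepSet X → ∀ zs → Distinct zs → (∀ x → x ∈ zs → X x ≡ true) → Good (length zs) (List.lookup zs)
  good-list iX zs d s = iX _ (List.lookup zs) (lookup-injective d) (λ i → s _ (∈-lookup i))

  -- The two points of F are independent, so the basis of F is all of F. A 2-edge cycle together
  -- with F lies in a `parallel` plane, and a longer cycle together with F has at least five points.
  contract⇒graphic : ∀ X → ContractIndep K X → GraphicIndep 3 Γ X
  contract⇒graphic X (B , (_ , maxB) , ind) C Y eq Y⊆X = go C (λ k → Y⊆X _ (Equivalence.from (eq _) (k , refl)))
    where
    Bi : ∀ i → B i ≡ true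
    Bi i = maxB (const true) (λ _ _ → refl) F-indep i refl
    F-distinct : Distinct {A = Point} (inj₂ 0F ∷ inj₂ 1F ∷ [])
    F-distinct = (λ { (here ()) ; (there ()) }) , (λ ()) , tt
    in-F : ∀ x → x ∈ inj₂ 0F ∷ inj₂ 1F ∷ [] → [ X , B ] x ≡ true
    in-F x (here refl) = Bi _
    in-F x (there (here refl)) = Bi _
    go : (C : Cycle 3 Γ) → (∀ k → X (Cycle.edg C k) ≡ true) → ⊥
    go record { len = zero ; edg = e ; einj = einj ; joins = joins } Xe = good-list ind
      (inj₁ (e 0F) ∷ inj₁ (e 1F) ∷ inj₂ 0F ∷ inj₂ 1F ∷ [])
      ((λ { (here q) → case einj (Sum.inj₁-injective q) of λ () ; (there (here ())) ; (there (there (here ()))) }) ,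
       (λ { (here ()) ; (there (here ())) }) , F-distinct)
      (λ { x (here refl) → Xe _ ; x (there (here refl)) → Xe _ ; x (there (there m)) → in-F x m })
      (parallel (src (e 0F)) (tgt (e 0F)) , λ { 0F → refl , refl ; 1F → sym (proj₁ same) , sym (proj₂ same) ; 2F → tt ; 3F →
        tt })
      where
      same : Same (e 0F) (e 1F)
      same = same-joins {e 0F} {e 1F} (joins 0F) (joins-flip {e 1F} (joins 1F))
    go record { len = suc _ ; edg = e ; einj = einj } Xe = good-list ind
      (inj₁ (e 0F) ∷ inj₁ (e 1F) ∷ inj₁ (e 2F) ∷ inj₂ 0F ∷ inj₂ 1F ∷ [])
      ((λ { (here q) → case einj (Sum.inj₁-injective q) of λ () ; (there (here q)) → case einj (Sum.inj₁-injective q) of λ ()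
          ; (there (there (here ()))) ; (there (there (there (here ())))) }) ,
       (λ { (here q) → case einj (Sum.inj₁-injective q) of λ () ; (there (here ())) ; (there (there (here ()))) }) ,
       (λ { (here ()) ; (there (here ())) }) , F-distinct)
      (λ { x (here refl) → Xe _ ; x (there (here refl)) → Xe _ ; x (there (there (here refl))) → Xe _ ; x
        (there (there (there m))) → in-F x m })

  module EdgeCode {X} (gX : GraphicIndep 3 Γ X) where
    private
      κ = proj₁ (graphic-missing gX)
      missing = proj₂ (graphic-missing gX)

    ecode : ∀ e → X e ≡ true → Fin 2
    ecode e m = punchOut (missing e m)

    ecode-injective : ∀ {e e′} m m′ → ecode e m ≡ ecode e′ m′ → e ≡ e′
    ecode-injective {e} {e′} m m′ q = graphic-parallel gX m m′
      (cls-same (classOf e) (classOf e′) (Fin.punchOut-injective (missing e m) (missing e′ m′) q))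

  -- A count: the acyclic set together with F has at most four points, at most three of them in any
  -- plane and at most two on any line. The codes into `Fin 4`, `Fin 3` and `Fin 2` are these
  -- bounds.
  graphic⇒contract : ∀ X → GraphicIndep 3 Γ X → ContractIndep K X
  graphic⇒contract X gX = const true , (F-indep , λ _ _ _ _ _ → refl) , ind
    where
    open EdgeCode gX
    XF : Subset Point
    XF = [ X , const true ]
    edges-code : ∀ x → XF x ≡ true → Fin 4
    edges-code (inj₁ e) m = ecode e m ↑ˡ 2
    edges-code (inj₂ i) m = 2 ↑ʳ i
    edges-code-injective : ∀ x y m m′ → edges-code x m ≡ edges-code y m′ → x ≡ y
    edges-code-injective (inj₁ e) (inj₁ e′) m m′ q = cong inj₁ (ecode-injective m m′ (Fin.↑ˡ-injective 2 _ _ q))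
    edges-code-injective (inj₂ i) (inj₂ j) m m′ q = cong inj₂ (Fin.↑ʳ-injective 2 i j q)
    edges-code-injective (inj₁ e) (inj₂ j) m m′ q = contradiction
      (trans (sym (Fin.splitAt-↑ˡ 2 (ecode e m) 2)) (trans (cong (splitAt 2) q) (Fin.splitAt-↑ʳ 2 2 j))) λ ()
    edges-code-injective (inj₂ j) (inj₁ e) m m′ q = contradiction
      (trans (sym (Fin.splitAt-↑ʳ 2 2 j)) (trans (cong (splitAt 2) q) (Fin.splitAt-↑ˡ 2 (ecode e m′) 2))) λ ()

    plane-code : ∀ π x → x ∈ᵖ π → XF x ≡ true → Fin 3
    plane-code (block _ _) (inj₁ e) _ m = inject₁ (ecode e m)
    plane-code (parallel _ _) (inj₁ e) _ m = fzero
    plane-code (parallel _ _) (inj₂ i) _ m = fsuc i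
    plane-code (spike _ _) (inj₁ e) _ m = fsuc (ecode e m)
    plane-code (spike _ _) (inj₂ i) _ m = fzero
    plane-code-injective : ∀ π x y p q m m′ → plane-code π x p m ≡ plane-code π y q m′ → x ≡ y
    plane-code-injective (block _ _) (inj₁ e) (inj₁ e′) _ _ m m′ r = cong inj₁
      (ecode-injective m m′ (Fin.inject₁-injective r))
    plane-code-injective (parallel _ _) (inj₁ e) (inj₁ e′) p q m m′ _ = cong inj₁
      (graphic-parallel gX m m′ (same-class {e} {e′} p q))
    plane-code-injective (parallel _ _) (inj₂ i) (inj₂ j) _ _ _ _ r = cong inj₂ (Fin.suc-injective r)
    plane-code-injective (spike _ _) (inj₁ e) (inj₁ e′) _ _ m m′ r = cong inj₁ (ecode-injective m m′ (Fin.suc-injective r))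
    plane-code-injective (spike _ _) (inj₂ i) (inj₂ j) refl refl _ _ _ = refl

    line-code : ∀ l x → x ∈ˡ l → XF x ≡ true → Fin 2
    line-code l (inj₁ e) _ m = ecode e m
    line-code-injective : ∀ l x y p q m m′ → line-code l x p m ≡ line-code l y q m′ → x ≡ y
    line-code-injective l (inj₁ e) (inj₁ e′) _ _ m m′ r = cong inj₁ (ecode-injective m m′ r)

    ind : IndepSet XF
    ind 0 f inj fX = tt
    ind 1 f inj fX = tt
    ind 2 f inj fX = tt
    ind 3 f inj fX (l , on) = ℕ.<-irrefl refl (coded inj (λ i → line-code l (f i) (on i) (fX i))
      λ i j → line-code-injective l (f i) (f j) (on i) (on j) (fX i) (fX j))
    ind 4 f inj fX (π , on) = ℕ.<-irrefl refl (coded inj (λ i → plane-code π (f i) (on i) (fX i))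
      λ i j → plane-code-injective π (f i) (f j) (on i) (on j) (fX i) (fX j))
    ind (suc (suc (suc (suc (suc k))))) f inj fX = contradiction
      (coded inj (λ i → edges-code (f i) (fX i)) λ i j → edges-code-injective (f i) (f j) (fX i) (fX j))
      λ { (s≤s (s≤s (s≤s (s≤s ())))) }

  contraction : ∀ X → ContractIndep K X ⇔ GraphicIndep 3 Γ X
  contraction X = mk⇔ (contract⇒graphic X) (graphic⇒contract X)

  only-edges : Subset E → Subset Point
  only-edges X = [ X , const false ]

  point : E → Point
  point = inj₁

  -- A 2-edge cycle is neither dependent nor balanced. The edges of a triangle belong to different
  -- parallel classes, so no coset line contains them, and a balanced line through them is a
  -- potential that all three fit. Longer cycles do not exist on three vertices.
  circuit⇔balanced : (C : Cycle 3 Γ) → ∀ X → EdgeSetOf C X → IsCircuit (Indep lift) X ⇔ Balanced C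
  circuit⇔balanced C X X-set = go C X-set
    where
    covers : ∀ (C : Cycle 3 Γ) → EdgeSetOf C X → ∀ x → only-edges X x ≡ true → ∃[ k ] point (Cycle.edg C k) ≡ x
    covers C X-set (inj₁ x) m = let (k , q) = Equivalence.to (X-set x) m in k , cong inj₁ q
    covers C X-set (inj₂ _) ()
    go : (C : Cycle 3 Γ) → EdgeSetOf C X → IsCircuit (Indep lift) X ⇔ Balanced C
    go C@record { len = zero ; edg = e ; einj = einj ; joins = joins } X-set = mk⇔
      (λ (dep , _) → contradiction (good⇒indepSet {2} {only-edges X} (point ∘ e) tt (covers C X-set)) dep)
      (λ b → case einj (same-val-ε (pathPotential C) {e 0F} {e 1F} same
        (fits⇒val (pathPotential C) (e 0F) (balanced⇒fits C b 0F))
        (fits⇒val (pathPotential C) (e 1F) (balanced⇒fits C b 1F))) of λ ())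
      where
      same : Same (e 0F) (e 1F)
      same = same-joins {e 0F} {e 1F} (joins 0F) (joins-flip {e 1F} (joins 1F))
    go C@record { len = suc zero ; vert = v ; edg = e ; vinj = vinj ; einj = einj ; joins = joins } X-set = mk⇔
      (λ (dep , _) → decidable-stable (_ ≟ _) λ nb → dep
        (good⇒indepSet {3} {only-edges X} (point ∘ e) (spread-out nb) (covers C X-set)))
      (λ b → (λ iX → iX 3 (point ∘ e) (λ q → einj (Sum.inj₁-injective q)) (λ i → Equivalence.from (X-set _) (i , refl))
                (balanced (pathPotential C) , λ i → fits⇒val (pathPotential C) (e i) (balanced⇒fits C b i))) , smaller)
      where
      spread-out : ¬ Balanced C → Good 3 (point ∘ e)
      spread-out nb (balanced p , on) = nb (fits⇒balanced C p (λ k → val⇒fits p (e k) (on k)))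
      spread-out nb (coset s t p a , on) = case vinj (other-endpoint {e 1F}
        (same-transfer {e 0F} {e 1F} (same-class {e 0F} {e 1F} (proj₁ (on 0F)) (proj₁ (on 1F))) (joins 0F)) (joins 1F)) of
          λ ()
      smaller : ∀ Y → Y ⊆ X → (∃[ f ] (X f ≡ true × Y f ≡ false)) → Indep lift Y
      smaller Y Y⊆X (f , Xf , Yf) with Equivalence.to (X-set f) Xf
      ... | k , refl = good⇒indepSet {2} {only-edges Y} (point ∘ e ∘ punchIn k) tt at
        where
        at : ∀ x → only-edges Y x ≡ true → ∃[ i ] point (e (punchIn k i)) ≡ x
        at (inj₁ x) m with Equivalence.to (X-set x) (Y⊆X x m)
        ... | i , refl = punchOut k≢i , cong (point ∘ e) (Fin.punchIn-punchOut k≢i)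
          where
          k≢i : k ≢ i
          k≢i refl = contradiction (trans (sym Yf) m) λ ()
        at (inj₂ _) ()
    go C@record { len = suc (suc _) ; vert = v ; vinj = vinj } X-set = contradiction
      (Fin.injective⇒≤ {f = v} vinj) λ { (s≤s (s≤s (s≤s ()))) }

  lift-inClass : InClass 3 Γ lift
  lift-inClass = Deletion.deletion-isLift K contraction , circuit⇔balanced

  graphic-rank : IsRank (GraphicIndep 3 Γ) 2
  graphic-rank = (toSubset star , star-graphic , star-size) , λ X s gX (f , inj , fX , _) → let open EdgeCode gX in
    Fin.injective⇒≤ {f = λ i → ecode (f i) (fX i)} (λ {i} {j} e → inj (ecode-injective (fX i) (fX j) e))

  private
    g = proj₁ nt
    h = proj₁ (proper g (proj₂ nt))
    ¬Hgh : ¬ H g h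
    ¬Hgh = proj₂ (proper g (proj₂ nt))
    h≢ε : h ≢ ε
    h≢ε e = ¬Hgh (subst (H g) (sym e) (∋ε g))
    C : Carrier → E
    C = edge 0F 2F z<s

  frame : List E
  frame = edge 0F 1F z<s ε ∷ C ε ∷ C g ∷ C h ∷ []

  frame-distinct : Distinct frame
  frame-distinct = (λ { (here ()) ; (there (here ())) ; (there (there (here ()))) ; (there (there (there ()))) }) ,
    (λ { (here q) → proj₂ nt (sym (cong label q)) ; (there (here q)) → h≢ε (sym (cong label q)) }) ,
    (λ { (here q) → ¬Hgh (subst (H g) (cong label q) (∋self g)) }) , (λ ()) , tt

  -- The first edge has another parallel class than the `C` edges, and `C ε`, `C g` cannot fit one
  -- potential. A `block` plane through the `C` edges would, after undoing the conjugation by the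
  -- potential at vertex 0, put `h` into the block of `g`.
  frame-spread : Good 4 (point ∘ List.lookup frame)
  frame-spread (parallel s t , on) = case trans (proj₂ (on 0F)) (sym (proj₂ (on 1F))) of λ ()
  frame-spread (spike p i , on) = proj₂ nt (sym (cong label (same-val-ε p {C ε} {C g} (refl , refl) (on 1F) (on 2F))))
  frame-spread (block p a , on) = ¬Hgh (subst₂ H (back g) (back h) (Block-conj part (p 0F ⁻¹)
    (transitive _ a _ (symmetric a _ (inA g (on 2F)) λ e → proj₂ nt
      (trans (sym (back g)) (trans (cong (cj (p 0F ⁻¹)) e) (Partitions.conj-ε Γ part _)))) (inA h (on 3F)))))
    where
    inA : ∀ x → H a (val p (C x)) → H a (cj (p 0F) x)
    inA x m = subst (H a) (trans (val-difference p {C x} {C ε} (refl , refl))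
      (cong (cj (p 0F)) (trans (cong (x ∙_) ε⁻¹≈ε) (identityʳ x)))) (∋∙ m (∋⁻¹ (on 1F)))
    back : ∀ x → cj (p 0F ⁻¹) (cj (p 0F) x) ≡ x
    back x = trans (conj-conj part (p 0F ⁻¹) (p 0F) x) (trans (cong (λ k → cj k x) (inverseˡ (p 0F))) (conj-id part x))

  lift-rank : IsRank (Indep lift) 4
  lift-rank = (toSubset frame , frame-indep , toSubset-size frame-distinct) , bound
    where
    frame-indep : Indep lift (toSubset frame)
    frame-indep = good⇒indepSet {4} {only-edges (toSubset frame)} (point ∘ List.lookup frame) frame-spread λ where
      (inj₁ x) m → let q = toSubset⁻ {x} frame m in index q , cong inj₁ (sym (Any.lookup-index q))
      (inj₂ _) ()
    bound : ∀ X s → Indep lift X → HasSize X s → s ≤ 4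
    bound X 0 _ _ = z≤n
    bound X 1 _ _ = s≤s z≤n
    bound X 2 _ _ = s≤s (s≤s z≤n)
    bound X 3 _ _ = s≤s (s≤s (s≤s z≤n))
    bound X 4 _ _ = s≤s (s≤s (s≤s (s≤s z≤n)))
    bound X (suc (suc (suc (suc (suc s))))) iX (f , inj , fX , _) = ⊥-elim
      (iX _ (point ∘ f) (λ q → inj (Sum.inj₁-injective q)) fX)

  lift-nonElementary : NonElementary 3 Γ lift
  lift-nonElementary = 2 , 4 , graphic-rank , lift-rank , ℕ.≤-refl

theorem1p6 : (Γ : FiniteGroup) → Nontrivial Γ → (n : ℕ) → 3 ≤ n →
    (Σ (Matroid (Edge n Γ)) λ L → InClass n Γ L × NonElementary n Γ L)
    ⇔ ((n ≡ 3 × HasNontrivialPartition Γ)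
       ⊎ (4 ≤ n × ∃[ p ] ∃[ j ] (Prime p × 2 ≤ j × IsoToZpj Γ p j)))
theorem1p6 Γ nt n 3≤n = mk⇔ (Necessity.necessity {Γ} nt n 3≤n) sufficiency
  where
  sufficiency : (n ≡ 3 × HasNontrivialPartition Γ) ⊎ (4 ≤ n × ∃[ p ] ∃[ j ] (Prime p × 2 ≤ j × IsoToZpj Γ p j)) →
    Σ (Matroid (Edge n Γ)) λ L → InClass n Γ L × NonElementary n Γ L
  sufficiency (inj₁ (refl , part)) = lift , lift-inClass , lift-nonElementary
    where open TriangleLiftClass {Γ} part nt
  sufficiency (inj₂ (s≤s (s≤s _) , p , j , isPrime , 2≤j , iso)) = elementary-sufficiency {Γ} {p = p} {j} isPrime 2≤j iso
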